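{- Let $(a_n)_{n\ge0}$ be the sequence, listed in increasing order, of the non-negative integers $m$ such that $840m+361$ is a perfect square. Define $t(n)=0$ if $n\equiv 0,1,3,5,10,12,14,15 \pmod{16}$ and $t(n)=1$ otherwise. Then $$\sum_{n=0}^\infty(-1)^{t(n)}q^{a_n}=\frac{(q,q^6,q^7;q^7)_\infty}{(q,q^4;q^5)_\infty}.$$
   Context: Here $q$ is a complex number with $|q|<1$ (equivalently, the identity may be read as an identity of formal power series in $q$). For a complex number $a$, $(a;q)_\infty:=\prod_{i=0}^\infty(1-aq^i)$, and $(a_1,a_2,\dots,a_m;q)_\infty:=\prod_{j=1}^m(a_j;q)_\infty$. -}

module Defs where

open import Data.Nat as ℕ using (ℕ; zero; suc; _≡ᵇ_; _<_; _%_)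
open import Data.Integer as ℤ using (ℤ; +_; -_; _-_)
open import Data.List using (List; []; _∷_; foldr; map; upTo)
open import Data.Bool using (if_then_else_)
open import Data.Product using (∃-syntax)
open import Relation.Binary.PropositionalEquality using (_≡_)

sumℤ : List ℤ → ℤ
sumℤ = foldr ℤ._+_ (+ 0)

-- Formal power series over ℤ in one variable q, as coefficient functions.
Series : Set
Series = ℕ → ℤ

one : Series
one zero    = + 1
one (suc _) = + 0

infixl 7 _⊛_
_⊛_ : Series → Series → Series
(f ⊛ g) n = sumℤ (map (λ i → f i ℤ.* g (n ℕ.∸ i)) (upTo (suc n)))

oneMinus : ℕ → Series
oneMinus e n = (if n ≡ᵇ 0 then + 1 else + 0) - (if n ≡ᵇ e then + 1 else + 0)

prodBelow : (ℕ → Series) → ℕ → Series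
prodBelow f M = foldr _⊛_ one (map f (upTo M))

-- (q^j ; q^k)_∞ = ∏_{i ≥ 0} (1 - q^{j + k i}), for j ≥ 1.
-- Its q^N coefficient only involves the factors with i ≤ N (since j + k i > N
-- when i > N and j ≥ 1), so it equals the q^N coefficient of the finite
-- product over i < N+1.
qPoch : ℕ → ℕ → Series
qPoch j k N = prodBelow (λ i → oneMinus (j ℕ.+ k ℕ.* i)) (suc N) N

-- Multiplicative inverse of a power series with constant term 1:
-- b_0 = 1, b_n = - Σ_{k=1}^{n} a_k b_{n-k}.
-- invRev a n = [b_n , b_{n-1} , ... , b_0]
private
  dot : Series → ℕ → List ℤ → ℤ
  dot a j []       = + 0
  dot a j (x ∷ xs) = a (suc j) ℤ.* x ℤ.+ dot a (suc j) xs

invRev : Series → ℕ → List ℤ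
invRev a zero    = + 1 ∷ []
invRev a (suc n) = (- dot a 0 (invRev a n)) ∷ invRev a n

inv : Series → Series
inv a n with invRev a n
... | []    = + 0
... | b ∷ _ = b

IsSq : ℕ → Set
IsSq x = ∃[ k ] k ℕ.* k ≡ x

tRes : ℕ → ℕ
tRes 0  = 0
tRes 1  = 0
tRes 3  = 0
tRes 5  = 0
tRes 10 = 0
tRes 12 = 0
tRes 14 = 0
tRes 15 = 0
tRes _  = 1

t : ℕ → ℕ
t n = tRes (n % 16)

sgn : ℕ → ℤ
sgn n = (- + 1) ℤ.^ t n

-- The series Σ_{n ≥ 0} (-1)^{t(n)} q^{a n} for a strictly increasing a.
-- Since a strictly increasing implies a n ≥ n, only n ≤ N can contribute
-- to the coefficient of q^N.
lhsSeries : (ℕ → ℕ) → Series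
lhsSeries a N = sumℤ (map (λ n → if a n ≡ᵇ N then sgn n else + 0) (upTo (suc N)))

rhsSeries : Series
rhsSeries = (qPoch 1 7 ⊛ qPoch 6 7 ⊛ qPoch 7 7) ⊛ inv (qPoch 1 5 ⊛ qPoch 4 5)

StrictlyIncreasing : (ℕ → ℕ) → Set
StrictlyIncreasing a = ∀ m n → m < n → a m < a n

{-# OPTIONS --safe #-}
module Submission where

-- Write P = (q,q⁶,q⁷;q⁷), Q = (q,q⁴;q⁵), P′ = (q²,q³,q⁵;q⁵) and D for the left-hand side.
-- Since Q P′ = (q;q), it suffices to show P P′ = (q;q) D.  By the Jacobi triple product
-- P, P′ and (q;q) are theta series: their exponents e satisfy 56e + 25 = (14j - 5)²,
-- 40e + 1 = (10n - 1)², 24e + 1 = (6j - 1)², while those of D satisfy 840e + 361 = l².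
-- Both products thus become signed sums over integral points of 5X² + 7Y² = 280N + 132 and of
-- 35k² + l² = 840N + 396.  These are compared through k = (X + Y)/2, l = (5X - 7Y)/2, the sign
-- of Y being chosen so that k is odd.  With l = 4p - k, both are sums over the points (k , p),
-- k odd, of the form 9k² - 2kp + 4p² with weights that agree except for a factor depending
-- on k and p modulo 3, and their difference is the sum over p ≡ 2k (mod 3) of w(l), which is
-- 1, -1 or 0 according as l is 26, 19 or anything else modulo 35.  That sum vanishes: with
-- p = 2k + 3h, g = k + h the form is 21g² + 15h², and g ↦ -g changes the sign of w(l).

open import Defs
open import Data.Bool using (if_then_else_; true; false; T)
open import Data.Empty using (⊥; ⊥-elim)
open import Data.Integer as ℤ using (ℤ; +_; -_; -[1+_]; _+_; _*_; _-_; _⊖_; ∣_∣; _%ℕ_; _/ℕ_)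
open import Data.Integer.DivMod using (a≡a%ℕn+[a/ℕn]*n; n%ℕd<d)
import Data.Integer.Properties as ℤₚ
open import Data.Integer.Tactic.RingSolver using (solve-∀)
open import Data.List using (List; []; _∷_; _++_; cartesianProduct; filter; foldr; length; map; upTo)
open import Data.List.Properties using (map-applyUpTo; map-∘)
open import Data.Nat as ℕ using (ℕ; zero; suc; z≤n; s≤s; _≡ᵇ_; _%_; _/_)
import Data.Nat.DivMod as ℕ
open import Data.Nat.Divisibility using (divides-refl)
open import Data.Nat.Induction using (<-rec)
import Data.Nat.Properties as ℕₚ
import Data.Nat.Tactic.RingSolver as ℕ-Solver
open import Data.Product using (_×_; _,_; proj₁; proj₂; ∃-syntax)
open import Data.Product.Properties using (≡-dec)
open import Data.Sum using (_⊎_; inj₁; inj₂)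
open import Function using (_∘_; id)
open import Function.Bundles using (_⇔_; Equivalence)
open import Relation.Binary.Definitions using (DecidableEquality; tri<; tri≈; tri>)
open import Relation.Binary.PropositionalEquality
open import Relation.Nullary using (¬_; Dec; yes; no; does)
open import Relation.Nullary.Decidable using (dec-false; dec-true; from-yes; _×-dec_; _⊎-dec_; _→-dec_)
open import Algebra.Properties.AbelianGroup ℤₚ.+-0-abelianGroup using () renaming (∙-cancelʳ to +-cancelʳ)

-- Multiplying by `P′` turns the denominator into `(q;q)`, so that every factor except `D` is a
-- theta series and each coefficient becomes a finite sum of signs over a conic. The signs decide
-- the proof. If the root `l` of `840 a n + 361` is normalised by `l ≡ 5 (mod 7)`, the pattern of
-- `t` modulo 16 is a product of three signs of `l`: the nontrivial characters modulo 4 and 3, and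
-- the sign in `l ≡ ±1 (mod 5)`. The sign `(-1)^j` of the pentagonal series is the product of the
-- characters modulo 4 and 3 at `k = ±(6j - 1)`. Since `k + l = 4p` with `k` odd, the two characters
-- modulo 4 multiply to `-1`, and what is left beside `w(l)` depends on residues modulo 3 only. For
-- `P P′` the corresponding factor is the condition `3 | p`, since there `p = 3 (X - Y) / 4`. The
-- finite lists that carry these sums contain many points that match nothing on the other side, so
-- sums are compared by a relation between the supports and not by a bijection of the lists.

private variable A B : Set

-- Finite sums over lists

∑ : List A → (A → ℤ) → ℤ
∑ xs f = sumℤ (map f xs)

∑-cong : {f g : A → ℤ} → (∀ x → f x ≡ g x) → ∀ xs → ∑ xs f ≡ ∑ xs g
∑-cong h []       = refl
∑-cong h (x ∷ xs) = cong₂ _+_ (h x) (∑-cong h xs)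

∑-zero : {f : A → ℤ} → (∀ x → f x ≡ + 0) → ∀ xs → ∑ xs f ≡ + 0
∑-zero h []       = refl
∑-zero h (x ∷ xs) rewrite h x | ∑-zero h xs = refl

∑-distrib-+ : ∀ (f g : A → ℤ) xs → ∑ xs (λ x → f x + g x) ≡ ∑ xs f + ∑ xs g
∑-distrib-+ f g []       = refl
∑-distrib-+ f g (x ∷ xs) rewrite ∑-distrib-+ f g xs = interchange (f x) (g x) _ _
  where
  interchange : ∀ a b c d → (a + b) + (c + d) ≡ (a + c) + (b + d)
  interchange = solve-∀

∑-distribˡ-* : ∀ c (f : A → ℤ) xs → ∑ xs (λ x → c * f x) ≡ c * ∑ xs f
∑-distribˡ-* c f []       = sym (ℤₚ.*-zeroʳ c)
∑-distribˡ-* c f (x ∷ xs) rewrite ∑-distribˡ-* c f xs = sym (ℤₚ.*-distribˡ-+ c (f x) _)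

∑-swap : ∀ (f : A → B → ℤ) xs ys → ∑ xs (λ x → ∑ ys (f x)) ≡ ∑ ys (λ y → ∑ xs (λ x → f x y))
∑-swap f []       ys = sym (∑-zero (λ _ → refl) ys)
∑-swap f (x ∷ xs) ys = trans (cong (_+_ (∑ ys (f x))) (∑-swap f xs ys))
                             (sym (∑-distrib-+ (f x) _ ys))

∑-++ : ∀ (f : A → ℤ) xs ys → ∑ (xs ++ ys) f ≡ ∑ xs f + ∑ ys f
∑-++ f []       ys = sym (ℤₚ.+-identityˡ _)
∑-++ f (x ∷ xs) ys rewrite ∑-++ f xs ys = sym (ℤₚ.+-assoc (f x) _ _)

∑-map : ∀ (f : B → ℤ) (g : A → B) xs → ∑ (map g xs) f ≡ ∑ xs (f ∘ g)
∑-map f g xs = cong sumℤ (sym (map-∘ xs))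

∑-cartesianProduct : ∀ (f : A × B → ℤ) xs ys →
                     ∑ (cartesianProduct xs ys) f ≡ ∑ xs (λ x → ∑ ys (λ y → f (x , y)))
∑-cartesianProduct f []       ys = refl
∑-cartesianProduct f (x ∷ xs) ys =
  trans (∑-++ f (map (x ,_) ys) (cartesianProduct xs ys))
        (cong₂ _+_ (∑-map f (x ,_) ys) (∑-cartesianProduct f xs ys))

∑-head : ∀ (f : ℕ → ℤ) n → ∑ (upTo (suc n)) f ≡ f 0 + ∑ (upTo n) (f ∘ suc)
∑-head f n = cong (λ l → f 0 + sumℤ l)
  (trans (map-applyUpTo suc f n) (sym (map-applyUpTo id (f ∘ suc) n)))

∑-last : ∀ (f : ℕ → ℤ) n → ∑ (upTo (suc n)) f ≡ ∑ (upTo n) f + f n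
∑-last f zero    = trans (ℤₚ.+-identityʳ (f 0)) (sym (ℤₚ.+-identityˡ (f 0)))
∑-last f (suc n) =
  trans (∑-head f (suc n))
 (trans (cong (_+_ (f 0)) (∑-last (f ∘ suc) n))
 (trans (sym (ℤₚ.+-assoc (f 0) _ _))
        (cong (ℤ._+ f (suc n)) (sym (∑-head f n)))))

-- Formal power series

tail : Series → Series
tail f n = f (suc n)

⊛-zero : ∀ f g → (f ⊛ g) 0 ≡ f 0 * g 0
⊛-zero f g = ℤₚ.+-identityʳ _

-- Splitting off the term `i = 0` makes the Cauchy product a recursion on `tail f`. Congruence,
-- commutativity and associativity follow by induction on the coefficient, with no reasoning about
-- the truncated subtraction in `⊛`.
⊛-suc : ∀ f g n → (f ⊛ g) (suc n) ≡ f 0 * g (suc n) + (tail f ⊛ g) n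
⊛-suc f g n = ∑-head (λ i → f i * g (suc n ℕ.∸ i)) (suc n)

infix 4 _≈[_]_
-- Congruence modulo `q^(N+1)`: the sense in which an infinite product is replaced by a finite one
-- and a theta series by a finite sum.
_≈[_]_ : Series → ℕ → Series → Set
f ≈[ N ] g = ∀ n → n ℕ.≤ N → f n ≡ g n

≈-tail : ∀ {f g N} → f ≈[ suc N ] g → tail f ≈[ N ] tail g
≈-tail p n n≤N = p (suc n) (s≤s n≤N)

≈-mono : ∀ {f g N M} → M ℕ.≤ N → f ≈[ N ] g → f ≈[ M ] g
≈-mono M≤N p n n≤M = p n (ℕₚ.≤-trans n≤M M≤N)

≈-sym : ∀ {f g N} → f ≈[ N ] g → g ≈[ N ] f
≈-sym p n n≤N = sym (p n n≤N)

⊛-cong-at : ∀ {f f′ g g′} N → f ≈[ N ] f′ → g ≈[ N ] g′ → (f ⊛ g) N ≡ (f′ ⊛ g′) N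
⊛-cong-at {f} {f′} {g} {g′} zero p q =
  trans (⊛-zero f g) (trans (cong₂ _*_ (p 0 z≤n) (q 0 z≤n)) (sym (⊛-zero f′ g′)))
⊛-cong-at {f} {f′} {g} {g′} (suc N) p q =
  trans (⊛-suc f g N)
 (trans (cong₂ _+_ (cong₂ _*_ (p 0 z≤n) (q (suc N) ℕₚ.≤-refl))
                     (⊛-cong-at {tail f} {tail f′} {g} {g′} N (≈-tail {f} {f′} p) (≈-mono {g} {g′} (ℕₚ.n≤1+n N) q)))
        (sym (⊛-suc f′ g′ N)))

⊛-cong-≈ : ∀ {f f′ g g′ N} → f ≈[ N ] f′ → g ≈[ N ] g′ → (f ⊛ g) ≈[ N ] (f′ ⊛ g′)
⊛-cong-≈ {f} {f′} {g} {g′} p q n n≤N =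
  ⊛-cong-at {f} {f′} {g} {g′} n (≈-mono {f} {f′} n≤N p) (≈-mono {g} {g′} n≤N q)

⊛-cong : ∀ {f f′ g g′} → f ≗ f′ → g ≗ g′ → (f ⊛ g) ≗ (f′ ⊛ g′)
⊛-cong {f} {f′} {g} {g′} p q n = ⊛-cong-at {f} {f′} {g} {g′} n (λ m _ → p m) (λ m _ → q m)

⊛-congʳ : ∀ f {g g′} → g ≗ g′ → (f ⊛ g) ≗ (f ⊛ g′)
⊛-congʳ f {g} {g′} = ⊛-cong {f} {f} {g} {g′} (λ _ → refl)

⊛-congˡ : ∀ g {f f′} → f ≗ f′ → (f ⊛ g) ≗ (f′ ⊛ g)
⊛-congˡ g {f} {f′} p = ⊛-cong {f} {f′} {g} {g} p (λ _ → refl)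

⊛-zeroˡ : ∀ {f} g → (∀ n → f n ≡ + 0) → ∀ n → (f ⊛ g) n ≡ + 0
⊛-zeroˡ g z n = ∑-zero (λ i → trans (cong (ℤ._* g (n ℕ.∸ i)) (z i)) (ℤₚ.*-zeroˡ (g (n ℕ.∸ i)))) (upTo (suc n))

⊛-distribʳ-+ : ∀ f g h n → ((λ i → f i + g i) ⊛ h) n ≡ (f ⊛ h) n + (g ⊛ h) n
⊛-distribʳ-+ f g h n =
  trans (∑-cong (λ i → ℤₚ.*-distribʳ-+ (h (n ℕ.∸ i)) (f i) (g i)) (upTo (suc n)))
        (∑-distrib-+ (λ i → f i * h (n ℕ.∸ i)) (λ i → g i * h (n ℕ.∸ i)) (upTo (suc n)))

⊛-scaleˡ : ∀ c f g n → ((λ i → c * f i) ⊛ g) n ≡ c * (f ⊛ g) n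
⊛-scaleˡ c f g n =
  trans (∑-cong (λ i → ℤₚ.*-assoc c (f i) (g (n ℕ.∸ i))) (upTo (suc n)))
        (∑-distribˡ-* c (λ i → f i * g (n ℕ.∸ i)) (upTo (suc n)))

⊛-sucʳ : ∀ f g n → (f ⊛ g) (suc n) ≡ f (suc n) * g 0 + (f ⊛ tail g) n
⊛-sucʳ f g zero =
  trans (⊛-suc f g 0)
 (trans (cong (_+_ (f 0 * g 1)) (⊛-zero (tail f) g))
 (trans (ℤₚ.+-comm (f 0 * g 1) _)
        (cong (_+_ (f 1 * g 0)) (sym (⊛-zero f (tail g))))))
⊛-sucʳ f g (suc n) =
  trans (⊛-suc f g (suc n))
 (trans (cong (_+_ (f 0 * g (2 ℕ.+ n))) (⊛-sucʳ (tail f) g n))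
 (trans (swap (f 0 * g (2 ℕ.+ n)) (f (2 ℕ.+ n) * g 0) _)
        (cong (_+_ (f (2 ℕ.+ n) * g 0)) (sym (⊛-suc f (tail g) n)))))
  where
  swap : ∀ x y z → x + (y + z) ≡ y + (x + z)
  swap = solve-∀

⊛-comm : ∀ f g → (f ⊛ g) ≗ (g ⊛ f)
⊛-comm f g zero    = trans (⊛-zero f g) (trans (ℤₚ.*-comm (f 0) (g 0)) (sym (⊛-zero g f)))
⊛-comm f g (suc n) =
  trans (⊛-suc f g n)
 (trans (cong₂ _+_ (ℤₚ.*-comm (f 0) (g (suc n))) (⊛-comm (tail f) g n))
        (sym (⊛-sucʳ g f n)))

⊛-assoc : ∀ f g h → ((f ⊛ g) ⊛ h) ≗ (f ⊛ (g ⊛ h))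
⊛-assoc f g h zero =
  trans (⊛-zero (f ⊛ g) h)
 (trans (cong (ℤ._* h 0) (⊛-zero f g))
 (trans (ℤₚ.*-assoc (f 0) (g 0) (h 0))
 (trans (cong (f 0 *_) (sym (⊛-zero g h)))
        (sym (⊛-zero f (g ⊛ h))))))
⊛-assoc f g h (suc n) = begin
  ((f ⊛ g) ⊛ h) (suc n)
    ≡⟨ ⊛-suc (f ⊛ g) h n ⟩
  (f ⊛ g) 0 * h (suc n) + (tail (f ⊛ g) ⊛ h) n
    ≡⟨ cong₂ _+_ (cong (ℤ._* h (suc n)) (⊛-zero f g)) (⊛-congˡ h (⊛-suc f g) n) ⟩
  f 0 * g 0 * h (suc n) + ((λ i → f 0 * g (suc i) + (tail f ⊛ g) i) ⊛ h) n
    ≡⟨ cong (_+_ (f 0 * g 0 * h (suc n)))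
         (trans (⊛-distribʳ-+ (λ i → f 0 * g (suc i)) (tail f ⊛ g) h n)
                (cong₂ _+_ (⊛-scaleˡ (f 0) (tail g) h n) (⊛-assoc (tail f) g h n))) ⟩
  f 0 * g 0 * h (suc n) + (f 0 * (tail g ⊛ h) n + (tail f ⊛ (g ⊛ h)) n)
    ≡⟨ factor (f 0) (g 0) (h (suc n)) _ _ ⟩
  f 0 * (g 0 * h (suc n) + (tail g ⊛ h) n) + (tail f ⊛ (g ⊛ h)) n
    ≡⟨ cong (λ x → f 0 * x + (tail f ⊛ (g ⊛ h)) n) (sym (⊛-suc g h n)) ⟩
  f 0 * (g ⊛ h) (suc n) + (tail f ⊛ (g ⊛ h)) n
    ≡⟨ sym (⊛-suc f (g ⊛ h) n) ⟩
  (f ⊛ (g ⊛ h)) (suc n) ∎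
  where
  open ≡-Reasoning
  factor : ∀ a b c d e → a * b * c + (a * d + e) ≡ a * (b * c + d) + e
  factor = solve-∀

⊛-identityˡ : ∀ f → (one ⊛ f) ≗ f
⊛-identityˡ f zero    = trans (⊛-zero one f) (ℤₚ.*-identityˡ (f 0))
⊛-identityˡ f (suc n) =
  trans (⊛-suc one f n)
 (trans (cong₂ _+_ (ℤₚ.*-identityˡ (f (suc n))) (⊛-zeroˡ f (λ _ → refl) n))
        (ℤₚ.+-identityʳ (f (suc n))))

⊛-identityʳ : ∀ f → (f ⊛ one) ≗ f
⊛-identityʳ f n = trans (⊛-comm f one n) (⊛-identityˡ f n)

∑-⊛ : ∀ (F : A → Series) g xs N →
      ((λ n → ∑ xs (λ x → F x n)) ⊛ g) N ≡ ∑ xs (λ x → (F x ⊛ g) N)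
∑-⊛ F g []       N = ⊛-zeroˡ g (λ _ → refl) N
∑-⊛ F g (x ∷ xs) N =
  trans (⊛-distribʳ-+ (F x) (λ n → ∑ xs (λ y → F y n)) g N)
        (cong (_+_ ((F x ⊛ g) N)) (∑-⊛ F g xs N))

mono : ℕ → Series
mono e n = if n ≡ᵇ e then + 1 else + 0

mono-0 : mono 0 ≗ one
mono-0 zero    = refl
mono-0 (suc n) = refl

mono-0-⊛ : ∀ g → (mono 0 ⊛ g) ≗ g
mono-0-⊛ g n = trans (⊛-congˡ g mono-0 n) (⊛-identityˡ g n)

mono-suc-⊛-zero : ∀ e g → (mono (suc e) ⊛ g) 0 ≡ + 0
mono-suc-⊛-zero e g = trans (⊛-zero (mono (suc e)) g) (ℤₚ.*-zeroˡ (g 0))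

mono-suc-⊛-suc : ∀ e g n → (mono (suc e) ⊛ g) (suc n) ≡ (mono e ⊛ g) n
mono-suc-⊛-suc e g n =
  trans (⊛-suc (mono (suc e)) g n)
 (trans (cong (ℤ._+ (mono e ⊛ g) n) (ℤₚ.*-zeroˡ (g (suc n)))) (ℤₚ.+-identityˡ _))

-- Multiplication by `q^e` is a shift, so the coefficient at `N` sees `g` only up to degree `N - e`.
mono-⊛-cong : ∀ e {g h} N → (∀ i → e ℕ.+ i ℕ.≤ N → g i ≡ h i) → (mono e ⊛ g) N ≡ (mono e ⊛ h) N
mono-⊛-cong zero {g} {h} N p = trans (mono-0-⊛ g N) (trans (p N ℕₚ.≤-refl) (sym (mono-0-⊛ h N)))
mono-⊛-cong (suc e) {g} {h} zero p = trans (mono-suc-⊛-zero e g) (sym (mono-suc-⊛-zero e h))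
mono-⊛-cong (suc e) {g} {h} (suc N) p =
  trans (mono-suc-⊛-suc e g N)
 (trans (mono-⊛-cong e {g} {h} N (λ i q → p i (s≤s q))) (sym (mono-suc-⊛-suc e h N)))

⊛-zeroʳ : ∀ f n → (f ⊛ (λ _ → + 0)) n ≡ + 0
⊛-zeroʳ f n = trans (⊛-comm f (λ _ → + 0) n) (⊛-zeroˡ f (λ _ → refl) n)

mono-⊛-low : ∀ e g {N} → N ℕ.< e → (mono e ⊛ g) N ≡ + 0
mono-⊛-low e g {N} N<e =
  trans (mono-⊛-cong e {g} {λ _ → + 0} N (λ i q → ⊥-elim (ℕₚ.<⇒≱ N<e (ℕₚ.≤-trans (ℕₚ.m≤m+n e i) q))))
        (⊛-zeroʳ (mono e) N)

mono-⊛-mono : ∀ d e → (mono d ⊛ mono e) ≗ mono (d ℕ.+ e)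
mono-⊛-mono zero    e n       = mono-0-⊛ (mono e) n
mono-⊛-mono (suc d) e zero    = mono-suc-⊛-zero d (mono e)
mono-⊛-mono (suc d) e (suc n) = trans (mono-suc-⊛-suc d (mono e) n) (mono-⊛-mono d e n)

mono-⊛-mono-⊛ : ∀ d e g → (mono d ⊛ (mono e ⊛ g)) ≗ (mono (d ℕ.+ e) ⊛ g)
mono-⊛-mono-⊛ d e g n =
  trans (sym (⊛-assoc (mono d) (mono e) g n)) (⊛-congˡ g (mono-⊛-mono d e) n)

oneMinus-⊛ : ∀ e g n → (oneMinus e ⊛ g) n ≡ g n - (mono e ⊛ g) n
oneMinus-⊛ e g n = begin
  (oneMinus e ⊛ g) n
    ≡⟨ ⊛-congˡ g split n ⟩
  ((λ i → one i + (- + 1) * mono e i) ⊛ g) n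
    ≡⟨ ⊛-distribʳ-+ one (λ i → (- + 1) * mono e i) g n ⟩
  (one ⊛ g) n + ((λ i → (- + 1) * mono e i) ⊛ g) n
    ≡⟨ cong₂ _+_ (⊛-identityˡ g n) (trans (⊛-scaleˡ (- + 1) (mono e) g n) (ℤₚ.-1*i≡-i _)) ⟩
  g n - (mono e ⊛ g) n ∎
  where
  open ≡-Reasoning
  split : ∀ i → oneMinus e i ≡ one i + (- + 1) * mono e i
  split i = cong₂ _+_ (mono-0 i) (sym (ℤₚ.-1*i≡-i (mono e i)))

oneMinus-⊛-high : ∀ e g {N} → N ℕ.< e → (oneMinus e ⊛ g) ≈[ N ] g
oneMinus-⊛-high e g N<e n n≤N =
  trans (oneMinus-⊛ e g n)
 (trans (cong (λ x → g n - x) (mono-⊛-low e g (ℕₚ.≤-<-trans n≤N N<e))) (ℤₚ.+-identityʳ (g n)))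

-- Infinite products

prodBelow-head : ∀ f M → prodBelow f (suc M) ≗ (f 0 ⊛ prodBelow (f ∘ suc) M)
prodBelow-head f M n = cong (λ l → (f 0 ⊛ foldr _⊛_ one l) n)
  (trans (map-applyUpTo suc f M) (sym (map-applyUpTo id (f ∘ suc) M)))

prodBelow-cong : ∀ {f g} → (∀ i → f i ≗ g i) → ∀ M → prodBelow f M ≗ prodBelow g M
prodBelow-cong p zero    n = refl
prodBelow-cong {f} {g} p (suc M) n =
  trans (prodBelow-head f M n)
 (trans (⊛-cong (p 0) (prodBelow-cong (p ∘ suc) M) n) (sym (prodBelow-head g M n)))

prodBelow-last : ∀ f M → prodBelow f (suc M) ≗ (prodBelow f M ⊛ f M)
prodBelow-last f zero n = ⊛-comm (f 0) one n
prodBelow-last f (suc M) n = begin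
  prodBelow f (suc (suc M)) n
    ≡⟨ prodBelow-head f (suc M) n ⟩
  (f 0 ⊛ prodBelow (f ∘ suc) (suc M)) n
    ≡⟨ ⊛-congʳ (f 0) (prodBelow-last (f ∘ suc) M) n ⟩
  (f 0 ⊛ (prodBelow (f ∘ suc) M ⊛ f (suc M))) n
    ≡⟨ sym (⊛-assoc (f 0) (prodBelow (f ∘ suc) M) (f (suc M)) n) ⟩
  ((f 0 ⊛ prodBelow (f ∘ suc) M) ⊛ f (suc M)) n
    ≡⟨ ⊛-congˡ (f (suc M)) (λ m → sym (prodBelow-head f M m)) n ⟩
  (prodBelow f (suc M) ⊛ f (suc M)) n ∎
  where open ≡-Reasoning

⊛-swap : ∀ f g h → (f ⊛ (g ⊛ h)) ≗ (g ⊛ (f ⊛ h))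
⊛-swap f g h n =
  trans (sym (⊛-assoc f g h n)) (trans (⊛-congˡ h (⊛-comm f g) n) (⊛-assoc g f h n))

⊛-interchange : ∀ a b c d → ((a ⊛ b) ⊛ (c ⊛ d)) ≗ ((a ⊛ c) ⊛ (b ⊛ d))
⊛-interchange a b c d n = begin
  ((a ⊛ b) ⊛ (c ⊛ d)) n ≡⟨ ⊛-assoc a b (c ⊛ d) n ⟩
  (a ⊛ (b ⊛ (c ⊛ d))) n ≡⟨ ⊛-congʳ a (⊛-swap b c d) n ⟩
  (a ⊛ (c ⊛ (b ⊛ d))) n ≡⟨ sym (⊛-assoc a c (b ⊛ d) n) ⟩
  ((a ⊛ c) ⊛ (b ⊛ d)) n ∎
  where
  open ≡-Reasoning

prodBelow-⊛ : ∀ f g M → prodBelow (λ i → f i ⊛ g i) M ≗ (prodBelow f M ⊛ prodBelow g M)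
prodBelow-⊛ f g zero    n = sym (⊛-identityˡ one n)
prodBelow-⊛ f g (suc M) n =
  trans (prodBelow-head (λ i → f i ⊛ g i) M n)
 (trans (⊛-congʳ (f 0 ⊛ g 0) (prodBelow-⊛ (f ∘ suc) (g ∘ suc) M) n)
 (trans (⊛-interchange (f 0) (g 0) (prodBelow (f ∘ suc) M) (prodBelow (g ∘ suc) M) n)
        (⊛-cong (λ m → sym (prodBelow-head f M m)) (λ m → sym (prodBelow-head g M m)) n)))

prodBelow-one : ∀ M → prodBelow (λ _ → one) M ≗ one
prodBelow-one zero    n = refl
prodBelow-one (suc M) n =
  trans (prodBelow-head (λ _ → one) M n)
 (trans (⊛-identityˡ (prodBelow (λ _ → one) M) n) (prodBelow-one M n))

prodBelow-swap : ∀ (f : ℕ → ℕ → Series) L M →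
  prodBelow (λ i → prodBelow (f i) L) M ≗ prodBelow (λ r → prodBelow (λ i → f i r) M) L
prodBelow-swap f L zero    n = sym (prodBelow-one L n)
prodBelow-swap f L (suc M) n = begin
  prodBelow (λ i → prodBelow (f i) L) (suc M) n
    ≡⟨ prodBelow-last (λ i → prodBelow (f i) L) M n ⟩
  (prodBelow (λ i → prodBelow (f i) L) M ⊛ prodBelow (f M) L) n
    ≡⟨ ⊛-congˡ (prodBelow (f M) L) (prodBelow-swap f L M) n ⟩
  (prodBelow (λ r → prodBelow (λ i → f i r) M) L ⊛ prodBelow (f M) L) n
    ≡⟨ sym (prodBelow-⊛ (λ r → prodBelow (λ i → f i r) M) (f M) L n) ⟩
  prodBelow (λ r → prodBelow (λ i → f i r) M ⊛ f M r) L n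
    ≡⟨ prodBelow-cong (λ r m → sym (prodBelow-last (λ i → f i r) M m)) L n ⟩
  prodBelow (λ r → prodBelow (λ i → f i r) (suc M)) L n ∎
  where open ≡-Reasoning

prodBelow-+ : ∀ h L M → prodBelow h (L ℕ.+ M) ≗ (prodBelow h L ⊛ prodBelow (λ i → h (L ℕ.+ i)) M)
prodBelow-+ h zero    M n = sym (⊛-identityˡ (prodBelow h M) n)
prodBelow-+ h (suc L) M n =
  trans (prodBelow-head h (L ℕ.+ M) n)
 (trans (⊛-congʳ (h 0) (prodBelow-+ (h ∘ suc) L M) n)
 (trans (sym (⊛-assoc (h 0) (prodBelow (h ∘ suc) L) rest n))
        (⊛-congˡ rest (λ m → sym (prodBelow-head h L m)) n)))
  where rest = prodBelow (λ i → h (suc L ℕ.+ i)) M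

-- Cuts the product into consecutive blocks of length `L`. Followed by `prodBelow-swap`, it sorts
-- the factors by the residue of their index modulo `L`.
prodBelow-blocks : ∀ L h M →
  prodBelow h (M ℕ.* L) ≗ prodBelow (λ i → prodBelow (λ r → h (r ℕ.+ L ℕ.* i)) L) M
prodBelow-blocks L h zero    n = refl
prodBelow-blocks L h (suc M) n =
  trans (prodBelow-+ h L (M ℕ.* L) n)
 (trans (⊛-cong (prodBelow-cong (λ r m → cong (λ x → h x m) (first r)) L)
                (λ m → trans (prodBelow-blocks L (λ i → h (L ℕ.+ i)) M m)
                  (prodBelow-cong (λ i → prodBelow-cong
                    (λ r k → cong (λ x → h x k) (next r i)) L) M m)) n)
        (sym (prodBelow-head (λ i → prodBelow (λ r → h (r ℕ.+ L ℕ.* i)) L) M n)))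
  where
  first : ∀ r → r ≡ r ℕ.+ L ℕ.* 0
  first r = sym (trans (cong (r ℕ.+_) (ℕₚ.*-zeroʳ L)) (ℕₚ.+-identityʳ r))
  next : ∀ r i → L ℕ.+ (r ℕ.+ L ℕ.* i) ≡ r ℕ.+ L ℕ.* suc i
  next r i = trans (sym (ℕₚ.+-assoc L r _))
            (trans (cong (ℕ._+ L ℕ.* i) (ℕₚ.+-comm L r))
            (trans (ℕₚ.+-assoc r L _) (cong (r ℕ.+_) (sym (ℕₚ.*-suc L i)))))

factors : ℕ → ℕ → ℕ → Series
factors j k i = oneMinus (j ℕ.+ k ℕ.* i)

prodBelow-stable : ∀ j k .{{_ : ℕ.NonZero j}} .{{_ : ℕ.NonZero k}} N d →
                   prodBelow (factors j k) (d ℕ.+ suc N) ≈[ N ] prodBelow (factors j k) (suc N)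
prodBelow-stable j k N zero    n n≤N = refl
prodBelow-stable j k N (suc d) n n≤N =
  trans (prodBelow-last (factors j k) (d ℕ.+ suc N) n)
 (trans (⊛-comm (prodBelow (factors j k) (d ℕ.+ suc N)) (factors j k (d ℕ.+ suc N)) n)
 (trans (oneMinus-⊛-high _ (prodBelow (factors j k) (d ℕ.+ suc N)) large n n≤N)
        (prodBelow-stable j k N d n n≤N)))
  where
  large : N ℕ.< j ℕ.+ k ℕ.* (d ℕ.+ suc N)
  large = ℕₚ.≤-trans (ℕₚ.m≤n+m (suc N) d)
         (ℕₚ.≤-trans (ℕₚ.m≤n*m (d ℕ.+ suc N) k) (ℕₚ.m≤n+m _ j))

-- The number of factors in `qPoch` varies with the coefficient; a fixed `M` beyond `N` serves all
-- coefficients up to `N` at once, because the additional factors are 1 modulo `q^(N+1)`.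
qPoch-finite : ∀ j k .{{_ : ℕ.NonZero j}} .{{_ : ℕ.NonZero k}} N M → N ℕ.< M →
               qPoch j k ≈[ N ] prodBelow (factors j k) M
qPoch-finite j k N M N<M n n≤N =
  sym (subst (λ m → prodBelow (factors j k) m n ≡ qPoch j k n)
             (ℕₚ.m∸n+n≡m (ℕₚ.≤-trans (s≤s n≤N) N<M))
             (prodBelow-stable j k n (M ℕ.∸ suc n) n ℕₚ.≤-refl))

qPoch-unfold : ∀ j k .{{_ : ℕ.NonZero j}} .{{_ : ℕ.NonZero k}} →
               qPoch j k ≗ (oneMinus j ⊛ qPoch (k ℕ.+ j) k)
qPoch-unfold j k@(suc k′) N = begin
  qPoch j k N
    -- One factor more than `qPoch` takes at `N`, so that `suc N` of them remain after the first is
    -- split off.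
    ≡⟨ qPoch-finite j k N (suc (suc N)) (ℕₚ.m<n⇒m<1+n (ℕₚ.n<1+n N)) N ℕₚ.≤-refl ⟩
  prodBelow (factors j k) (suc (suc N)) N
    ≡⟨ prodBelow-head (factors j k) (suc N) N ⟩
  (factors j k 0 ⊛ prodBelow (factors j k ∘ suc) (suc N)) N
    ≡⟨ ⊛-cong (λ m → cong (λ x → oneMinus x m) e₀)
              (prodBelow-cong (λ i m → cong (λ x → oneMinus x m) (e₁ i)) (suc N)) N ⟩
  (oneMinus j ⊛ prodBelow (factors (k ℕ.+ j) k) (suc N)) N
    ≡⟨ ⊛-cong-at {f = oneMinus j} N (λ _ _ → refl)
                 (≈-sym (qPoch-finite (k ℕ.+ j) k N (suc N) (ℕₚ.n<1+n N))) ⟩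
  (oneMinus j ⊛ qPoch (k ℕ.+ j) k) N ∎
  where
  open ≡-Reasoning
  e₀ : j ℕ.+ k ℕ.* 0 ≡ j
  e₀ = trans (cong (j ℕ.+_) (ℕₚ.*-zeroʳ k)) (ℕₚ.+-identityʳ j)
  e₁ : ∀ i → j ℕ.+ k ℕ.* suc i ≡ (k ℕ.+ j) ℕ.+ k ℕ.* i
  e₁ i = trans (cong (j ℕ.+_) (ℕₚ.*-suc k i))
        (trans (sym (ℕₚ.+-assoc j k _)) (cong (ℕ._+ k ℕ.* i) (ℕₚ.+-comm j k)))

qPoch-low : ∀ j k .{{_ : ℕ.NonZero j}} .{{_ : ℕ.NonZero k}} N → N ℕ.< j → qPoch j k N ≡ one N
qPoch-low j k N N<j = go (suc N)
  where
  go : ∀ M → prodBelow (factors j k) M N ≡ one N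
  go zero    = refl
  go (suc M) =
    trans (prodBelow-last (factors j k) M N)
   (trans (⊛-comm (prodBelow (factors j k) M) (factors j k M) N)
   (trans (oneMinus-⊛-high _ (prodBelow (factors j k) M)
             (ℕₚ.≤-trans N<j (ℕₚ.m≤m+n j _)) N ℕₚ.≤-refl) (go M)))

-- Multiplicative inverses

private
  dotFrom : Series → ℕ → List ℤ → ℤ
  dotFrom a j []       = + 0
  dotFrom a j (x ∷ xs) = a (suc j) * x + dotFrom a (suc j) xs

-- The left-hand side of dot≡dotFrom is the private function dot of Defs; it cannot be named
-- here and is found by unification with the goal of inv-suc.
mutual
  dot≡dotFrom : ∀ a j xs → _ ≡ dotFrom a j xs

  inv-suc : ∀ a n → inv a (suc n) ≡ - dotFrom a 0 (invRev a n)
  inv-suc a n with zero | invRev a n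
  ... | j | xs = cong -_ (dot≡dotFrom a j xs)

  dot≡dotFrom a j []       = refl
  dot≡dotFrom a j (x ∷ xs) = cong (_+_ (a (suc j) * x)) (dot≡dotFrom a (suc j) xs)

-- `invRev a n` lists `b_n` down to `b_0` while the index of `a` increases, which is a Cauchy
-- product with a shifted copy of `a`. The offset `j` has to be general because each step of the
-- recursion raises it.
dotFrom-invRev : ∀ a j n → dotFrom a j (invRev a n) ≡ ((λ i → a (suc (j ℕ.+ i))) ⊛ inv a) n
dotFrom-invRev a j zero    =
  cong (λ i → a (suc i) * + 1 + + 0) (sym (ℕₚ.+-identityʳ j))
dotFrom-invRev a j (suc n) = begin
  a (suc j) * inv a (suc n) + dotFrom a (suc j) (invRev a n)
    ≡⟨ cong₂ (λ i x → a (suc i) * inv a (suc n) + x) (sym (ℕₚ.+-identityʳ j)) (dotFrom-invRev a (suc j) n) ⟩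
  a (suc (j ℕ.+ 0)) * inv a (suc n) + ((λ i → a (suc (suc j ℕ.+ i))) ⊛ inv a) n
    ≡⟨ cong (_+_ (a (suc (j ℕ.+ 0)) * inv a (suc n)))
         (⊛-congˡ (inv a) (λ i → cong (λ x → a (suc x)) (sym (ℕₚ.+-suc j i))) n) ⟩
  a (suc (j ℕ.+ 0)) * inv a (suc n) + ((λ i → a (suc (j ℕ.+ suc i))) ⊛ inv a) n
    ≡⟨ sym (⊛-suc (λ i → a (suc (j ℕ.+ i))) (inv a) n) ⟩
  ((λ i → a (suc (j ℕ.+ i))) ⊛ inv a) (suc n) ∎
  where open ≡-Reasoning

inverseʳ : ∀ a → a 0 ≡ + 1 → (a ⊛ inv a) ≗ one
inverseʳ a a₀ zero    = trans (⊛-zero a (inv a)) (cong (_* + 1) a₀)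
inverseʳ a a₀ (suc n) = begin
  (a ⊛ inv a) (suc n)
    ≡⟨ ⊛-suc a (inv a) n ⟩
  a 0 * inv a (suc n) + (tail a ⊛ inv a) n
    ≡⟨ cong₂ (λ x y → x * y + (tail a ⊛ inv a) n) a₀ (trans (inv-suc a n) (cong -_ (dotFrom-invRev a 0 n))) ⟩
  + 1 * - (tail a ⊛ inv a) n + (tail a ⊛ inv a) n
    ≡⟨ cancel ((tail a ⊛ inv a) n) ⟩
  + 0 ∎
  where
  open ≡-Reasoning
  cancel : ∀ x → + 1 * - x + x ≡ + 0
  cancel = solve-∀

-- The Jacobi triple product

[-1]^_ : ℕ → ℤ
[-1]^ zero  = + 1
[-1]^ suc n = - [-1]^ n

parity : ℤ → ℤ
parity j = [-1]^ ∣ j ∣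

parity-⊖-suc : ∀ k n → parity (k ⊖ suc n) ≡ - parity (k ⊖ n)
parity-⊖-suc zero    zero    = refl
parity-⊖-suc zero    (suc n) = refl
parity-⊖-suc (suc k) zero    = sym (ℤₚ.neg-involutive ([-1]^ k))
parity-⊖-suc (suc k) (suc n) rewrite ℤₚ.[1+m]⊖[1+n]≡m⊖n k (suc n) | ℤₚ.[1+m]⊖[1+n]≡m⊖n k n =
  parity-⊖-suc k n

triangle : ℕ → ℕ
triangle zero    = 0
triangle (suc n) = n ℕ.+ triangle n

-- The interval from `-B` to `2B`. Its length comes from the proof of the triple product: a sum of
-- `suc B` terms is lengthened by one in each of the `B` steps of `G` and in each of the `B` steps
-- of `F`.
range : ℕ → List ℤ
range B = map (_⊖ B) (upTo (B ℕ.+ (B ℕ.+ suc B)))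

-- The case of base `q^b` and variable `q^a`, with `c = b - a`. The parameters are the predecessors
-- of `a` and `c`, so that both are visibly positive.
module TripleProduct (a′ c′ : ℕ) where

  a c b : ℕ
  a = suc a′
  c = suc c′
  b = a ℕ.+ c

  -- a j + b j (j - 1) / 2
  expo : ℤ → ℕ
  expo (+ n)    = a ℕ.* n ℕ.+ b ℕ.* triangle n
  expo -[1+ n ] = c ℕ.* suc n ℕ.+ b ℕ.* triangle (suc n)

  -- This is `e(j) - e(j - 1) = b j - c` at `j = k - n`, with the negative terms moved across so
  -- that it can be stated in `ℕ`.
  expo-⊖-suc : ∀ k n → expo (k ⊖ suc n) ℕ.+ b ℕ.* k ≡ expo (k ⊖ n) ℕ.+ (c ℕ.+ b ℕ.* n)
  expo-⊖-suc zero zero = identity a′ c′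
    where
    identity : ∀ x y → suc y ℕ.* 1 ℕ.+ (suc x ℕ.+ suc y) ℕ.* 0 ℕ.+ (suc x ℕ.+ suc y) ℕ.* 0
             ≡ suc x ℕ.* 0 ℕ.+ (suc x ℕ.+ suc y) ℕ.* 0 ℕ.+ (suc y ℕ.+ (suc x ℕ.+ suc y) ℕ.* 0)
    identity = ℕ-Solver.solve-∀
  expo-⊖-suc zero (suc n) = identity a c n (triangle (suc n))
    where
    identity : ∀ x y n t → y ℕ.* suc (suc n) ℕ.+ (x ℕ.+ y) ℕ.* (suc n ℕ.+ t) ℕ.+ (x ℕ.+ y) ℕ.* 0
             ≡ y ℕ.* suc n ℕ.+ (x ℕ.+ y) ℕ.* t ℕ.+ (y ℕ.+ (x ℕ.+ y) ℕ.* suc n)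
    identity = ℕ-Solver.solve-∀
  expo-⊖-suc (suc k) zero = identity a c k (triangle k)
    where
    identity : ∀ x y k t → x ℕ.* k ℕ.+ (x ℕ.+ y) ℕ.* t ℕ.+ (x ℕ.+ y) ℕ.* suc k
             ≡ x ℕ.* suc k ℕ.+ (x ℕ.+ y) ℕ.* (k ℕ.+ t) ℕ.+ (y ℕ.+ (x ℕ.+ y) ℕ.* 0)
    identity = ℕ-Solver.solve-∀
  expo-⊖-suc (suc k) (suc n) rewrite ℤₚ.[1+m]⊖[1+n]≡m⊖n k (suc n) | ℤₚ.[1+m]⊖[1+n]≡m⊖n k n =
    trans (left (expo (k ⊖ suc n)) b k)
   (trans (cong (b ℕ.+_) (expo-⊖-suc k n))
          (right (expo (k ⊖ n)) b c n))
    where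
    left : ∀ e b k → e ℕ.+ b ℕ.* suc k ≡ b ℕ.+ (e ℕ.+ b ℕ.* k)
    left = ℕ-Solver.solve-∀
    right : ∀ e b c n → b ℕ.+ (e ℕ.+ (c ℕ.+ b ℕ.* n)) ≡ e ℕ.+ (c ℕ.+ b ℕ.* suc n)
    right = ℕ-Solver.solve-∀

  -- This is `e(j) ≥ -j` at `j = k - n`. For `n ≥ N` the term of index `k` in `F n` therefore leaves
  -- at most degree `k` to `R k`, and up to that degree `R k` is 1; this is how the factors `R k`
  -- disappear in `F-limit`.
  expo-⊖-lower : ∀ k n → n ℕ.≤ expo (k ⊖ n) ℕ.+ k
  expo-⊖-lower zero    zero    = z≤n
  expo-⊖-lower zero    (suc n) = ℕₚ.≤-trans (ℕₚ.m≤n*m (suc n) c)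
                                (ℕₚ.≤-trans (ℕₚ.m≤m+n _ _) (ℕₚ.m≤m+n _ 0))
  expo-⊖-lower (suc k) zero    = z≤n
  expo-⊖-lower (suc k) (suc n) rewrite ℤₚ.[1+m]⊖[1+n]≡m⊖n k n | ℕₚ.+-suc (expo (k ⊖ n)) k =
    s≤s (expo-⊖-lower k n)

  -- The quotient `(q^b;q^b)_∞ / (q^b;q^b)_k` written without division. Then `F 0` is Euler's
  -- expansion of `(q^a;q^b)_∞` multiplied by `(q^b;q^b)_∞`.
  R : ℕ → Series
  R k = qPoch (b ℕ.* suc k) b

  R-step : ∀ k → R k ≗ (oneMinus (b ℕ.* suc k) ⊛ R (suc k))
  R-step k n = trans (qPoch-unfold (b ℕ.* suc k) b n)
    (cong (λ j → (oneMinus (b ℕ.* suc k) ⊛ qPoch j b) n) (sym (ℕₚ.*-suc b (suc k))))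

  Θ : (ℕ → ℤ) → (ℕ → ℕ) → ℕ → Series
  Θ σ e K n = ∑ (upTo K) (λ k → σ k * (mono (e k) ⊛ R k) n)

  mono-⊛-R : ∀ e k n → (mono e ⊛ R k) n
           ≡ (mono e ⊛ R (suc k)) n - (mono (e ℕ.+ b ℕ.* suc k) ⊛ R (suc k)) n
  mono-⊛-R e k n = begin
    (mono e ⊛ R k) n
      ≡⟨ ⊛-congʳ (mono e) (R-step k) n ⟩
    (mono e ⊛ (oneMinus d ⊛ R (suc k))) n
      ≡⟨ sym (⊛-assoc (mono e) (oneMinus d) (R (suc k)) n) ⟩
    ((mono e ⊛ oneMinus d) ⊛ R (suc k)) n
      ≡⟨ ⊛-congˡ (R (suc k)) (⊛-comm (mono e) (oneMinus d)) n ⟩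
    ((oneMinus d ⊛ mono e) ⊛ R (suc k)) n
      ≡⟨ ⊛-assoc (oneMinus d) (mono e) (R (suc k)) n ⟩
    (oneMinus d ⊛ (mono e ⊛ R (suc k))) n
      ≡⟨ oneMinus-⊛ d (mono e ⊛ R (suc k)) n ⟩
    (mono e ⊛ R (suc k)) n - (mono d ⊛ (mono e ⊛ R (suc k))) n
      ≡⟨ cong (λ x → (mono e ⊛ R (suc k)) n - x)
           (trans (mono-⊛-mono-⊛ d e (R (suc k)) n)
                  (cong (λ x → (mono x ⊛ R (suc k)) n) (ℕₚ.+-comm d e))) ⟩
    (mono e ⊛ R (suc k)) n - (mono (e ℕ.+ d) ⊛ R (suc k)) n ∎
    where
    open ≡-Reasoning
    d = b ℕ.* suc k

  -- The relation R k = (1 - q^{b(k+1)}) R (k+1) makes the sum collapse.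
  telescope : ∀ σ e K n →
    ∑ (upTo K) (λ k → σ k * (mono (e k ℕ.+ b ℕ.* k) ⊛ R k) n
                      + σ (suc k) * (mono (e (suc k)) ⊛ R k) n)
    ≡ Θ σ e (suc K) n - σ K * (mono (e K ℕ.+ b ℕ.* K) ⊛ R K) n
  telescope σ e zero n = sym (begin
    (σ 0 * (mono (e 0) ⊛ R 0) n + + 0) - σ 0 * (mono (e 0 ℕ.+ b ℕ.* 0) ⊛ R 0) n
      ≡⟨ cong (λ x → (σ 0 * (mono (e 0) ⊛ R 0) n + + 0) - σ 0 * (mono x ⊛ R 0) n) e₀ ⟩
    (σ 0 * (mono (e 0) ⊛ R 0) n + + 0) - σ 0 * (mono (e 0) ⊛ R 0) n
      ≡⟨ cancel (σ 0 * (mono (e 0) ⊛ R 0) n) ⟩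
    + 0 ∎)
    where
    open ≡-Reasoning
    e₀ : e 0 ℕ.+ b ℕ.* 0 ≡ e 0
    e₀ = trans (cong (e 0 ℕ.+_) (ℕₚ.*-zeroʳ b)) (ℕₚ.+-identityʳ (e 0))
    cancel : ∀ x → (x + + 0) - x ≡ + 0
    cancel = solve-∀
  telescope σ e (suc K) n = begin
    ∑ (upTo (suc K)) term
      ≡⟨ ∑-last term K ⟩
    ∑ (upTo K) term + term K
      ≡⟨ cong₂ _+_ (telescope σ e K n)
               (cong (λ x → Q + σ (suc K) * x) (mono-⊛-R (e (suc K)) K n)) ⟩
    Θ σ e (suc K) n - Q + (Q + σ (suc K) * (X - Y))
      ≡⟨ collapse (Θ σ e (suc K) n) Q (σ (suc K)) X Y ⟩
    Θ σ e (suc K) n + σ (suc K) * X - σ (suc K) * Y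
      ≡⟨ cong (_- σ (suc K) * Y) (sym (∑-last (λ k → σ k * (mono (e k) ⊛ R k) n) (suc K))) ⟩
    Θ σ e (suc (suc K)) n - σ (suc K) * Y ∎
    where
    open ≡-Reasoning
    term : ℕ → ℤ
    term k = σ k * (mono (e k ℕ.+ b ℕ.* k) ⊛ R k) n + σ (suc k) * (mono (e (suc k)) ⊛ R k) n
    Q = σ K * (mono (e K ℕ.+ b ℕ.* K) ⊛ R K) n
    X = (mono (e (suc K)) ⊛ R (suc K)) n
    Y = (mono (e (suc K) ℕ.+ b ℕ.* suc K) ⊛ R (suc K)) n
    collapse : ∀ t q s x y → t - q + (q + s * (x - y)) ≡ t + s * x - s * y
    collapse = solve-∀

  oneMinus-⊛-Θ : ∀ x σ e K n → (oneMinus x ⊛ Θ σ e K) n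
    ≡ ∑ (upTo K) (λ k → σ k * (mono (e k) ⊛ R k) n - σ k * (mono (e k ℕ.+ x) ⊛ R k) n)
  oneMinus-⊛-Θ x σ e K n = begin
    (oneMinus x ⊛ Θ σ e K) n
      ≡⟨ ⊛-comm (oneMinus x) (Θ σ e K) n ⟩
    (Θ σ e K ⊛ oneMinus x) n
      ≡⟨ ∑-⊛ (λ k i → σ k * (mono (e k) ⊛ R k) i) (oneMinus x) (upTo K) n ⟩
    ∑ (upTo K) (λ k → ((λ i → σ k * (mono (e k) ⊛ R k) i) ⊛ oneMinus x) n)
      ≡⟨ ∑-cong expand (upTo K) ⟩
    ∑ (upTo K) (λ k → σ k * (mono (e k) ⊛ R k) n - σ k * (mono (e k ℕ.+ x) ⊛ R k) n) ∎
    where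
    open ≡-Reasoning
    distrib : ∀ s u v → s * (u - v) ≡ s * u - s * v
    distrib = solve-∀
    expand : ∀ k → ((λ i → σ k * (mono (e k) ⊛ R k) i) ⊛ oneMinus x) n
                 ≡ σ k * (mono (e k) ⊛ R k) n - σ k * (mono (e k ℕ.+ x) ⊛ R k) n
    expand k = begin
      ((λ i → σ k * (mono (e k) ⊛ R k) i) ⊛ oneMinus x) n
        ≡⟨ ⊛-scaleˡ (σ k) (mono (e k) ⊛ R k) (oneMinus x) n ⟩
      σ k * ((mono (e k) ⊛ R k) ⊛ oneMinus x) n
        ≡⟨ cong (σ k *_) (⊛-comm (mono (e k) ⊛ R k) (oneMinus x) n) ⟩
      σ k * (oneMinus x ⊛ (mono (e k) ⊛ R k)) n
        ≡⟨ cong (σ k *_) (oneMinus-⊛ x (mono (e k) ⊛ R k) n) ⟩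
      σ k * ((mono (e k) ⊛ R k) n - (mono x ⊛ (mono (e k) ⊛ R k)) n)
        ≡⟨ cong (λ y → σ k * ((mono (e k) ⊛ R k) n - y))
             (trans (mono-⊛-mono-⊛ x (e k) (R k) n)
                    (cong (λ y → (mono y ⊛ R k) n) (ℕₚ.+-comm x (e k)))) ⟩
      σ k * ((mono (e k) ⊛ R k) n - (mono (e k ℕ.+ x) ⊛ R k) n)
        ≡⟨ distrib (σ k) _ _ ⟩
      σ k * (mono (e k) ⊛ R k) n - σ k * (mono (e k ℕ.+ x) ⊛ R k) n ∎

  -- The hypothesis brings the product, term by term, into the shape summed by `telescope`. The
  -- boundary term left over has degree at least `b K > N` and vanishes modulo `q^(N+1)`; the sum
  -- becomes one term longer.
  Θ-step : ∀ x σ e σ′ e′ {N K} → N ℕ.< K →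
    (∀ k n → σ k * (mono (e k) ⊛ R k) n - σ k * (mono (e k ℕ.+ x) ⊛ R k) n
           ≡ σ′ k * (mono (e′ k ℕ.+ b ℕ.* k) ⊛ R k) n + σ′ (suc k) * (mono (e′ (suc k)) ⊛ R k) n) →
    (oneMinus x ⊛ Θ σ e K) ≈[ N ] Θ σ′ e′ (suc K)
  Θ-step x σ e σ′ e′ {N} {K} N<K h n n≤N = begin
    (oneMinus x ⊛ Θ σ e K) n
      ≡⟨ trans (oneMinus-⊛-Θ x σ e K n) (∑-cong (λ k → h k n) (upTo K)) ⟩
    ∑ (upTo K) (λ k → σ′ k * (mono (e′ k ℕ.+ b ℕ.* k) ⊛ R k) n + σ′ (suc k) * (mono (e′ (suc k)) ⊛ R k) n)
      ≡⟨ telescope σ′ e′ K n ⟩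
    Θ σ′ e′ (suc K) n - σ′ K * (mono (e′ K ℕ.+ b ℕ.* K) ⊛ R K) n
      ≡⟨ cong (λ y → Θ σ′ e′ (suc K) n - σ′ K * y) (mono-⊛-low (e′ K ℕ.+ b ℕ.* K) (R K) large) ⟩
    Θ σ′ e′ (suc K) n - σ′ K * + 0
      ≡⟨ drop (Θ σ′ e′ (suc K) n) (σ′ K) ⟩
    Θ σ′ e′ (suc K) n ∎
    where
    open ≡-Reasoning
    large : n ℕ.< e′ K ℕ.+ b ℕ.* K
    large = ℕₚ.≤-trans (ℕₚ.≤-<-trans n≤N N<K) (ℕₚ.≤-trans (ℕₚ.m≤n*m K b) (ℕₚ.m≤n+m _ (e′ K)))
    drop : ∀ t s → t - s * + 0 ≡ t
    drop = solve-∀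

  -- G 0 = (q^a;q^b)_m G m, which tends to (q^a;q^b)_∞ R 0, and F n = (q^c;q^b)_n F 0 tends to the
  -- theta series; moreover F 0 = G 0.  All this holds modulo q^{N+1} because of the truncation.
  F G : ℕ → ℕ → Series
  F n = Θ (λ k → parity (k ⊖ n)) (λ k → expo (k ⊖ n))
  G m = Θ [-1]^_ (λ k → expo (+ k) ℕ.+ b ℕ.* m ℕ.* k)

  F-step : ∀ {N K} n → N ℕ.< K → (oneMinus (c ℕ.+ b ℕ.* n) ⊛ F n K) ≈[ N ] F (suc n) (suc K)
  F-step n N<K = Θ-step (c ℕ.+ b ℕ.* n) (λ k → parity (k ⊖ n)) (λ k → expo (k ⊖ n))
    (λ k → parity (k ⊖ suc n)) (λ k → expo (k ⊖ suc n)) N<K terms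
    where
    open ≡-Reasoning
    swap : ∀ p u v → p * u - p * v ≡ - p * v + p * u
    swap = solve-∀
    terms : ∀ k i → parity (k ⊖ n) * (mono (expo (k ⊖ n)) ⊛ R k) i
                    - parity (k ⊖ n) * (mono (expo (k ⊖ n) ℕ.+ (c ℕ.+ b ℕ.* n)) ⊛ R k) i
                  ≡ parity (k ⊖ suc n) * (mono (expo (k ⊖ suc n) ℕ.+ b ℕ.* k) ⊛ R k) i
                    + parity (suc k ⊖ suc n) * (mono (expo (suc k ⊖ suc n)) ⊛ R k) i
    -- The first term reappears as the second, since `suc k ⊖ suc n` is `k ⊖ n`. The shifted term
    -- becomes the first by `expo-⊖-suc`, its minus sign being absorbed by the change of parity.
    terms k i
      rewrite ℤₚ.[1+m]⊖[1+n]≡m⊖n k n | parity-⊖-suc k n | expo-⊖-suc k n =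
      swap (parity (k ⊖ n)) _ _

  G-step : ∀ {N K} m → N ℕ.< K → (oneMinus (a ℕ.+ b ℕ.* m) ⊛ G (suc m) K) ≈[ N ] G m (suc K)
  G-step m N<K = Θ-step (a ℕ.+ b ℕ.* m) [-1]^_ (λ k → expo (+ k) ℕ.+ b ℕ.* suc m ℕ.* k)
    [-1]^_ (λ k → expo (+ k) ℕ.+ b ℕ.* m ℕ.* k) N<K terms
    where
    e₁ : ∀ E b m k → E ℕ.+ b ℕ.* suc m ℕ.* k ≡ E ℕ.+ b ℕ.* m ℕ.* k ℕ.+ b ℕ.* k
    e₁ = ℕ-Solver.solve-∀
    e₂ : ∀ a b k t m → a ℕ.* k ℕ.+ b ℕ.* t ℕ.+ b ℕ.* m ℕ.* k ℕ.+ b ℕ.* k ℕ.+ (a ℕ.+ b ℕ.* m)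
       ≡ a ℕ.* suc k ℕ.+ b ℕ.* (k ℕ.+ t) ℕ.+ b ℕ.* m ℕ.* suc k
    e₂ = ℕ-Solver.solve-∀
    distrib : ∀ p u v → p * u - p * v ≡ p * u + - p * v
    distrib = solve-∀
    terms : ∀ k i → [-1]^ k * (mono (expo (+ k) ℕ.+ b ℕ.* suc m ℕ.* k) ⊛ R k) i
                    - [-1]^ k * (mono (expo (+ k) ℕ.+ b ℕ.* suc m ℕ.* k ℕ.+ (a ℕ.+ b ℕ.* m)) ⊛ R k) i
                  ≡ [-1]^ k * (mono (expo (+ k) ℕ.+ b ℕ.* m ℕ.* k ℕ.+ b ℕ.* k) ⊛ R k) i
                    + [-1]^ suc k * (mono (expo (+ suc k) ℕ.+ b ℕ.* m ℕ.* suc k) ⊛ R k) i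
    terms k i rewrite e₁ (expo (+ k)) b m k | e₂ a b k (triangle k) m = distrib ([-1]^ k) _ _

  F-iterate : ∀ {N K} n → N ℕ.< K → (prodBelow (factors c b) n ⊛ F 0 K) ≈[ N ] F n (n ℕ.+ K)
  F-iterate {N} {K} zero    N<K i i≤N = ⊛-identityˡ (F 0 K) i
  F-iterate {N} {K} (suc n) N<K i i≤N = begin
    (prodBelow (factors c b) (suc n) ⊛ F 0 K) i
      ≡⟨ ⊛-congˡ (F 0 K) (prodBelow-last (factors c b) n) i ⟩
    ((P ⊛ f) ⊛ F 0 K) i
      ≡⟨ ⊛-congˡ (F 0 K) (⊛-comm P f) i ⟩
    ((f ⊛ P) ⊛ F 0 K) i
      ≡⟨ ⊛-assoc f P (F 0 K) i ⟩
    (f ⊛ (P ⊛ F 0 K)) i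
      ≡⟨ ⊛-cong-≈ {f} {f} {P ⊛ F 0 K} {F n (n ℕ.+ K)} (λ _ _ → refl) (F-iterate n N<K) i i≤N ⟩
    (f ⊛ F n (n ℕ.+ K)) i
      ≡⟨ F-step n (ℕₚ.≤-trans N<K (ℕₚ.m≤n+m K n)) i i≤N ⟩
    F (suc n) (suc n ℕ.+ K) i ∎
    where
    open ≡-Reasoning
    P = prodBelow (factors c b) n
    f = factors c b n

  G-iterate : ∀ {N} m K → N ℕ.< K → (prodBelow (factors a b) m ⊛ G m K) ≈[ N ] G 0 (m ℕ.+ K)
  G-iterate zero    K N<K i i≤N = ⊛-identityˡ (G 0 K) i
  G-iterate (suc m) K N<K i i≤N = begin
    (prodBelow (factors a b) (suc m) ⊛ G (suc m) K) i
      ≡⟨ ⊛-congˡ (G (suc m) K) (prodBelow-last (factors a b) m) i ⟩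
    ((P ⊛ f) ⊛ G (suc m) K) i
      ≡⟨ ⊛-assoc P f (G (suc m) K) i ⟩
    (P ⊛ (f ⊛ G (suc m) K)) i
      ≡⟨ ⊛-cong-≈ {P} {P} {f ⊛ G (suc m) K} {G m (suc K)} (λ _ _ → refl) (G-step m N<K) i i≤N ⟩
    (P ⊛ G m (suc K)) i
      ≡⟨ G-iterate m (suc K) (ℕₚ.m<n⇒m<1+n N<K) i i≤N ⟩
    G 0 (m ℕ.+ suc K) i
      ≡⟨ cong (λ x → G 0 x i) (ℕₚ.+-suc m K) ⟩
    G 0 (suc m ℕ.+ K) i ∎
    where
    open ≡-Reasoning
    P = prodBelow (factors a b) m
    f = factors a b m

  -- Every term with `k ≥ 1` contains `q^(b m k)`, of degree beyond `N` once `m > N`; only `k = 0`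
  -- survives.
  G-limit : ∀ {N} m K → N ℕ.< m → G m (suc K) ≈[ N ] R 0
  G-limit {N} m K N<m n n≤N = begin
    G m (suc K) n
      ≡⟨ ∑-head (λ k → [-1]^ k * (mono (expo (+ k) ℕ.+ b ℕ.* m ℕ.* k) ⊛ R k) n) K ⟩
    + 1 * (mono (expo (+ 0) ℕ.+ b ℕ.* m ℕ.* 0) ⊛ R 0) n + ∑ (upTo K) rest
      ≡⟨ cong₂ _+_ (trans (ℤₚ.*-identityˡ _) (cong (λ x → (mono x ⊛ R 0) n) (e₀ a b (b ℕ.* m))))
                   (∑-zero vanish (upTo K)) ⟩
    (mono 0 ⊛ R 0) n + + 0
      ≡⟨ trans (ℤₚ.+-identityʳ _) (mono-0-⊛ (R 0) n) ⟩
    R 0 n ∎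
    where
    open ≡-Reasoning
    rest : ℕ → ℤ
    rest k = [-1]^ suc k * (mono (expo (+ suc k) ℕ.+ b ℕ.* m ℕ.* suc k) ⊛ R (suc k)) n
    e₀ : ∀ a b x → a ℕ.* 0 ℕ.+ b ℕ.* 0 ℕ.+ x ℕ.* 0 ≡ 0
    e₀ = ℕ-Solver.solve-∀
    large : ∀ k → n ℕ.< expo (+ suc k) ℕ.+ b ℕ.* m ℕ.* suc k
    large k = ℕₚ.≤-trans (ℕₚ.≤-<-trans n≤N N<m)
             (ℕₚ.≤-trans (ℕₚ.m≤n*m m b)
             (ℕₚ.≤-trans (ℕₚ.m≤m*n (b ℕ.* m) (suc k)) (ℕₚ.m≤n+m _ (expo (+ suc k)))))
    vanish : ∀ k → rest k ≡ + 0
    vanish k = trans (cong ([-1]^ suc k *_) (mono-⊛-low _ (R (suc k)) (large k)))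
                     (ℤₚ.*-zeroʳ ([-1]^ suc k))

  F₀≗G₀ : ∀ K → F 0 K ≗ G 0 K
  F₀≗G₀ K n = ∑-cong (λ k → cong (λ x → [-1]^ k * (mono x ⊛ R k) n) (e₀ (expo (+ k)) b k)) (upTo K)
    where
    e₀ : ∀ E b k → E ≡ E ℕ.+ b ℕ.* 0 ℕ.* k
    e₀ = ℕ-Solver.solve-∀

  F-limit : ∀ {N} n K → N ℕ.≤ n →
            F n K ≈[ N ] (λ i → ∑ (upTo K) (λ k → parity (k ⊖ n) * mono (expo (k ⊖ n)) i))
  F-limit {N} n K N≤n i i≤N = ∑-cong (λ k → cong (parity (k ⊖ n) *_) (flat k)) (upTo K)
    where
    small : ∀ k d → expo (k ⊖ n) ℕ.+ d ℕ.≤ i → d ℕ.< b ℕ.* suc k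
    small k d e+d≤i = ℕₚ.≤-trans (s≤s d≤k) (ℕₚ.m≤n*m (suc k) b)
      where
      d≤k : d ℕ.≤ k
      d≤k = ℕₚ.+-cancelˡ-≤ (expo (k ⊖ n)) d k
        (ℕₚ.≤-trans e+d≤i (ℕₚ.≤-trans i≤N (ℕₚ.≤-trans N≤n (expo-⊖-lower k n))))
    flat : ∀ k → (mono (expo (k ⊖ n)) ⊛ R k) i ≡ mono (expo (k ⊖ n)) i
    flat k = trans (mono-⊛-cong (expo (k ⊖ n)) {R k} {one} i
                     (λ d p → qPoch-low (b ℕ.* suc k) b d (small k d p)))
                   (⊛-identityʳ (mono (expo (k ⊖ n))) i)

  theta : ℕ → Series
  theta B i = ∑ (range B) (λ j → parity j * mono (expo j) i)

  tripleProduct : ∀ {N B} → N ℕ.< B →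
                  (qPoch a b ⊛ qPoch c b ⊛ qPoch (b ℕ.* 1) b) ≈[ N ] theta B
  tripleProduct {N} {B} N<B n n≤N = begin
    (qPoch a b ⊛ qPoch c b ⊛ R 0) n
      ≡⟨ ⊛-congˡ (R 0) (⊛-comm (qPoch a b) (qPoch c b)) n ⟩
    (qPoch c b ⊛ qPoch a b ⊛ R 0) n
      ≡⟨ ⊛-assoc (qPoch c b) (qPoch a b) (R 0) n ⟩
    (qPoch c b ⊛ (qPoch a b ⊛ R 0)) n
      ≡⟨ ⊛-cong-≈ {qPoch c b} {Πc} {qPoch a b ⊛ R 0} {Πa ⊛ G B (suc B)}
           (qPoch-finite c b N B N<B)
           (⊛-cong-≈ {qPoch a b} {Πa} {R 0} {G B (suc B)} (qPoch-finite a b N B N<B)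
              (≈-sym {G B (suc B)} {R 0} (G-limit B B N<B))) n n≤N ⟩
    (Πc ⊛ (Πa ⊛ G B (suc B))) n
      ≡⟨ ⊛-cong-≈ {Πc} {Πc} {Πa ⊛ G B (suc B)} {F 0 (B ℕ.+ suc B)} (λ _ _ → refl)
           (λ i i≤N → trans (G-iterate B (suc B) (ℕₚ.m<n⇒m<1+n N<B) i i≤N)
                            (sym (F₀≗G₀ (B ℕ.+ suc B) i))) n n≤N ⟩
    (Πc ⊛ F 0 (B ℕ.+ suc B)) n
      ≡⟨ F-iterate B (ℕₚ.≤-trans N<B (ℕₚ.m≤m+n B (suc B))) n n≤N ⟩
    F B (B ℕ.+ (B ℕ.+ suc B)) n
      ≡⟨ F-limit B (B ℕ.+ (B ℕ.+ suc B)) (ℕₚ.<⇒≤ N<B) n n≤N ⟩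
    ∑ (upTo (B ℕ.+ (B ℕ.+ suc B))) (λ k → parity (k ⊖ B) * mono (expo (k ⊖ B)) n)
      ≡⟨ sym (∑-map (λ j → parity j * mono (expo j) n) (_⊖ B) (upTo (B ℕ.+ (B ℕ.+ suc B)))) ⟩
    theta B n ∎
    where
    open ≡-Reasoning
    Πa = prodBelow (factors a b) B
    Πc = prodBelow (factors c b) B

  private
    2triangle : ∀ n → + 2 * + triangle n ≡ + n * + n - + n
    2triangle zero    = refl
    2triangle (suc n) = trans (cong (+ 2 *_) (ℤₚ.pos-+ n (triangle n)))
      (trans (distrib (+ n) (+ triangle n)) (trans (cong (_+_ (+ 2 * + n)) (2triangle n)) (square (+ n))))
      where
      distrib : ∀ n t → + 2 * (n + t) ≡ + 2 * n + + 2 * t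
      distrib = solve-∀
      square : ∀ n → + 2 * n + (n * n - n) ≡ (+ 1 + n) * (+ 1 + n) - (+ 1 + n)
      square = solve-∀

    2linear : ∀ x y n → + 2 * + (x ℕ.* n ℕ.+ y ℕ.* triangle n)
                      ≡ + 2 * (+ x * + n) + + y * (+ n * + n - + n)
    2linear x y n =
      trans (cong (+ 2 *_) (trans (ℤₚ.pos-+ (x ℕ.* n) _) (cong₂ _+_ (ℤₚ.pos-* x n) (ℤₚ.pos-* y (triangle n)))))
     (trans (distrib (+ x * + n) (+ y) (+ triangle n))
            (cong (λ z → + 2 * (+ x * + n) + + y * z) (2triangle n)))
      where
      distrib : ∀ u y t → + 2 * (u + y * t) ≡ + 2 * u + y * (+ 2 * t)
      distrib = solve-∀

  -- Doubling clears the triangular number. One formula covers both signs of `j`, because exchanging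
  -- `a` and `c` amounts to replacing `j` by `-j`.
  expo-quadratic : ∀ j → + 2 * + expo j ≡ + b * (j * j) + (+ a - + c) * j
  expo-quadratic (+ n) = trans (2linear a b n) (identity (+ a) (+ c) (+ n))
    where
    identity : ∀ a c n → + 2 * (a * n) + (a + c) * (n * n - n) ≡ (a + c) * (n * n) + (a - c) * n
    identity = solve-∀
  expo-quadratic -[1+ n ] = trans (2linear c b (suc n)) (identity (+ a) (+ c) (+ suc n))
    where
    identity : ∀ a c n → + 2 * (c * n) + (a + c) * (n * n - n) ≡ (a + c) * (- n * - n) + (a - c) * - n
    identity = solve-∀

  ∣j∣≤expo : ∀ j → ∣ j ∣ ℕ.≤ expo j
  ∣j∣≤expo (+ n)    = ℕₚ.≤-trans (ℕₚ.m≤n*m n a) (ℕₚ.m≤m+n _ _)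
  ∣j∣≤expo -[1+ n ] = ℕₚ.≤-trans (ℕₚ.m≤n*m (suc n) c) (ℕₚ.m≤m+n _ _)


-- Reindexing finite sums

ind : {P : Set} → Dec P → ℤ
ind d = if does d then + 1 else + 0

ind-yes : {P : Set} (d : Dec P) → P → ind d ≡ + 1
ind-yes d p rewrite dec-true d p = refl

ind-no : {P : Set} (d : Dec P) → ¬ P → ind d ≡ + 0
ind-no d ¬p rewrite dec-false d ¬p = refl

ind-× : {P Q S : Set} (p : Dec P) (q : Dec Q) (s : Dec S) →
        (P → Q → S) → (S → P) → (S → Q) → ind s ≡ ind p * ind q
ind-× (yes p) (yes q) s pair _   _   = ind-yes s (pair p q)
ind-× (yes _) (no ¬q) s _    _   snd = ind-no s (¬q ∘ snd)
ind-× (no ¬p) _       s _    fst _   = ind-no s (¬p ∘ fst)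

ind-⇔ : {P Q : Set} (p : Dec P) (q : Dec Q) → (P → Q) → (Q → P) → ind p ≡ ind q
ind-⇔ (yes p) q to from = sym (ind-yes q (to p))
ind-⇔ (no ¬p) q to from = sym (ind-no q (¬p ∘ from))

-- The value 1 says both that `x` occurs in the list and that it occurs only once, which is what
-- matching summands of two lists requires.
count : DecidableEquality A → List A → A → ℤ
count _≟_ xs x = ∑ xs (λ x′ → ind (x ≟ x′))

module _ (_≟₁_ : DecidableEquality A) (_≟₂_ : DecidableEquality B) where

  -- Both sides are the sum over pairs (x , y) of f x restricted to the graph of the matching.
  reindex : (xs : List A) (ys : List B) (f : A → ℤ) (g : B → ℤ) (R : A → B → Set) →
    (∀ x → f x ≢ + 0 → ∃[ y ] (R x y × g y ≡ f x × count _≟₂_ ys y ≡ + 1)) →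
    (∀ y → g y ≢ + 0 → ∃[ x ] (R x y × f x ≡ g y × count _≟₁_ xs x ≡ + 1)) →
    (∀ x y y′ → g y ≢ + 0 → g y′ ≢ + 0 → R x y → R x y′ → y ≡ y′) →
    (∀ x x′ y → f x ≢ + 0 → f x′ ≢ + 0 → R x y → R x′ y → x ≡ x′) →
    ∑ xs f ≡ ∑ ys g
  reindex xs ys f g R to from functional injective = begin
    ∑ xs f                             ≡⟨ ∑-cong (λ x → sym (row x)) xs ⟩
    ∑ xs (λ x → ∑ ys (λ y → F x y))    ≡⟨ ∑-swap F xs ys ⟩
    ∑ ys (λ y → ∑ xs (λ x → F x y))    ≡⟨ ∑-cong (λ y → ∑-cong (λ x → F≡G x y) xs) ys ⟩
    ∑ ys (λ y → ∑ xs (λ x → G x y))    ≡⟨ ∑-cong column ys ⟩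
    ∑ ys g                             ∎
    where
    open ≡-Reasoning
    F G : A → B → ℤ
    -- Outside the support of `f` no partner is available and the row is filled with zeros; on the
    -- support `f x` stands in the column of its partner.
    F x y with f x ℤ.≟ + 0
    ... | yes _  = + 0
    ... | no f≢0 = f x * ind (proj₁ (to x f≢0) ≟₂ y)
    G x y with g y ℤ.≟ + 0
    ... | yes _  = + 0
    ... | no g≢0 = g y * ind (proj₁ (from y g≢0) ≟₁ x)

    row : ∀ x → ∑ ys (F x) ≡ f x
    row x with f x ℤ.≟ + 0
    ... | yes f≡0 = trans (∑-zero (λ _ → refl) ys) (sym f≡0)
    ... | no f≢0 with to x f≢0
    ...   | y , _ , _ , once =
      trans (∑-distribˡ-* (f x) (λ y′ → ind (y ≟₂ y′)) ys) (trans (cong (f x *_) once) (ℤₚ.*-identityʳ (f x)))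

    column : ∀ y → ∑ xs (λ x → G x y) ≡ g y
    column y with g y ℤ.≟ + 0
    ... | yes g≡0 = trans (∑-zero (λ _ → refl) xs) (sym g≡0)
    ... | no g≢0 with from y g≢0
    ...   | x , _ , _ , once =
      trans (∑-distribˡ-* (g y) (λ x′ → ind (x ≟₁ x′)) xs) (trans (cong (g y *_) once) (ℤₚ.*-identityʳ (g y)))

    F≡G : ∀ x y → F x y ≡ G x y
    F≡G x y with f x ℤ.≟ + 0 | g y ℤ.≟ + 0
    F≡G x y | yes _ | yes _ = refl
    F≡G x y | yes f≡0 | no g≢0 with from y g≢0
    ... | x′ , _ , f≡g , _ with x′ ≟₁ x
    ...   | yes refl = ⊥-elim (g≢0 (trans (sym f≡g) f≡0))
    ...   | no _     = sym (ℤₚ.*-zeroʳ (g y))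
    F≡G x y | no f≢0 | yes g≡0 with to x f≢0
    ... | y′ , _ , g≡f , _ with y′ ≟₂ y
    ...   | yes refl = ⊥-elim (f≢0 (trans (sym g≡f) g≡0))
    ...   | no _     = ℤₚ.*-zeroʳ (f x)
    F≡G x y | no f≢0 | no g≢0 with to x f≢0 | from y g≢0
    ... | y′ , Rxy′ , g≡f , _ | x′ , Rx′y , f≡g , _ with y′ ≟₂ y | x′ ≟₁ x
    ...   | yes refl | yes _    = cong (_* + 1) (sym g≡f)
    ...   | yes refl | no x′≢x  = ⊥-elim (x′≢x (injective _ _ _ (λ z → g≢0 (trans (sym f≡g) z)) f≢0 Rx′y Rxy′))
    ...   | no y′≢y  | yes refl = ⊥-elim (y′≢y (functional _ _ _ (λ z → f≢0 (trans (sym g≡f) z)) g≢0 Rxy′ Rx′y))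
    ...   | no _     | no _     = trans (ℤₚ.*-zeroʳ (f x)) (sym (ℤₚ.*-zeroʳ (g y)))

  _≟×_ : DecidableEquality (A × B)
  _≟×_ = ≡-dec _≟₁_ _≟₂_

  count-× : ∀ xs ys x y →
    count _≟×_ (cartesianProduct xs ys) (x , y) ≡ count _≟₁_ xs x * count _≟₂_ ys y
  count-× xs ys x y = begin
    ∑ (cartesianProduct xs ys) (λ z → ind ((x , y) ≟× z))
      ≡⟨ ∑-cartesianProduct (λ z → ind ((x , y) ≟× z)) xs ys ⟩
    ∑ xs (λ x′ → ∑ ys (λ y′ → ind ((x , y) ≟× (x′ , y′))))
      ≡⟨ ∑-cong (λ x′ → trans (∑-cong (split x′) ys)
                              (trans (∑-distribˡ-* (ind (x ≟₁ x′)) (λ y′ → ind (y ≟₂ y′)) ys)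
                                     (ℤₚ.*-comm (ind (x ≟₁ x′)) _))) xs ⟩
    ∑ xs (λ x′ → count _≟₂_ ys y * ind (x ≟₁ x′))
      ≡⟨ ∑-distribˡ-* (count _≟₂_ ys y) (λ x′ → ind (x ≟₁ x′)) xs ⟩
    count _≟₂_ ys y * count _≟₁_ xs x
      ≡⟨ ℤₚ.*-comm (count _≟₂_ ys y) (count _≟₁_ xs x) ⟩
    count _≟₁_ xs x * count _≟₂_ ys y ∎
    where
    open ≡-Reasoning
    split : ∀ x′ y′ → ind ((x , y) ≟× (x′ , y′)) ≡ ind (x ≟₁ x′) * ind (y ≟₂ y′)
    split x′ y′ = ind-× (x ≟₁ x′) (y ≟₂ y′) ((x , y) ≟× (x′ , y′)) (cong₂ _,_) (cong proj₁) (cong proj₂)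

count-upTo : ∀ M i → i ℕ.< M → count ℕ._≟_ (upTo M) i ≡ + 1
count-upTo (suc M) zero _ =
  trans (∑-head (λ k → ind (0 ℕ.≟ k)) M)
        (cong (_+_ (+ 1)) (∑-zero (λ k → ind-no (0 ℕ.≟ suc k) λ ()) (upTo M)))
count-upTo (suc M) (suc i) (s≤s i<M) =
  trans (∑-head (λ k → ind (suc i ℕ.≟ k)) M)
 (trans (ℤₚ.+-identityˡ _)
 (trans (∑-cong shift (upTo M)) (count-upTo M i i<M)))
  where
  shift : ∀ k → ind (suc i ℕ.≟ suc k) ≡ ind (i ℕ.≟ k)
  shift k = refl

⊖-cancelʳ : ∀ m n B → m ⊖ B ≡ n ⊖ B → m ≡ n
⊖-cancelʳ m n B eq = ℤₚ.+-injective
  (trans (restore m) (trans (cong (_+ + B) eq) (sym (restore n))))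
  where
  cancel : ∀ x y → x ≡ (x - y) + y
  cancel = solve-∀
  restore : ∀ k → + k ≡ (k ⊖ B) + + B
  restore k = trans (cancel (+ k) (+ B)) (cong (_+ + B) (ℤₚ.m-n≡m⊖n k B))

count-range : ∀ B j → ∣ j ∣ ℕ.≤ B → count ℤ._≟_ (range B) j ≡ + 1
count-range B j ∣j∣≤B with position j ∣j∣≤B
  where
  position : ∀ j → ∣ j ∣ ℕ.≤ B → ∃[ i ] (i ⊖ B ≡ j × i ℕ.< B ℕ.+ (B ℕ.+ suc B))
  position (+ n) n≤B = n ℕ.+ B , trans (ℤₚ.⊖-≥ (ℕₚ.m≤n+m B n)) (cong +_ (ℕₚ.m+n∸n≡m n B))
                     , ℕₚ.+-mono-≤-< n≤B (ℕₚ.≤-trans (ℕₚ.n<1+n B) (ℕₚ.m≤n+m (suc B) B))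
  position -[1+ n ] n<B = B ℕ.∸ suc n
                        , trans (ℤₚ.⊖-≤ (ℕₚ.m∸n≤m B (suc n))) (cong (-_ ∘ +_) (ℕₚ.m∸[m∸n]≡n n<B))
                        , ℕₚ.≤-<-trans (ℕₚ.m∸n≤m B (suc n))
                            (ℕₚ.≤-trans (ℕₚ.n<1+n B) (ℕₚ.≤-trans (ℕₚ.m≤n+m (suc B) B) (ℕₚ.m≤n+m _ B)))
... | i , refl , i<M =
  trans (∑-map (λ j′ → ind ((i ⊖ B) ℤ.≟ j′)) (_⊖ B) (upTo M))
 (trans (∑-cong same (upTo M)) (count-upTo M i i<M))
  where
  M = B ℕ.+ (B ℕ.+ suc B)
  same : ∀ k → ind ((i ⊖ B) ℤ.≟ (k ⊖ B)) ≡ ind (i ℕ.≟ k)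
  same k = ind-⇔ ((i ⊖ B) ℤ.≟ (k ⊖ B)) (i ℕ.≟ k) (⊖-cancelʳ i k B) (cong (_⊖ B))

-- Products of sums of signed monomials

mono-yes : ∀ e N → e ≡ N → mono e N ≡ + 1
mono-yes zero    _ refl = refl
mono-yes (suc e) _ refl = mono-yes e e refl

mono-≢0 : ∀ e N → mono e N ≢ + 0 → e ≡ N
mono-≢0 zero    zero    _ = refl
mono-≢0 zero    (suc N) p = ⊥-elim (p refl)
mono-≢0 (suc e) zero    p = ⊥-elim (p refl)
mono-≢0 (suc e) (suc N) p = cong suc (mono-≢0 e N p)

sparse : (A → ℤ) → (A → ℕ) → List A → Series
sparse s e xs n = ∑ xs (λ x → s x * mono (e x) n)

sparse-⊛ : ∀ (s : A → ℤ) e (s′ : B → ℤ) e′ xs ys N →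
  (sparse s e xs ⊛ sparse s′ e′ ys) N
  ≡ ∑ (cartesianProduct xs ys)
      (λ z → s (proj₁ z) * s′ (proj₂ z) * mono (e (proj₁ z) ℕ.+ e′ (proj₂ z)) N)
sparse-⊛ s e s′ e′ xs ys N = begin
  (sparse s e xs ⊛ sparse s′ e′ ys) N
    ≡⟨ ∑-⊛ (λ x n → s x * mono (e x) n) (sparse s′ e′ ys) xs N ⟩
  ∑ xs (λ x → ((λ n → s x * mono (e x) n) ⊛ sparse s′ e′ ys) N)
    ≡⟨ ∑-cong outer xs ⟩
  ∑ xs (λ x → ∑ ys (λ y → s x * s′ y * mono (e x ℕ.+ e′ y) N))
    ≡⟨ sym (∑-cartesianProduct
         (λ z → s (proj₁ z) * s′ (proj₂ z) * mono (e (proj₁ z) ℕ.+ e′ (proj₂ z)) N) xs ys) ⟩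
  _ ∎
  where
  open ≡-Reasoning
  inner : ∀ x y → ((λ n → s′ y * mono (e′ y) n) ⊛ mono (e x)) N ≡ s′ y * mono (e x ℕ.+ e′ y) N
  inner x y =
    trans (⊛-scaleˡ (s′ y) (mono (e′ y)) (mono (e x)) N)
          (cong (s′ y *_) (trans (mono-⊛-mono (e′ y) (e x) N)
                                 (cong (λ d → mono d N) (ℕₚ.+-comm (e′ y) (e x)))))
  outer : ∀ x → ((λ n → s x * mono (e x) n) ⊛ sparse s′ e′ ys) N
              ≡ ∑ ys (λ y → s x * s′ y * mono (e x ℕ.+ e′ y) N)
  outer x = begin
    ((λ n → s x * mono (e x) n) ⊛ sparse s′ e′ ys) N
      ≡⟨ ⊛-scaleˡ (s x) (mono (e x)) (sparse s′ e′ ys) N ⟩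
    s x * (mono (e x) ⊛ sparse s′ e′ ys) N
      ≡⟨ cong (s x *_) (⊛-comm (mono (e x)) (sparse s′ e′ ys) N) ⟩
    s x * (sparse s′ e′ ys ⊛ mono (e x)) N
      ≡⟨ cong (s x *_) (trans (∑-⊛ (λ y n → s′ y * mono (e′ y) n) (mono (e x)) ys N)
                              (∑-cong (inner x) ys)) ⟩
    s x * ∑ ys (λ y → s′ y * mono (e x ℕ.+ e′ y) N)
      ≡⟨ sym (∑-distribˡ-* (s x) (λ y → s′ y * mono (e x ℕ.+ e′ y) N) ys) ⟩
    ∑ ys (λ y → s x * (s′ y * mono (e x ℕ.+ e′ y) N))
      ≡⟨ ∑-cong (λ y → sym (ℤₚ.*-assoc (s x) (s′ y) _)) ys ⟩
    ∑ ys (λ y → s x * s′ y * mono (e x ℕ.+ e′ y) N) ∎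

-- Residues of integers

-- Two remainders of the same number differ by a multiple of `n` that is smaller than `n` in
-- absolute value, hence by zero.
%ℕ-unique : ∀ n .{{_ : ℕ.NonZero n}} r q → r ℕ.< n → (+ r + q * + n) %ℕ n ≡ r
%ℕ-unique n r q r<n = sym (ℤₚ.+-injective (ℤₚ.i-j≡0⇒i≡j (+ r) (+ r′) diff≡0))
  where
  x = + r + q * + n
  r′ = x %ℕ n
  q′ = x /ℕ n
  rearrange : ∀ r q n r′ q′ → r + q * n ≡ r′ + q′ * n → r - r′ ≡ (q′ - q) * n
  rearrange r q n r′ q′ eq =
    trans (first r q n r′) (trans (cong (λ y → y - (r′ + q * n)) eq) (second r′ q′ n q))
    where
    first : ∀ r q n r′ → r - r′ ≡ (r + q * n) - (r′ + q * n)
    first = solve-∀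
    second : ∀ r′ q′ n q → (r′ + q′ * n) - (r′ + q * n) ≡ (q′ - q) * n
    second = solve-∀
  diff : + r - + r′ ≡ (q′ - q) * + n
  diff = rearrange (+ r) q (+ n) (+ r′) q′ (a≡a%ℕn+[a/ℕn]*n x n)
  small : ∣ + r - + r′ ∣ ℕ.< n
  small = subst (λ z → ∣ z ∣ ℕ.< n) (sym (ℤₚ.m-n≡m⊖n r r′))
            (ℕₚ.≤-<-trans (ℤₚ.∣m⊝n∣≤m⊔n r r′) (ℕₚ.⊔-pres-<m r<n (n%ℕd<d x n)))
  zero-multiple : ∀ m → m ℕ.* n ℕ.< n → m ≡ 0
  zero-multiple zero    _ = refl
  zero-multiple (suc m) p = ⊥-elim (ℕₚ.<⇒≱ p (ℕₚ.m≤m+n n (m ℕ.* n)))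
  quotient≡0 : q′ - q ≡ + 0
  quotient≡0 = ℤₚ.∣i∣≡0⇒i≡0 (zero-multiple ∣ q′ - q ∣
    (subst (ℕ._< n) (trans (cong ∣_∣ diff) (ℤₚ.abs-* (q′ - q) (+ n))) small))
  diff≡0 : + r - + r′ ≡ + 0
  diff≡0 = trans diff (trans (cong (_* + n) quotient≡0) (ℤₚ.*-zeroˡ (+ n)))

%ℕ-periodic : ∀ n .{{_ : ℕ.NonZero n}} x q → (x + q * + n) %ℕ n ≡ x %ℕ n
%ℕ-periodic n x q =
  trans (cong (_%ℕ n) (trans (cong (_+ q * + n) (a≡a%ℕn+[a/ℕn]*n x n))
                             (regroup (+ (x %ℕ n)) (x /ℕ n) q (+ n))))
        (%ℕ-unique n (x %ℕ n) (x /ℕ n + q) (n%ℕd<d x n))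
  where
  regroup : ∀ r u q n → r + u * n + q * n ≡ r + (u + q) * n
  regroup = solve-∀

-- The bound is an implicit argument of type `T`, so for numerals it is settled by evaluation.
residue : ∀ n .{{_ : ℕ.NonZero n}} r q {r<n : T (r ℕ.<ᵇ n)} {x} → x ≡ + r + q * + n → x %ℕ n ≡ r
residue n r q {r<n} refl = %ℕ-unique n r q (ℕₚ.<ᵇ⇒< r n r<n)

quotient : ∀ n .{{_ : ℕ.NonZero n}} r x → x %ℕ n ≡ r → ∃[ q ] x ≡ + r + q * + n
quotient n r x refl = x /ℕ n , a≡a%ℕn+[a/ℕn]*n x n

residue-clash : ∀ n .{{_ : ℕ.NonZero n}} r s q q′ {r<n : T (r ℕ.<ᵇ n)} {s<n : T (s ℕ.<ᵇ n)} →
                r ≢ s → + r + q * + n ≡ + s + q′ * + n → ⊥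
residue-clash n r s q q′ {r<n} {s<n} r≢s eq =
  r≢s (trans (sym (residue n r q {r<n} refl)) (residue n s q′ {s<n} eq))

-- One shape for the nontrivial Dirichlet characters modulo 4 and 3 and for `w`, which is not
-- multiplicative.
char : ∀ n .{{_ : ℕ.NonZero n}} → ℕ → ℕ → ℤ → ℤ
char n r s x = ind (x %ℕ n ℕ.≟ r) - ind (x %ℕ n ℕ.≟ s)

char-value : ∀ n .{{_ : ℕ.NonZero n}} r s c q {c<n : T (c ℕ.<ᵇ n)} {x} → x ≡ + c + q * + n →
             char n r s x ≡ ind (c ℕ.≟ r) - ind (c ℕ.≟ s)
char-value n r s c q {c<n} eq = cong (λ y → ind (y ℕ.≟ r) - ind (y ℕ.≟ s)) (residue n c q {c<n} eq)

char-periodic : ∀ n .{{_ : ℕ.NonZero n}} r s x q → char n r s (x + q * + n) ≡ char n r s x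
char-periodic n r s x q = cong (λ y → ind (y ℕ.≟ r) - ind (y ℕ.≟ s)) (%ℕ-periodic n x q)

char-≢0 : ∀ n .{{_ : ℕ.NonZero n}} r s x → char n r s x ≢ + 0 →
          (∃[ q ] x ≡ + r + q * + n) ⊎ (∃[ q ] x ≡ + s + q * + n)
char-≢0 n r s x nz = go (x %ℕ n ℕ.≟ r) (x %ℕ n ℕ.≟ s)
  where
  go : Dec (x %ℕ n ≡ r) → Dec (x %ℕ n ≡ s) → _
  go (yes p) _       = inj₁ (quotient n r x p)
  go (no _)  (yes p) = inj₂ (quotient n s x p)
  go (no p)  (no p′) = ⊥-elim (nz (cong₂ _-_ (ind-no (x %ℕ n ℕ.≟ r) p) (ind-no (x %ℕ n ℕ.≟ s) p′)))

-- w l is nonzero only for l ≡ 5 (mod 7), and there it is ±1 according as l ≡ ±1 (mod 5).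
χ₄ ψ₃ w : ℤ → ℤ
χ₄ = char 4 1 3
ψ₃ = char 3 1 2
w  = char 35 26 19

oddInd mult3 : ℤ → ℤ
oddInd k = ind (k %ℕ 2 ℕ.≟ 1)
mult3 x = ind (x %ℕ 3 ℕ.≟ 0)

evenOrOdd : ∀ x → (∃[ h ] x ≡ + 0 + h * + 2) ⊎ (∃[ h ] x ≡ + 1 + h * + 2)
evenOrOdd x with x %ℕ 2 in eq | n%ℕd<d x 2
... | 0 | _ = inj₁ (quotient 2 0 x eq)
... | 1 | _ = inj₂ (quotient 2 1 x eq)
... | suc (suc _) | s≤s (s≤s ())

mod3 : ∀ x → (∃[ h ] x ≡ + 0 + h * + 3) ⊎ (∃[ h ] x ≡ + 1 + h * + 3) ⊎ (∃[ h ] x ≡ + 2 + h * + 3)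
mod3 x with x %ℕ 3 in eq | n%ℕd<d x 3
... | 0 | _ = inj₁ (quotient 3 0 x eq)
... | 1 | _ = inj₂ (inj₁ (quotient 3 1 x eq))
... | 2 | _ = inj₂ (inj₂ (quotient 3 2 x eq))
... | suc (suc (suc _)) | s≤s (s≤s (s≤s ()))

-- The sign `(-1)^j` on the integers

parity-pred : ∀ j → parity (ℤ.pred j) ≡ - parity j
parity-pred (+ zero)  = refl
parity-pred (+ suc n) = sym (ℤₚ.neg-involutive ([-1]^ n))
parity-pred -[1+ n ]  = refl

parity-suc : ∀ j → parity (ℤ.suc j) ≡ - parity j
parity-suc j = trans (sym (ℤₚ.neg-involutive _))
  (cong -_ (trans (sym (parity-pred (ℤ.suc j))) (cong parity (ℤₚ.pred-suc j))))

parity-+ : ∀ i j → parity (i + j) ≡ parity i * parity j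
parity-+ i (+ n) = go n
  where
  go : ∀ n → parity (i + + n) ≡ parity i * [-1]^ n
  go zero    = trans (cong parity (ℤₚ.+-identityʳ i)) (sym (ℤₚ.*-identityʳ (parity i)))
  go (suc n) = trans (cong parity (step i (+ n)))
              (trans (parity-suc (i + + n))
              (trans (cong -_ (go n)) (ℤₚ.neg-distribʳ-* (parity i) ([-1]^ n))))
    where
    step : ∀ i m → i + (+ 1 + m) ≡ + 1 + (i + m)
    step = solve-∀
parity-+ i -[1+ n ] = go n
  where
  go : ∀ n → parity (i + -[1+ n ]) ≡ parity i * [-1]^ suc n
  go zero    = trans (cong parity (ℤₚ.+-comm i -[1+ 0 ]))
              (trans (parity-pred i) (trans (sym (ℤₚ.-1*i≡-i (parity i))) (ℤₚ.*-comm -[1+ 0 ] (parity i))))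
  go (suc n) = trans (cong parity (step i -[1+ n ]))
              (trans (parity-pred (i + -[1+ n ]))
              (trans (cong -_ (go n)) (ℤₚ.neg-distribʳ-* (parity i) ([-1]^ suc n))))
    where
    step : ∀ i m → i + (-[1+ 0 ] + m) ≡ -[1+ 0 ] + (i + m)
    step = solve-∀

parity² : ∀ j → parity j * parity j ≡ + 1
parity² j = go ∣ j ∣
  where
  square : ∀ x → - x * - x ≡ x * x
  square = solve-∀
  go : ∀ n → [-1]^ n * [-1]^ n ≡ + 1
  go zero    = refl
  go (suc n) = trans (square ([-1]^ n)) (go n)

parity-even : ∀ h {x} → x ≡ + 0 + h * + 2 → parity x ≡ + 1
parity-even h refl = trans (cong parity (double h)) (trans (parity-+ h h) (parity² h))
  where
  double : ∀ h → + 0 + h * + 2 ≡ h + h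
  double = solve-∀

parity-odd : ∀ h {x} → x ≡ + 1 + h * + 2 → parity x ≡ - + 1
parity-odd h refl = trans (cong parity (ℤₚ.+-comm (+ 1) (h * + 2)))
  (trans (parity-+ (h * + 2) (+ 1))
         (cong (_* - + 1) (parity-even h (sym (ℤₚ.+-identityˡ (h * + 2))))))

*-≢0 : ∀ x y → x * y ≢ + 0 → x ≢ + 0 × y ≢ + 0
*-≢0 x y p = (λ x≡0 → p (trans (cong (_* y) x≡0) (ℤₚ.*-zeroˡ y)))
           , (λ y≡0 → p (trans (cong (x *_) y≡0) (ℤₚ.*-zeroʳ x)))

ind-≢0 : {P : Set} (d : Dec P) → ind d ≢ + 0 → P
ind-≢0 (yes p) _ = p
ind-≢0 (no _)  h = ⊥-elim (h refl)

square-abs : ∀ x → x * x ≡ + (∣ x ∣ ℕ.* ∣ x ∣)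
square-abs (+ n)    = sym (ℤₚ.pos-* n n)
square-abs -[1+ n ] = refl

square-≡ : ∀ x y → x * x ≡ y * y → x ≡ y ⊎ x ≡ - y
square-≡ x y eq with ℤₚ.i*j≡0⇒i≡0∨j≡0 (x - y) (trans (factor x y) (trans (cong (_- y * y) eq) (ℤₚ.+-inverseʳ (y * y))))
  where
  factor : ∀ x y → (x - y) * (x + y) ≡ x * x - y * y
  factor = solve-∀
... | inj₁ p = inj₁ (ℤₚ.i-j≡0⇒i≡j x y p)
... | inj₂ p = inj₂ (trans (shift x y) (trans (cong (_- y) p) (ℤₚ.+-identityˡ (- y))))
  where
  shift : ∀ x y → x ≡ (x + y) - y
  shift = solve-∀

-- Weighted points of the form 9k² - 2kp + 4p²

form : ℤ → ℤ → ℤ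
form k p = + 9 * (k * k) - + 2 * (k * p) + + 4 * (p * p)

opaque
  -- A quarter of `840 N + 396`: with `l = 4p - k`, the sum `35k² + l²` is four times the form.
  level : ℕ → ℤ
  level N = + 210 * + N + + 99

  -- Parity of `k`, level and `w(l)` are common to both products; only `φ` distinguishes them, and
  -- the weight is linear in it.
  weight : ℕ → (ℤ → ℤ → ℤ) → ℤ × ℤ → ℤ
  weight N φ (k , p) = oddInd k * φ k p * w (+ 4 * p - k) * ind (form k p ℤ.≟ level N)

record Support (N : ℕ) (φ : ℤ → ℤ → ℤ) (k p : ℤ) : Set where
  field
    half    : ℤ
    odd     : k ≡ + 1 + half * + 2
    φ≢0     : φ k p ≢ + 0
    w≢0     : w (+ 4 * p - k) ≢ + 0
    onLevel : form k p ≡ level N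

opaque
  unfolding weight

  support : ∀ N φ k p → weight N φ (k , p) ≢ + 0 → Support N φ k p
  support N φ k p nz = record
    { half = proj₁ k-odd ; odd = proj₂ k-odd ; φ≢0 = proj₂ s₃ ; w≢0 = proj₂ s₂
    ; onLevel = ind-≢0 (form k p ℤ.≟ level N) (proj₂ s₁) }
    where
    O W I : ℤ
    O = oddInd k
    W = w (+ 4 * p - k)
    I = ind (form k p ℤ.≟ level N)
    s₁ : O * φ k p * W ≢ + 0 × I ≢ + 0
    s₁ = *-≢0 (O * φ k p * W) I nz
    s₂ : O * φ k p ≢ + 0 × W ≢ + 0
    s₂ = *-≢0 (O * φ k p) W (proj₁ s₁)
    s₃ : O ≢ + 0 × φ k p ≢ + 0
    s₃ = *-≢0 O (φ k p) (proj₁ s₂)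
    k-odd : ∃[ h ] k ≡ + 1 + h * + 2
    k-odd = quotient 2 1 k (ind-≢0 (k %ℕ 2 ℕ.≟ 1) (proj₁ s₃))

  weight-value : ∀ N φ k p h → k ≡ + 1 + h * + 2 → form k p ≡ level N →
                 weight N φ (k , p) ≡ φ k p * w (+ 4 * p - k)
  weight-value N φ k p h k-odd eq
    rewrite ind-yes (k %ℕ 2 ℕ.≟ 1) (residue 2 1 h k-odd) | ind-yes (form k p ℤ.≟ level N) eq =
    simplify (φ k p) (w (+ 4 * p - k))
    where
    simplify : ∀ x y → + 1 * x * y * + 1 ≡ x * y
    simplify = solve-∀

  weight-+ : ∀ N φ φ′ φ″ → (∀ k p → φ k p ≡ φ′ k p + φ″ k p) →
             ∀ y → weight N φ y ≡ weight N φ′ y + weight N φ″ y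
  weight-+ N φ φ′ φ″ eq (k , p) =
    trans (cong (λ z → oddInd k * z * w (+ 4 * p - k) * ind (form k p ℤ.≟ level N)) (eq k p))
          (distrib (oddInd k) (φ′ k p) (φ″ k p) (w (+ 4 * p - k)) (ind (form k p ℤ.≟ level N)))
    where
    distrib : ∀ o x y u i → o * (x + y) * u * i ≡ o * x * u * i + o * y * u * i
    distrib = solve-∀

opaque
  unfolding level

  -- One bound for all truncations. It exceeds `N`, as the triple product requires, and it is the
  -- value of the form itself, which dominates the coordinates of every point on the level.
  bound : ℕ → ℕ
  bound N = 210 ℕ.* N ℕ.+ 99

  N<bound : ∀ N → N ℕ.< bound N
  N<bound N = ℕₚ.≤-trans (ℕₚ.≤-reflexive (ℕₚ.+-comm 1 N))
    (ℕₚ.+-mono-≤ (ℕₚ.m≤n*m N 210) (s≤s (z≤n {98})))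

  -- 9k² - 2kp + 4p² = (k - p)² + 8k² + 3p²
  form-bound : ∀ N k p → form k p ≡ level N → ∣ k ∣ ℕ.≤ bound N × ∣ p ∣ ℕ.≤ bound N
  form-bound N k p eq =
      (begin
        K           ≤⟨ self-≤-square K ⟩
        K ℕ.* K     ≤⟨ ℕₚ.m≤n*m (K ℕ.* K) 8 ⟩
        8 ℕ.* (K ℕ.* K) ≤⟨ ℕₚ.m≤n+m (8 ℕ.* (K ℕ.* K)) (D ℕ.* D) ⟩
        D ℕ.* D ℕ.+ 8 ℕ.* (K ℕ.* K) ≤⟨ ℕₚ.m≤m+n (D ℕ.* D ℕ.+ 8 ℕ.* (K ℕ.* K)) (3 ℕ.* (P ℕ.* P)) ⟩
        D ℕ.* D ℕ.+ 8 ℕ.* (K ℕ.* K) ℕ.+ 3 ℕ.* (P ℕ.* P) ≡⟨ total ⟩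
        bound N ∎)
    , (begin
        P           ≤⟨ self-≤-square P ⟩
        P ℕ.* P     ≤⟨ ℕₚ.m≤n*m (P ℕ.* P) 3 ⟩
        3 ℕ.* (P ℕ.* P) ≤⟨ ℕₚ.m≤n+m (3 ℕ.* (P ℕ.* P)) (D ℕ.* D ℕ.+ 8 ℕ.* (K ℕ.* K)) ⟩
        D ℕ.* D ℕ.+ 8 ℕ.* (K ℕ.* K) ℕ.+ 3 ℕ.* (P ℕ.* P) ≡⟨ total ⟩
        bound N ∎)
    where
    open ℕₚ.≤-Reasoning
    D K P : ℕ
    D = ∣ k - p ∣
    K = ∣ k ∣
    P = ∣ p ∣
    self-≤-square : ∀ n → n ℕ.≤ n ℕ.* n
    self-≤-square zero    = z≤n
    self-≤-square (suc n) = ℕₚ.m≤m+n (suc n) (n ℕ.* suc n)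
    squares : ∀ k p → + 9 * (k * k) - + 2 * (k * p) + + 4 * (p * p)
                    ≡ (k - p) * (k - p) + + 8 * (k * k) + + 3 * (p * p)
    squares = solve-∀
    total : D ℕ.* D ℕ.+ 8 ℕ.* (K ℕ.* K) ℕ.+ 3 ℕ.* (P ℕ.* P) ≡ bound N
    total = ℤₚ.+-injective (≡.begin
      + (D ℕ.* D ℕ.+ 8 ℕ.* (K ℕ.* K) ℕ.+ 3 ℕ.* (P ℕ.* P))
        ≡.≡⟨ trans (ℤₚ.pos-+ (D ℕ.* D ℕ.+ 8 ℕ.* (K ℕ.* K)) (3 ℕ.* (P ℕ.* P)))
               (cong₂ _+_ (trans (ℤₚ.pos-+ (D ℕ.* D) (8 ℕ.* (K ℕ.* K))) (cong (_+_ (+ (D ℕ.* D))) (ℤₚ.pos-* 8 (K ℕ.* K))))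
                          (ℤₚ.pos-* 3 (P ℕ.* P))) ⟩
      + (D ℕ.* D) + + 8 * + (K ℕ.* K) + + 3 * + (P ℕ.* P)
        ≡.≡⟨ sym (cong₂ _+_ (cong₂ (λ x y → x + + 8 * y) (square-abs (k - p)) (square-abs k))
                            (cong (+ 3 *_) (square-abs p))) ⟩
      (k - p) * (k - p) + + 8 * (k * k) + + 3 * (p * p)
        ≡.≡⟨ trans (sym (squares k p)) eq ⟩
      + 210 * + N + + 99
        ≡.≡⟨ sym (trans (ℤₚ.pos-+ (210 ℕ.* N) 99) (cong (_+ + 99) (ℤₚ.pos-* 210 N))) ⟩
      + bound N ≡.∎)
      where module ≡ = ≡-Reasoning

  box : ℕ → List (ℤ × ℤ)
  box B = cartesianProduct (range B) (range B)

_≟ℤ²_ = _≟×_ ℤ._≟_ ℤ._≟_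

opaque
  unfolding box

  count-box : ∀ B j k → ∣ j ∣ ℕ.≤ B → ∣ k ∣ ℕ.≤ B → count _≟ℤ²_ (box B) (j , k) ≡ + 1
  count-box B j k j≤B k≤B =
    trans (count-× ℤ._≟_ ℤ._≟_ (range B) (range B) j k)
          (cong₂ _*_ (count-range B j j≤B) (count-range B k k≤B))

count-level : ∀ N k p → form k p ≡ level N → count _≟ℤ²_ (box (bound N)) (k , p) ≡ + 1
count-level N k p eq = count-box (bound N) k p (proj₁ (form-bound N k p eq)) (proj₂ (form-bound N k p eq))

-- The product of the theta series modulo 7 and 5 as a weighted sum

module T₇ = TripleProduct 0 5
module T₅ = TripleProduct 1 2
module T₃ = TripleProduct 0 1

*-cancel : ∀ c .{{_ : ℤ.NonZero c}} {x y} → c * x ≡ c * y → x ≡ y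
*-cancel c {x} {y} = ℤₚ.*-cancelˡ-≡ c x y

left : ℕ → ℤ × ℤ → ℤ
left N (j , n) = parity j * parity n * mono (T₇.expo j ℕ.+ T₅.expo n) N

quadratic₇₅ : ∀ j n N → T₇.expo j ℕ.+ T₅.expo n ≡ N →
  + 2 * + N ≡ + 7 * (j * j) - + 5 * j + (+ 5 * (n * n) - n)
quadratic₇₅ j n _ refl = trans (cong (+ 2 *_) (ℤₚ.pos-+ (T₇.expo j) (T₅.expo n)))
  (trans (ℤₚ.*-distribˡ-+ (+ 2) (+ T₇.expo j) (+ T₅.expo n))
  (trans (cong₂ _+_ (T₇.expo-quadratic j) (T₅.expo-quadratic n)) (tidy j n)))
  where
  tidy : ∀ j n → + 7 * (j * j) + - + 5 * j + (+ 5 * (n * n) + - + 1 * n)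
               ≡ + 7 * (j * j) - + 5 * j + (+ 5 * (n * n) - n)
  tidy = solve-∀

quadratic₇₅⁻¹ : ∀ j n N → + 2 * + N ≡ + 7 * (j * j) - + 5 * j + (+ 5 * (n * n) - n) →
  T₇.expo j ℕ.+ T₅.expo n ≡ N
quadratic₇₅⁻¹ j n N eq = ℤₚ.+-injective (*-cancel (+ 2) (trans (quadratic₇₅ j n _ refl) (sym eq)))

opaque
  unfolding level

  level-double : ∀ N q → + 2 * + N ≡ q → + 2 * level N ≡ + 210 * q + + 198
  level-double N q refl = identity (+ N)
    where
    identity : ∀ n → + 2 * (+ 210 * n + + 99) ≡ + 210 * (+ 2 * n) + + 198
    identity = solve-∀

level-double⁻¹ : ∀ N q → + 2 * level N ≡ + 210 * q + + 198 → + 2 * + N ≡ q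
level-double⁻¹ N q eq = *-cancel (+ 210)
  (+-cancelʳ (+ 198) _ _ (trans (sym (level-double N _ refl)) eq))

-- From `k = (X + Y)/2` and `p = 3 (X - Y)/4` one gets `3k + 2p = 3X` and `3k - 2p = 3Y`. The second
-- equation is squared because `Y` is only known to be `±(10n - 1)`.
leftRel : ℤ × ℤ → ℤ × ℤ → Set
leftRel (j , n) (k , p) =
  + 3 * k + + 2 * p ≡ + 3 * (+ 14 * j - + 5) ×
  (+ 3 * k - + 2 * p) * (+ 3 * k - + 2 * p) ≡ + 3 * (+ 10 * n - + 1) * (+ 3 * (+ 10 * n - + 1))

-- `φL` records that `p = 3 (X - Y)/4` is a multiple of 3, `φR` is what remains of the signs on the
-- other side once the characters modulo 4 are removed, and `φS` is the difference.
φL φR φS : ℤ → ℤ → ℤ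
φL k p = mult3 p
φR k p = - (ψ₃ k * ψ₃ (+ 4 * p - k))
φS k p = mult3 (p - + 2 * k)

mult3-yes : ∀ q {x} → x ≡ q * + 3 → mult3 x ≡ + 1
mult3-yes q {x} eq = ind-yes (x %ℕ 3 ℕ.≟ 0) (residue 3 0 q (trans eq (sym (ℤₚ.+-identityˡ _))))

mult3-≢0 : ∀ x → mult3 x ≢ + 0 → ∃[ q ] x ≡ q * + 3
mult3-≢0 x nz with quotient 3 0 x (ind-≢0 (x %ℕ 3 ℕ.≟ 0) nz)
... | q , eq = q , trans eq (ℤₚ.+-identityˡ _)

left-to : ∀ N x → left N x ≢ + 0 →
  ∃[ y ] (leftRel x y × weight N φL y ≡ left N x × count _≟ℤ²_ (box (bound N)) y ≡ + 1)
left-to N (j , n) nz with evenOrOdd (j + n)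
... | inj₁ (h , j+n) = (k , p) , rel , value , count-level N k p onLevel
  where
  sumN = mono-≢0 (T₇.expo j ℕ.+ T₅.expo n) N (proj₂ (*-≢0 (parity j * parity n) _ nz))
  k p : ℤ
  -- For even `j + n` the choice `Y = 10n - 1` makes `(X + Y)/2 = 7j + 5n - 3` odd; then
  -- `n = 2h - j` is substituted.
  k = + 2 * j + + 10 * h - + 3
  p = (+ 6 * j - + 5 * h - + 1) * + 3
  n≡ : n ≡ + 2 * h - j
  n≡ = trans (i₁ j n) (trans (cong (_- j) j+n) (i₂ j h))
    where
    i₁ : ∀ j n → n ≡ (j + n) - j
    i₁ = solve-∀
    i₂ : ∀ j h → + 0 + h * + 2 - j ≡ + 2 * h - j
    i₂ = solve-∀
  rel : leftRel (j , n) (k , p)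
  rel rewrite n≡ = i₁ j h , i₂ j h
    where
    i₁ : ∀ j h → + 3 * (+ 2 * j + + 10 * h - + 3) + + 2 * ((+ 6 * j - + 5 * h - + 1) * + 3)
               ≡ + 3 * (+ 14 * j - + 5)
    i₁ = solve-∀
    i₂ : ∀ j h → (+ 3 * (+ 2 * j + + 10 * h - + 3) - + 2 * ((+ 6 * j - + 5 * h - + 1) * + 3))
                 * (+ 3 * (+ 2 * j + + 10 * h - + 3) - + 2 * ((+ 6 * j - + 5 * h - + 1) * + 3))
               ≡ + 3 * (+ 10 * (+ 2 * h - j) - + 1) * (+ 3 * (+ 10 * (+ 2 * h - j) - + 1))
    i₂ = solve-∀
  onLevel : form k p ≡ level N
  onLevel = *-cancel (+ 2) (trans (i₁ j h) (sym (level-double N _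
    (trans (quadratic₇₅ j n N sumN) (cong (λ z → + 7 * (j * j) - + 5 * j + (+ 5 * (z * z) - z)) n≡)))))
    where
    i₁ : ∀ j h → + 2 * (+ 9 * ((+ 2 * j + + 10 * h - + 3) * (+ 2 * j + + 10 * h - + 3))
                        - + 2 * ((+ 2 * j + + 10 * h - + 3) * ((+ 6 * j - + 5 * h - + 1) * + 3))
                        + + 4 * ((+ 6 * j - + 5 * h - + 1) * + 3 * ((+ 6 * j - + 5 * h - + 1) * + 3)))
               ≡ + 210 * (+ 7 * (j * j) - + 5 * j
                          + (+ 5 * ((+ 2 * h - j) * (+ 2 * h - j)) - (+ 2 * h - j))) + + 198
    i₁ = solve-∀
  value : weight N φL (k , p) ≡ left N (j , n)
  value = trans (weight-value N φL k p (j + + 5 * h - + 2) (i₁ j h) onLevel)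
    (trans (cong₂ _*_ (mult3-yes (+ 6 * j - + 5 * h - + 1) refl)
                      (char-value 35 26 19 26 (+ 2 * j - + 2 * h - + 1) (i₂ j h)))
           (sym (cong₂ _*_ (trans (sym (parity-+ j n)) (parity-even h j+n)) (mono-yes _ N sumN))))
    where
    i₁ : ∀ j h → + 2 * j + + 10 * h - + 3 ≡ + 1 + (j + + 5 * h - + 2) * + 2
    i₁ = solve-∀
    i₂ : ∀ j h → + 4 * ((+ 6 * j - + 5 * h - + 1) * + 3) - (+ 2 * j + + 10 * h - + 3)
               ≡ + 26 + (+ 2 * j - + 2 * h - + 1) * + 35
    i₂ = solve-∀
... | inj₂ (h , j+n) = (k , p) , rel , value , count-level N k p onLevel
  where
  sumN = mono-≢0 (T₇.expo j ℕ.+ T₅.expo n) N (proj₂ (*-≢0 (parity j * parity n) _ nz))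
  k p : ℤ
  -- For odd `j + n` it is `Y = 1 - 10n` that makes `(X + Y)/2 = 7j - 5n - 2` odd. Reversing `Y`
  -- negates `l` modulo 5, so `l` is 19 instead of 26 modulo 35, in accordance with the sign `-1`.
  k = + 12 * j - + 10 * h - + 7
  p = (j + + 5 * h + + 1) * + 3
  n≡ : n ≡ + 1 + + 2 * h - j
  n≡ = trans (i₁ j n) (trans (cong (_- j) j+n) (i₂ j h))
    where
    i₁ : ∀ j n → n ≡ (j + n) - j
    i₁ = solve-∀
    i₂ : ∀ j h → + 1 + h * + 2 - j ≡ + 1 + + 2 * h - j
    i₂ = solve-∀
  rel : leftRel (j , n) (k , p)
  rel rewrite n≡ = i₁ j h , i₂ j h
    where
    i₁ : ∀ j h → + 3 * (+ 12 * j - + 10 * h - + 7) + + 2 * ((j + + 5 * h + + 1) * + 3)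
               ≡ + 3 * (+ 14 * j - + 5)
    i₁ = solve-∀
    i₂ : ∀ j h → (+ 3 * (+ 12 * j - + 10 * h - + 7) - + 2 * ((j + + 5 * h + + 1) * + 3))
                 * (+ 3 * (+ 12 * j - + 10 * h - + 7) - + 2 * ((j + + 5 * h + + 1) * + 3))
               ≡ + 3 * (+ 10 * (+ 1 + + 2 * h - j) - + 1) * (+ 3 * (+ 10 * (+ 1 + + 2 * h - j) - + 1))
    i₂ = solve-∀
  onLevel : form k p ≡ level N
  onLevel = *-cancel (+ 2) (trans (i₁ j h) (sym (level-double N _
    (trans (quadratic₇₅ j n N sumN) (cong (λ z → + 7 * (j * j) - + 5 * j + (+ 5 * (z * z) - z)) n≡)))))
    where
    i₁ : ∀ j h → + 2 * (+ 9 * ((+ 12 * j - + 10 * h - + 7) * (+ 12 * j - + 10 * h - + 7))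
                        - + 2 * ((+ 12 * j - + 10 * h - + 7) * ((j + + 5 * h + + 1) * + 3))
                        + + 4 * ((j + + 5 * h + + 1) * + 3 * ((j + + 5 * h + + 1) * + 3)))
               ≡ + 210 * (+ 7 * (j * j) - + 5 * j
                          + (+ 5 * ((+ 1 + + 2 * h - j) * (+ 1 + + 2 * h - j)) - (+ 1 + + 2 * h - j))) + + 198
    i₁ = solve-∀
  value : weight N φL (k , p) ≡ left N (j , n)
  value = trans (weight-value N φL k p (+ 6 * j - + 5 * h - + 4) (i₁ j h) onLevel)
    (trans (cong₂ _*_ (mult3-yes (j + + 5 * h + + 1) refl)
                      (char-value 35 26 19 19 (+ 2 * h) (i₂ j h)))
           (sym (cong₂ _*_ (trans (sym (parity-+ j n)) (parity-odd h j+n)) (mono-yes _ N sumN))))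
    where
    i₁ : ∀ j h → + 12 * j - + 10 * h - + 7 ≡ + 1 + (+ 6 * j - + 5 * h - + 4) * + 2
    i₁ = solve-∀
    i₂ : ∀ j h → + 4 * ((j + + 5 * h + + 1) * + 3) - (+ 12 * j - + 10 * h - + 7)
               ≡ + 19 + (+ 2 * h) * + 35
    i₂ = solve-∀

count-left : ∀ N j n → T₇.expo j ℕ.+ T₅.expo n ≡ N → count _≟ℤ²_ (box (bound N)) (j , n) ≡ + 1
count-left N j n refl = count-box (bound N) j n
  (ℕₚ.≤-trans (T₇.∣j∣≤expo j) (ℕₚ.≤-trans (ℕₚ.m≤m+n _ _) (ℕₚ.<⇒≤ (N<bound N))))
  (ℕₚ.≤-trans (T₅.∣j∣≤expo n) (ℕₚ.≤-trans (ℕₚ.m≤n+m _ (T₇.expo j)) (ℕₚ.<⇒≤ (N<bound N))))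

left-value : ∀ N j n → T₇.expo j ℕ.+ T₅.expo n ≡ N → left N (j , n) ≡ parity (j + n)
left-value N j n eq = trans (cong (parity j * parity n *_) (mono-yes _ N eq))
  (trans (ℤₚ.*-identityʳ _) (sym (parity-+ j n)))

left-from : ∀ N y → weight N φL y ≢ + 0 →
  ∃[ x ] (leftRel x y × left N x ≡ weight N φL y × count _≟ℤ²_ (box (bound N)) x ≡ + 1)
left-from N (k , p) nz = byMult (mult3-≢0 p φ≢0)
  where
  open Support (support N φL k p nz)
  Goal = ∃[ x ] (leftRel x (k , p) × left N x ≡ weight N φL (k , p) × count _≟ℤ²_ (box (bound N)) x ≡ + 1)

  value : ∀ {c} → φL k p ≡ + 1 → w (+ 4 * p - k) ≡ c → weight N φL (k , p) ≡ c
  value φ≡1 w≡c = trans (weight-value N φL k p half odd onLevel)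
                        (trans (cong₂ _*_ φ≡1 w≡c) (ℤₚ.*-identityˡ _))

  k≡ : ∀ {q l} → p ≡ q * + 3 → + 4 * p - k ≡ l → k ≡ + 12 * q - l
  k≡ {q} refl refl = identity k q
    where
    identity : ∀ k q → k ≡ + 12 * q - (+ 4 * (q * + 3) - k)
    identity = solve-∀

  residue26 : ∀ q v → p ≡ q * + 3 → + 4 * p - k ≡ + 26 + (+ 1 + v * + 2) * + 35 → Goal
  residue26 q v p-eq l-eq =
    (j , n) , (rel₁ , rel₂) , trans (left-value N j n sumN) (trans (parity-even (q - + 5 - + 6 * v) (i₃ q v))
        (sym (value (mult3-yes q p-eq) (char-value 35 26 19 26 (+ 1 + v * + 2) l-eq))))
    , count-left N j n sumN
    where
    j n : ℤ
    -- With `p = 3q` one has `X = k + 2q = 14q - l` and `Y = k - 2q = 10q - l`. Here `l = 61 + 70v`,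
    -- and `X = 14j - 5`, `Y = 10n - 1` are solved for `j` and `n`.
    j = q - + 4 - + 5 * v
    n = q - + 6 - + 7 * v
    k-eq = k≡ {q} p-eq l-eq
    i₁ : ∀ q v → + 3 * (+ 12 * q - (+ 26 + (+ 1 + v * + 2) * + 35)) + + 2 * (q * + 3)
               ≡ + 3 * (+ 14 * (q - + 4 - + 5 * v) - + 5)
    i₁ = solve-∀
    i₂ : ∀ q v → + 3 * (+ 12 * q - (+ 26 + (+ 1 + v * + 2) * + 35)) - + 2 * (q * + 3)
               ≡ + 3 * (+ 10 * (q - + 6 - + 7 * v) - + 1)
    i₂ = solve-∀
    i₃ : ∀ q v → q - + 4 - + 5 * v + (q - + 6 - + 7 * v) ≡ + 0 + (q - + 5 - + 6 * v) * + 2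
    i₃ = solve-∀
    rel₁ : + 3 * k + + 2 * p ≡ + 3 * (+ 14 * j - + 5)
    rel₁ = trans (cong₂ (λ k p → + 3 * k + + 2 * p) k-eq p-eq) (i₁ q v)
    rel₂ : (+ 3 * k - + 2 * p) * (+ 3 * k - + 2 * p) ≡ + 3 * (+ 10 * n - + 1) * (+ 3 * (+ 10 * n - + 1))
    rel₂ = cong (λ y → y * y) (trans (cong₂ (λ k p → + 3 * k - + 2 * p) k-eq p-eq) (i₂ q v))
    i₄ : ∀ q v → + 2 * (+ 9 * ((+ 12 * q - (+ 26 + (+ 1 + v * + 2) * + 35)) * (+ 12 * q - (+ 26 + (+ 1 + v * + 2) * + 35)))
                        - + 2 * ((+ 12 * q - (+ 26 + (+ 1 + v * + 2) * + 35)) * (q * + 3)) + + 4 * (q * + 3 * (q * + 3)))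
               ≡ + 210 * (+ 7 * ((q - + 4 - + 5 * v) * (q - + 4 - + 5 * v)) - + 5 * (q - + 4 - + 5 * v)
                         + (+ 5 * ((q - + 6 - + 7 * v) * (q - + 6 - + 7 * v)) - (q - + 6 - + 7 * v))) + + 198
    i₄ = solve-∀
    sumN : T₇.expo j ℕ.+ T₅.expo n ≡ N
    sumN = quadratic₇₅⁻¹ j n N (level-double⁻¹ N _
      (trans (cong (+ 2 *_) (trans (sym onLevel) (cong₂ form k-eq p-eq))) (i₄ q v)))

  residue19 : ∀ q v → p ≡ q * + 3 → + 4 * p - k ≡ + 19 + (+ 0 + v * + 2) * + 35 → Goal
  residue19 q v p-eq l-eq =
    (j , n) , (rel₁ , rel₂) , trans (left-value N j n sumN) (trans (parity-odd v (i₃ q v))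
        (sym (value (mult3-yes q p-eq) (char-value 35 26 19 19 (+ 0 + v * + 2) l-eq))))
    , count-left N j n sumN
    where
    j n : ℤ
    -- Now `l = 19 + 70v`, so `10q - l` is 1 modulo 10 and the other sign `Y = 1 - 10n` applies.
    j = q - + 1 - + 5 * v
    n = + 2 + + 7 * v - q
    k-eq = k≡ {q} p-eq l-eq
    i₁ : ∀ q v → + 3 * (+ 12 * q - (+ 19 + (+ 0 + v * + 2) * + 35)) + + 2 * (q * + 3)
               ≡ + 3 * (+ 14 * (q - + 1 - + 5 * v) - + 5)
    i₁ = solve-∀
    i₂ : ∀ q v → (+ 3 * (+ 12 * q - (+ 19 + (+ 0 + v * + 2) * + 35)) - + 2 * (q * + 3))
                 * (+ 3 * (+ 12 * q - (+ 19 + (+ 0 + v * + 2) * + 35)) - + 2 * (q * + 3))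
               ≡ + 3 * (+ 10 * (+ 2 + + 7 * v - q) - + 1) * (+ 3 * (+ 10 * (+ 2 + + 7 * v - q) - + 1))
    i₂ = solve-∀
    i₃ : ∀ q v → q - + 1 - + 5 * v + (+ 2 + + 7 * v - q) ≡ + 1 + v * + 2
    i₃ = solve-∀
    rel₁ : + 3 * k + + 2 * p ≡ + 3 * (+ 14 * j - + 5)
    rel₁ = trans (cong₂ (λ k p → + 3 * k + + 2 * p) k-eq p-eq) (i₁ q v)
    rel₂ : (+ 3 * k - + 2 * p) * (+ 3 * k - + 2 * p) ≡ + 3 * (+ 10 * n - + 1) * (+ 3 * (+ 10 * n - + 1))
    rel₂ = trans (cong₂ (λ k p → (+ 3 * k - + 2 * p) * (+ 3 * k - + 2 * p)) k-eq p-eq) (i₂ q v)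
    i₄ : ∀ q v → + 2 * (+ 9 * ((+ 12 * q - (+ 19 + (+ 0 + v * + 2) * + 35)) * (+ 12 * q - (+ 19 + (+ 0 + v * + 2) * + 35)))
                        - + 2 * ((+ 12 * q - (+ 19 + (+ 0 + v * + 2) * + 35)) * (q * + 3)) + + 4 * (q * + 3 * (q * + 3)))
               ≡ + 210 * (+ 7 * ((q - + 1 - + 5 * v) * (q - + 1 - + 5 * v)) - + 5 * (q - + 1 - + 5 * v)
                         + (+ 5 * ((+ 2 + + 7 * v - q) * (+ 2 + + 7 * v - q)) - (+ 2 + + 7 * v - q))) + + 198
    i₄ = solve-∀
    sumN : T₇.expo j ℕ.+ T₅.expo n ≡ N
    sumN = quadratic₇₅⁻¹ j n N (level-double⁻¹ N _
      (trans (cong (+ 2 *_) (trans (sym onLevel) (cong₂ form k-eq p-eq))) (i₄ q v)))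

  byMult : (∃[ q ] p ≡ q * + 3) → Goal
  byMult (q , p-eq) with char-≢0 35 26 19 (+ 4 * p - k) w≢0
  ... | inj₁ (v , l-eq) with evenOrOdd v
  ...   | inj₂ (v′ , refl) = residue26 q v′ p-eq l-eq
  -- An even `v` would make `l`, and with it `k = 12q - l`, even.
  ...   | inj₁ (v′ , refl) = ⊥-elim (residue-clash 2 1 0 half (+ 6 * q - + 13 - + 35 * v′) (λ ())
            (trans (sym odd) (trans (k≡ {q} p-eq l-eq) (identity q v′))))
    where
    identity : ∀ q v → + 12 * q - (+ 26 + (+ 0 + v * + 2) * + 35) ≡ + 0 + (+ 6 * q - + 13 - + 35 * v) * + 2
    identity = solve-∀
  byMult (q , p-eq) | inj₂ (v , l-eq) with evenOrOdd v
  ...   | inj₁ (v′ , refl) = residue19 q v′ p-eq l-eq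
  ...   | inj₂ (v′ , refl) = ⊥-elim (residue-clash 2 1 0 half (+ 6 * q - + 27 - + 35 * v′) (λ ())
            (trans (sym odd) (trans (k≡ {q} p-eq l-eq) (identity q v′))))
    where
    identity : ∀ q v → + 12 * q - (+ 19 + (+ 1 + v * + 2) * + 35) ≡ + 0 + (+ 6 * q - + 27 - + 35 * v) * + 2
    identity = solve-∀

-- The two signs of `Y` cannot both occur: adding the equations would give `6k = 4p′`, against `k`
-- odd.
left-functional : ∀ N x y y′ → weight N φL y ≢ + 0 → weight N φL y′ ≢ + 0 →
                  leftRel x y → leftRel x y′ → y ≡ y′
left-functional N _ (k , p) (k′ , p′) nz _ (s , d) (s′ , d′) =
  go (square-≡ (+ 3 * k - + 2 * p) (+ 3 * k′ - + 2 * p′) (trans d (sym d′)))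
  where
  open Support (support N φL k p nz)
  sum : + 3 * k + + 2 * p ≡ + 3 * k′ + + 2 * p′
  sum = trans s (sym s′)
  i₁ : ∀ k p → + 6 * k ≡ (+ 3 * k + + 2 * p) + (+ 3 * k - + 2 * p)
  i₁ = solve-∀
  i₂ : ∀ k p → + 4 * p ≡ (+ 3 * k + + 2 * p) - (+ 3 * k - + 2 * p)
  i₂ = solve-∀
  i₃ : ∀ h → + 2 * (+ 1 + (+ 1 + + 3 * h) * + 2) ≡ + 6 * (+ 1 + h * + 2)
  i₃ = solve-∀
  i₄ : ∀ k p → (+ 3 * k + + 2 * p) + - (+ 3 * k - + 2 * p) ≡ + 2 * (+ 0 + p * + 2)
  i₄ = solve-∀
  go : + 3 * k - + 2 * p ≡ + 3 * k′ - + 2 * p′ ⊎ + 3 * k - + 2 * p ≡ - (+ 3 * k′ - + 2 * p′) →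
       (k , p) ≡ (k′ , p′)
  go (inj₁ eq) = cong₂ _,_
    (*-cancel (+ 6) (trans (i₁ k p) (trans (cong₂ _+_ sum eq) (sym (i₁ k′ p′)))))
    (*-cancel (+ 4) (trans (i₂ k p) (trans (cong₂ _-_ sum eq) (sym (i₂ k′ p′)))))
  go (inj₂ eq) = ⊥-elim (residue-clash 2 1 0 (+ 1 + + 3 * half) p′ (λ ())
    (*-cancel (+ 2) (trans (i₃ half) (trans (cong (+ 6 *_) (sym odd))
      (trans (i₁ k p) (trans (cong₂ _+_ sum eq) (i₄ k′ p′)))))))

-- Opposite values of `10n - 1` are excluded modulo 5, as they would give `10 (n + n′) = 2`.
left-injective : ∀ x x′ y → leftRel x y → leftRel x′ y → x ≡ x′
left-injective (j , n) (j′ , n′) _ (s , d) (s′ , d′) =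
  go (square-≡ (+ 3 * (+ 10 * n - + 1)) (+ 3 * (+ 10 * n′ - + 1)) (trans (sym d) d′))
  where
  i₁ : ∀ j → + 42 * j ≡ + 3 * (+ 14 * j - + 5) + + 15
  i₁ = solve-∀
  i₂ : ∀ n → + 30 * n ≡ + 3 * (+ 10 * n - + 1) + + 3
  i₂ = solve-∀
  i₃ : ∀ n n′ → + 6 * (+ 0 + (n + n′) * + 5) ≡ + 3 * (+ 10 * n - + 1) + (+ 30 * n′ + + 3)
  i₃ = solve-∀
  i₄ : ∀ n′ → - (+ 3 * (+ 10 * n′ - + 1)) + (+ 30 * n′ + + 3) ≡ + 6 * (+ 1 + + 0 * + 5)
  i₄ = solve-∀
  go : + 3 * (+ 10 * n - + 1) ≡ + 3 * (+ 10 * n′ - + 1) ⊎ + 3 * (+ 10 * n - + 1) ≡ - (+ 3 * (+ 10 * n′ - + 1)) →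
       (j , n) ≡ (j′ , n′)
  go (inj₁ eq) = cong₂ _,_
    (*-cancel (+ 42) (trans (i₁ j) (trans (cong (_+ + 15) (trans (sym s) s′)) (sym (i₁ j′)))))
    (*-cancel (+ 30) (trans (i₂ n) (trans (cong (_+ + 3) eq) (sym (i₂ n′)))))
  go (inj₂ eq) = ⊥-elim (residue-clash 5 0 1 (n + n′) (+ 0) (λ ())
    (*-cancel (+ 6) (trans (i₃ n n′) (trans (cong (_+ (+ 30 * n′ + + 3)) eq) (i₄ n′)))))

left-sum : ∀ N → ∑ (box (bound N)) (left N) ≡ ∑ (box (bound N)) (weight N φL)
left-sum N = reindex _≟ℤ²_ _≟ℤ²_ (box (bound N)) (box (bound N)) (left N) (weight N φL) leftRel
  (left-to N) (left-from N) (left-functional N) (λ x x′ y _ _ → left-injective x x′ y)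

-- The vanishing sum and the comparison of the two weights

∑-neg : ∀ {A : Set} (f : A → ℤ) xs → ∑ xs (λ x → - f x) ≡ - ∑ xs f
∑-neg f xs = trans (∑-cong (λ x → sym (ℤₚ.-1*i≡-i (f x))) xs)
  (trans (∑-distribˡ-* (- + 1) f xs) (ℤₚ.-1*i≡-i (∑ xs f)))

-- The reflection `k′ = -k - 2h`, `p′ = -2k - h` with `3h = p - 2k` eliminated. In this form it is
-- linear in `k` and `p` and needs no quotient by 3.
mirrorRel : ℤ × ℤ → ℤ × ℤ → Set
mirrorRel (k , p) (k′ , p′) = + 3 * k′ ≡ k - + 2 * p × + 3 * p′ ≡ - (p + + 4 * k)

-- In the coordinates h = (p - 2k)/3, g = k + h the form is 21g² + 15h² and l = 7g + 5h;
-- the reflection g ↦ -g multiplies l by -6 modulo 35 and so changes the sign of w l.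
mirror : ∀ N k p → weight N φS (k , p) ≢ + 0 →
  ∃[ k′ ] ∃[ p′ ] (mirrorRel (k , p) (k′ , p′) × mirrorRel (k′ , p′) (k , p) ×
                   weight N φS (k′ , p′) ≡ - weight N φS (k , p) ×
                   count _≟ℤ²_ (box (bound N)) (k′ , p′) ≡ + 1)
mirror N k p nz with mult3-≢0 (p - + 2 * k) (Support.φ≢0 (support N φS k p nz))
... | q , p-eq = k′ , p′ , (r₁ , r₂) , (r₃ , r₄) , value , count-level N k′ p′ onLevel′
  where
  open Support (support N φS k p nz)
  k′ p′ : ℤ
  k′ = - k - + 2 * q
  p′ = - (+ 2 * k) - q
  p≡ : p ≡ + 2 * k + q * + 3
  p≡ = trans (identity p k) (cong (_+_ (+ 2 * k)) p-eq)
    where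
    identity : ∀ p k → p ≡ + 2 * k + (p - + 2 * k)
    identity = solve-∀
  i₁ : ∀ k q → + 3 * (- k - + 2 * q) ≡ k - + 2 * (+ 2 * k + q * + 3)
  i₁ = solve-∀
  i₂ : ∀ k q → + 3 * (- (+ 2 * k) - q) ≡ - (+ 2 * k + q * + 3 + + 4 * k)
  i₂ = solve-∀
  i₃ : ∀ k q → + 3 * k ≡ - k - + 2 * q - + 2 * (- (+ 2 * k) - q)
  i₃ = solve-∀
  i₄ : ∀ k q → + 3 * (+ 2 * k + q * + 3) ≡ - (- (+ 2 * k) - q + + 4 * (- k - + 2 * q))
  i₄ = solve-∀
  r₁ : + 3 * k′ ≡ k - + 2 * p
  r₁ = trans (i₁ k q) (cong (λ z → k - + 2 * z) (sym p≡))
  r₂ : + 3 * p′ ≡ - (p + + 4 * k)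
  r₂ = trans (i₂ k q) (cong (λ z → - (z + + 4 * k)) (sym p≡))
  r₃ : + 3 * k ≡ k′ - + 2 * p′
  r₃ = i₃ k q
  r₄ : + 3 * p ≡ - (p′ + + 4 * k′)
  r₄ = trans (cong (+ 3 *_) p≡) (i₄ k q)
  i₅ : ∀ k q → + 9 * ((- k - + 2 * q) * (- k - + 2 * q)) - + 2 * ((- k - + 2 * q) * (- (+ 2 * k) - q))
               + + 4 * ((- (+ 2 * k) - q) * (- (+ 2 * k) - q))
             ≡ + 9 * (k * k) - + 2 * (k * (+ 2 * k + q * + 3))
               + + 4 * ((+ 2 * k + q * + 3) * (+ 2 * k + q * + 3))
  i₅ = solve-∀
  onLevel′ : form k′ p′ ≡ level N
  onLevel′ = trans (i₅ k q) (trans (cong (form k) (sym p≡)) onLevel)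
  odd′ : k′ ≡ + 1 + (- + 1 - half - q) * + 2
  odd′ = trans (cong (λ z → - z - + 2 * q) odd) (identity half q)
    where
    identity : ∀ h q → - (+ 1 + h * + 2) - + 2 * q ≡ + 1 + (- + 1 - h - q) * + 2
    identity = solve-∀
  l′≡ : + 4 * p′ - k′ ≡ - + 6 * (+ 4 * p - k) + (k + + 2 * q) * + 35
  l′≡ = trans (identity k q) (cong (λ z → - + 6 * (+ 4 * z - k) + (k + + 2 * q) * + 35) (sym p≡))
    where
    identity : ∀ k q → + 4 * (- (+ 2 * k) - q) - (- k - + 2 * q)
             ≡ - + 6 * (+ 4 * (+ 2 * k + q * + 3) - k) + (k + + 2 * q) * + 35
    identity = solve-∀
  -- `-6` is 1 modulo 7 and `-1` modulo 5, while 26 and 19 agree modulo 7 and are opposite modulo 5;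
  -- hence the two classes are interchanged.
  w-flip : ∀ l l′ t → w l ≢ + 0 → l′ ≡ - + 6 * l + t * + 35 → w l′ ≡ - w l
  w-flip l l′ t w≢0 eq with char-≢0 35 26 19 l w≢0
  ... | inj₁ (v , refl) = trans (char-value 35 26 19 19 (t - + 5 - + 6 * v) (trans eq (identity v t)))
                                (cong -_ (sym (char-value 35 26 19 26 v refl)))
    where
    identity : ∀ v t → - + 6 * (+ 26 + v * + 35) + t * + 35 ≡ + 19 + (t - + 5 - + 6 * v) * + 35
    identity = solve-∀
  ... | inj₂ (v , refl) = trans (char-value 35 26 19 26 (t - + 4 - + 6 * v) (trans eq (identity v t)))
                                (cong -_ (sym (char-value 35 26 19 19 v refl)))
    where
    identity : ∀ v t → - + 6 * (+ 19 + v * + 35) + t * + 35 ≡ + 26 + (t - + 4 - + 6 * v) * + 35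
    identity = solve-∀
  value : weight N φS (k′ , p′) ≡ - weight N φS (k , p)
  value = begin
    weight N φS (k′ , p′)
      ≡⟨ weight-value N φS k′ p′ (- + 1 - half - q) odd′ onLevel′ ⟩
    mult3 (p′ - + 2 * k′) * w (+ 4 * p′ - k′)
      ≡⟨ cong₂ _*_ (mult3-yes q (i₆ k q)) (w-flip (+ 4 * p - k) _ (k + + 2 * q) w≢0 l′≡) ⟩
    + 1 * - w (+ 4 * p - k)
      ≡⟨ sym (ℤₚ.neg-distribʳ-* (+ 1) (w (+ 4 * p - k))) ⟩
    - (+ 1 * w (+ 4 * p - k))
      ≡⟨ cong (λ z → - (z * w (+ 4 * p - k))) (sym (mult3-yes q p-eq)) ⟩
    - (φS k p * w (+ 4 * p - k))
      ≡⟨ cong -_ (sym (weight-value N φS k p half odd onLevel)) ⟩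
    - weight N φS (k , p) ∎
    where
    open ≡-Reasoning
    i₆ : ∀ k q → - (+ 2 * k) - q - + 2 * (- k - + 2 * q) ≡ q * + 3
    i₆ = solve-∀

neg-≢0 : ∀ {x} → - x ≢ + 0 → x ≢ + 0
neg-≢0 p x≡0 = p (cong -_ x≡0)

mirror-sum : ∀ N → ∑ (box (bound N)) (weight N φS) ≡ + 0
mirror-sum N = self-negative (trans
  (reindex _≟ℤ²_ _≟ℤ²_ b b (weight N φS) (λ y → - weight N φS y) mirrorRel to from
    (λ x y y′ _ _ → functional x y y′) (λ x x′ y _ _ → injective x x′ y))
  (∑-neg (weight N φS) b))
  where
  b = box (bound N)
  self-negative : ∀ {x} → x ≡ - x → x ≡ + 0
  self-negative {+ zero}    _ = refl
  self-negative {+ suc n}   ()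
  self-negative { -[1+ n ]} ()
  to : ∀ x → weight N φS x ≢ + 0 →
       ∃[ y ] (mirrorRel x y × - weight N φS y ≡ weight N φS x × count _≟ℤ²_ b y ≡ + 1)
  to x@(k , p) nz =
    let k′ , p′ , r , _ , value , once = mirror N k p nz
    in (k′ , p′) , r , trans (cong -_ value) (ℤₚ.neg-involutive (weight N φS x)) , once
  from : ∀ y → - weight N φS y ≢ + 0 →
       ∃[ x ] (mirrorRel x y × weight N φS x ≡ - weight N φS y × count _≟ℤ²_ b x ≡ + 1)
  from (k , p) nz =
    let k′ , p′ , _ , r , value , once = mirror N k p (neg-≢0 nz)
    in (k′ , p′) , r , value , once
  functional : ∀ x y y′ → mirrorRel x y → mirrorRel x y′ → y ≡ y′
  functional _ _ _ (r₁ , r₂) (s₁ , s₂) =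
    cong₂ _,_ (*-cancel (+ 3) (trans r₁ (sym s₁))) (*-cancel (+ 3) (trans r₂ (sym s₂)))
  injective : ∀ x x′ y → mirrorRel x y → mirrorRel x′ y → x ≡ x′
  injective (k , p) (k′ , p′) _ (r₁ , r₂) (s₁ , s₂) = cong₂ _,_
    (*-cancel (+ 9) (trans (i₁ k p) (trans (cong₂ (λ u v → u - + 2 * v) e₁ e₂) (sym (i₁ k′ p′)))))
    (*-cancel (+ 9) (trans (i₂ k p) (trans (cong₂ (λ u v → - v - + 4 * u) e₁ e₂) (sym (i₂ k′ p′)))))
    where
    e₁ = trans (sym r₁) s₁
    e₂ = trans (sym r₂) s₂
    i₁ : ∀ k p → + 9 * k ≡ (k - + 2 * p) - + 2 * - (p + + 4 * k)
    i₁ = solve-∀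
    i₂ : ∀ k p → + 9 * p ≡ - - (p + + 4 * k) - + 4 * (k - + 2 * p)
    i₂ = solve-∀

-- Everything depends on residues modulo 3, where `4p - k ≡ p - k` and `p - 2k ≡ p + k`. If `3 | k`
-- the product of characters vanishes and both conditions say `3 | p`. Otherwise `φR` is 1, 0, `-1`
-- for `p ≡ 0`, `k`, `-k`, and `φS` cancels the last value.
φ-identity : ∀ k p → φL k p ≡ φR k p + φS k p
φ-identity k p with mod3 k | mod3 p
... | k₃ | p₃ = cases k₃ p₃
  where
  mult3-periodic : ∀ x q → mult3 (x + q * + 3) ≡ mult3 x
  mult3-periodic x q = cong (λ y → ind (y ℕ.≟ 0)) (%ℕ-periodic 3 x q)
  reduce : ∀ r u s v {k p} → k ≡ r + u * + 3 → p ≡ s + v * + 3 →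
           φL r s ≡ φR r s + φS r s → φL k p ≡ φR k p + φS k p
  reduce r u s v refl refl check = begin
    mult3 (s + v * + 3)
      ≡⟨ mult3-periodic s v ⟩
    mult3 s
      ≡⟨ check ⟩
    - (ψ₃ r * ψ₃ (+ 4 * s - r)) + mult3 (s - + 2 * r)
      ≡⟨ sym (cong₂ _+_
           (cong -_ (cong₂ _*_ (char-periodic 3 1 2 r u)
             (trans (cong ψ₃ (i₁ r u s v)) (char-periodic 3 1 2 (+ 4 * s - r) (+ 4 * v - u)))))
           (trans (cong mult3 (i₂ r u s v)) (mult3-periodic (s - + 2 * r) (v - + 2 * u)))) ⟩
    φR (r + u * + 3) (s + v * + 3) + φS (r + u * + 3) (s + v * + 3) ∎
    where
    open ≡-Reasoning
    i₁ : ∀ r u s v → + 4 * (s + v * + 3) - (r + u * + 3) ≡ + 4 * s - r + (+ 4 * v - u) * + 3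
    i₁ = solve-∀
    i₂ : ∀ r u s v → s + v * + 3 - + 2 * (r + u * + 3) ≡ s - + 2 * r + (v - + 2 * u) * + 3
    i₂ = solve-∀
  cases : _ → _ → φL k p ≡ φR k p + φS k p
  cases (inj₁ (u , e)) (inj₁ (v , f))               = reduce (+ 0) u (+ 0) v e f refl
  cases (inj₁ (u , e)) (inj₂ (inj₁ (v , f)))        = reduce (+ 0) u (+ 1) v e f refl
  cases (inj₁ (u , e)) (inj₂ (inj₂ (v , f)))        = reduce (+ 0) u (+ 2) v e f refl
  cases (inj₂ (inj₁ (u , e))) (inj₁ (v , f))        = reduce (+ 1) u (+ 0) v e f refl
  cases (inj₂ (inj₁ (u , e))) (inj₂ (inj₁ (v , f))) = reduce (+ 1) u (+ 1) v e f refl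
  cases (inj₂ (inj₁ (u , e))) (inj₂ (inj₂ (v , f))) = reduce (+ 1) u (+ 2) v e f refl
  cases (inj₂ (inj₂ (u , e))) (inj₁ (v , f))        = reduce (+ 2) u (+ 0) v e f refl
  cases (inj₂ (inj₂ (u , e))) (inj₂ (inj₁ (v , f))) = reduce (+ 2) u (+ 1) v e f refl
  cases (inj₂ (inj₂ (u , e))) (inj₂ (inj₂ (v , f))) = reduce (+ 2) u (+ 2) v e f refl

weight-sum : ∀ N → ∑ (box (bound N)) (weight N φL) ≡ ∑ (box (bound N)) (weight N φR)
weight-sum N = begin
  ∑ b (weight N φL)
    ≡⟨ ∑-cong (weight-+ N φL φR φS φ-identity) b ⟩
  ∑ b (λ y → weight N φR y + weight N φS y)
    ≡⟨ ∑-distrib-+ (weight N φR) (weight N φS) b ⟩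
  ∑ b (weight N φR) + ∑ b (weight N φS)
    ≡⟨ cong (_+_ (∑ b (weight N φR))) (mirror-sum N) ⟩
  ∑ b (weight N φR) + + 0
    ≡⟨ ℤₚ.+-identityʳ _ ⟩
  ∑ b (weight N φR) ∎
  where
  open ≡-Reasoning
  b = box (bound N)

-- The product of `(q;q)` and the left-hand series as a weighted sum

-- Both characters are odd functions, so their product does not see the sign of `k`; this leaves
-- that sign free to be chosen later.
parity≡χ₄ψ₃ : ∀ j k → k ≡ + 6 * j - + 1 ⊎ k ≡ - (+ 6 * j - + 1) → parity j ≡ χ₄ k * ψ₃ k
parity≡χ₄ψ₃ j k k≡ = go (evenOrOdd j) k≡
  where
  i₁ : ∀ h → + 6 * (+ 0 + h * + 2) - + 1 ≡ + 3 + (+ 3 * h - + 1) * + 4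
  i₁ = solve-∀
  i₂ : ∀ h → + 6 * (+ 0 + h * + 2) - + 1 ≡ + 2 + (+ 4 * h - + 1) * + 3
  i₂ = solve-∀
  i₃ : ∀ h → - (+ 6 * (+ 0 + h * + 2) - + 1) ≡ + 1 + (- + 3 * h) * + 4
  i₃ = solve-∀
  i₄ : ∀ h → - (+ 6 * (+ 0 + h * + 2) - + 1) ≡ + 1 + (- + 4 * h) * + 3
  i₄ = solve-∀
  i₅ : ∀ h → + 6 * (+ 1 + h * + 2) - + 1 ≡ + 1 + (+ 3 * h + + 1) * + 4
  i₅ = solve-∀
  i₆ : ∀ h → + 6 * (+ 1 + h * + 2) - + 1 ≡ + 2 + (+ 4 * h + + 1) * + 3
  i₆ = solve-∀
  i₇ : ∀ h → - (+ 6 * (+ 1 + h * + 2) - + 1) ≡ + 3 + (- + 3 * h - + 2) * + 4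
  i₇ = solve-∀
  i₈ : ∀ h → - (+ 6 * (+ 1 + h * + 2) - + 1) ≡ + 1 + (- + 4 * h - + 2) * + 3
  i₈ = solve-∀
  go : (∃[ h ] j ≡ + 0 + h * + 2) ⊎ (∃[ h ] j ≡ + 1 + h * + 2) →
       k ≡ + 6 * j - + 1 ⊎ k ≡ - (+ 6 * j - + 1) → parity j ≡ χ₄ k * ψ₃ k
  go (inj₁ (h , refl)) (inj₁ refl) = trans (parity-even h refl)
    (sym (cong₂ _*_ (char-value 4 1 3 3 (+ 3 * h - + 1) (i₁ h)) (char-value 3 1 2 2 (+ 4 * h - + 1) (i₂ h))))
  go (inj₁ (h , refl)) (inj₂ refl) = trans (parity-even h refl)
    (sym (cong₂ _*_ (char-value 4 1 3 1 (- + 3 * h) (i₃ h)) (char-value 3 1 2 1 (- + 4 * h) (i₄ h))))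
  go (inj₂ (h , refl)) (inj₁ refl) = trans (parity-odd h refl)
    (sym (cong₂ _*_ (char-value 4 1 3 1 (+ 3 * h + + 1) (i₅ h)) (char-value 3 1 2 2 (+ 4 * h + + 1) (i₆ h))))
  go (inj₂ (h , refl)) (inj₂ refl) = trans (parity-odd h refl)
    (sym (cong₂ _*_ (char-value 4 1 3 3 (- + 3 * h - + 2) (i₇ h)) (char-value 3 1 2 1 (- + 4 * h - + 2) (i₈ h))))

odd⇒1or3 : ∀ k h → k ≡ + 1 + h * + 2 → (∃[ v ] k ≡ + 1 + v * + 4) ⊎ (∃[ v ] k ≡ + 3 + v * + 4)
odd⇒1or3 k h k≡ = go (evenOrOdd h)
  where
  i₁ : ∀ v → + 1 + (+ 0 + v * + 2) * + 2 ≡ + 1 + v * + 4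
  i₁ = solve-∀
  i₂ : ∀ v → + 1 + (+ 1 + v * + 2) * + 2 ≡ + 3 + v * + 4
  i₂ = solve-∀
  go : (∃[ v ] h ≡ + 0 + v * + 2) ⊎ (∃[ v ] h ≡ + 1 + v * + 2) →
       (∃[ v ] k ≡ + 1 + v * + 4) ⊎ (∃[ v ] k ≡ + 3 + v * + 4)
  go (inj₁ (v , refl)) = inj₁ (v , trans k≡ (i₁ v))
  go (inj₂ (v , refl)) = inj₂ (v , trans k≡ (i₂ v))

-- `k` and `4p - k` are opposite modulo 4, and the character is odd.
χ₄-complement : ∀ k p h → k ≡ + 1 + h * + 2 → χ₄ k * χ₄ (+ 4 * p - k) ≡ - + 1
χ₄-complement k p h k≡ = go (odd⇒1or3 k h k≡)
  where
  i₁ : ∀ p v → + 4 * p - (+ 1 + v * + 4) ≡ + 3 + (p - v - + 1) * + 4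
  i₁ = solve-∀
  i₂ : ∀ p v → + 4 * p - (+ 3 + v * + 4) ≡ + 1 + (p - v - + 1) * + 4
  i₂ = solve-∀
  go : (∃[ v ] k ≡ + 1 + v * + 4) ⊎ (∃[ v ] k ≡ + 3 + v * + 4) → χ₄ k * χ₄ (+ 4 * p - k) ≡ - + 1
  go (inj₁ (v , refl)) = cong₂ _*_ (char-value 4 1 3 1 v refl) (char-value 4 1 3 3 (p - v - + 1) (i₁ p v))
  go (inj₂ (v , refl)) = cong₂ _*_ (char-value 4 1 3 3 v refl) (char-value 4 1 3 1 (p - v - + 1) (i₂ p v))

-- All that the comparison uses about the sequence. The sign of `root n` is fixed by `root-sign`: as
-- `sgn n` is never zero, `w (root n)` is nonzero, which entails `root n ≡ 5 (mod 7)`.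
record Roots (a : ℕ → ℕ) : Set where
  field
    root        : ℕ → ℤ
    root²       : ∀ n → root n * root n ≡ + 840 * + a n + + 361
    root-sign   : ∀ n → sgn n ≡ χ₄ (root n) * ψ₃ (root n) * w (root n)
    root-onto   : ∀ l → χ₄ l ≢ + 0 → ψ₃ l ≢ + 0 → w l ≢ + 0 → ∃[ n ] root n ≡ l
    a-injective : ∀ m n → a m ≡ a n → m ≡ n
    n≤a         : ∀ n → n ℕ.≤ a n

module RightSum (a : ℕ → ℕ) (roots : Roots a) where
  open Roots roots

  right : ℕ → ℤ × ℕ → ℤ
  right N (j , n) = parity j * sgn n * mono (T₃.expo j ℕ.+ a n) N

  _≟ℤℕ_ = _≟×_ ℤ._≟_ ℕ._≟_

  indices : ℕ → List (ℤ × ℕ)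
  indices N = cartesianProduct (range (bound N)) (upTo (suc N))

  -- Only `k²` is prescribed: the sign of `k` is dictated by the integrality of `p = (k + l)/4`.
  rightRel : ℤ × ℕ → ℤ × ℤ → Set
  rightRel (j , n) (k , p) =
    k * k ≡ (+ 6 * j - + 1) * (+ 6 * j - + 1) × + 4 * p - k ≡ root n

  opaque
    unfolding level

    -- Stated as an equality of differences, valid off the level too, so that either difference
    -- vanishes with the other and both directions of the matching can use it.
    form-level : ∀ N j n k p → rightRel (j , n) (k , p) →
      + 4 * form k p - + 4 * level N ≡ + 840 * + (T₃.expo j ℕ.+ a n) - + 840 * + N
    form-level N j n k p (k² , l≡) = begin
      + 4 * form k p - + 4 * level N
        ≡⟨ i₁ k p (+ N) ⟩
      + 35 * (k * k) + (+ 4 * p - k) * (+ 4 * p - k) - + 4 * level N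
        ≡⟨ cong₂ (λ x y → + 35 * x + y - + 4 * level N) k² (trans (cong₂ _*_ l≡ l≡) (root² n)) ⟩
      + 35 * ((+ 6 * j - + 1) * (+ 6 * j - + 1)) + (+ 840 * + a n + + 361) - + 4 * level N
        ≡⟨ i₂ j (+ a n) (+ N) ⟩
      + 420 * (+ 3 * (j * j) + (+ 1 - + 2) * j) + + 840 * + a n - + 840 * + N
        ≡⟨ cong (λ x → + 420 * x + + 840 * + a n - + 840 * + N) (sym (T₃.expo-quadratic j)) ⟩
      + 420 * (+ 2 * + T₃.expo j) + + 840 * + a n - + 840 * + N
        ≡⟨ i₃ (+ T₃.expo j) (+ a n) (+ N) ⟩
      + 840 * (+ T₃.expo j + + a n) - + 840 * + N
        ≡⟨ cong (λ x → + 840 * x - + 840 * + N) (sym (ℤₚ.pos-+ (T₃.expo j) (a n))) ⟩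
      + 840 * + (T₃.expo j ℕ.+ a n) - + 840 * + N ∎
      where
      open ≡-Reasoning
      i₁ : ∀ k p N → + 4 * (+ 9 * (k * k) - + 2 * (k * p) + + 4 * (p * p)) - + 4 * (+ 210 * N + + 99)
                   ≡ + 35 * (k * k) + (+ 4 * p - k) * (+ 4 * p - k) - + 4 * (+ 210 * N + + 99)
      i₁ = solve-∀
      i₂ : ∀ j A N → + 35 * ((+ 6 * j - + 1) * (+ 6 * j - + 1)) + (+ 840 * A + + 361) - + 4 * (+ 210 * N + + 99)
                   ≡ + 420 * (+ 3 * (j * j) + (+ 1 - + 2) * j) + + 840 * A - + 840 * N
      i₂ = solve-∀
      i₃ : ∀ E A N → + 420 * (+ 2 * E) + + 840 * A - + 840 * N ≡ + 840 * (E + A) - + 840 * N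
      i₃ = solve-∀

  onLevel⁺ : ∀ N j n k p → rightRel (j , n) (k , p) → T₃.expo j ℕ.+ a n ≡ N → form k p ≡ level N
  onLevel⁺ N j n k p rel refl = *-cancel (+ 4) (ℤₚ.i-j≡0⇒i≡j (+ 4 * form k p) (+ 4 * level N)
    (trans (form-level N j n k p rel) (ℤₚ.+-inverseʳ (+ 840 * + N))))

  onLevel⁻ : ∀ N j n k p → rightRel (j , n) (k , p) → form k p ≡ level N → T₃.expo j ℕ.+ a n ≡ N
  onLevel⁻ N j n k p rel eq = ℤₚ.+-injective (*-cancel (+ 840)
    (ℤₚ.i-j≡0⇒i≡j (+ 840 * + (T₃.expo j ℕ.+ a n)) (+ 840 * + N)
      (trans (sym (form-level N j n k p rel))
        (trans (cong (λ z → + 4 * z - + 4 * level N) eq) (ℤₚ.+-inverseʳ (+ 4 * level N))))))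

  right-value : ∀ N j n k p h → rightRel (j , n) (k , p) → T₃.expo j ℕ.+ a n ≡ N → k ≡ + 1 + h * + 2 →
                right N (j , n) ≡ weight N φR (k , p)
  right-value N j n k p h rel@(k² , l≡) sumN k-odd = begin
    parity j * sgn n * mono (T₃.expo j ℕ.+ a n) N
      ≡⟨ cong₂ (λ x y → x * sgn n * y) (parity≡χ₄ψ₃ j k (square-≡ k (+ 6 * j - + 1) k²)) (mono-yes _ N sumN) ⟩
    χ₄ k * ψ₃ k * sgn n * + 1
      ≡⟨ cong (λ x → χ₄ k * ψ₃ k * x * + 1)
           (trans (root-sign n) (cong (λ l → χ₄ l * ψ₃ l * w l) (sym l≡))) ⟩
    χ₄ k * ψ₃ k * (χ₄ l * ψ₃ l * w l) * + 1
      ≡⟨ i₁ (χ₄ k) (ψ₃ k) (χ₄ l) (ψ₃ l) (w l) ⟩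
    χ₄ k * χ₄ l * (ψ₃ k * ψ₃ l) * w l
      -- The origin of the minus sign in `φR`.
      ≡⟨ cong (λ x → x * (ψ₃ k * ψ₃ l) * w l) (χ₄-complement k p h k-odd) ⟩
    - + 1 * (ψ₃ k * ψ₃ l) * w l
      ≡⟨ cong (_* w l) (ℤₚ.-1*i≡-i (ψ₃ k * ψ₃ l)) ⟩
    φR k p * w l
      ≡⟨ sym (weight-value N φR k p h k-odd (onLevel⁺ N j n k p rel sumN)) ⟩
    weight N φR (k , p) ∎
    where
    open ≡-Reasoning
    l = + 4 * p - k
    i₁ : ∀ a b c d e → a * b * (c * d * e) * + 1 ≡ a * c * (b * d) * e
    i₁ = solve-∀

  count-right : ∀ N j n → T₃.expo j ℕ.+ a n ≡ N → count _≟ℤℕ_ (indices N) (j , n) ≡ + 1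
  count-right N j n refl =
    trans (count-× ℤ._≟_ ℕ._≟_ (range (bound N)) (upTo (suc N)) j n)
          (cong₂ _*_ (count-range (bound N) j
                       (ℕₚ.≤-trans (T₃.∣j∣≤expo j) (ℕₚ.≤-trans (ℕₚ.m≤m+n (T₃.expo j) (a n)) (ℕₚ.<⇒≤ (N<bound N)))))
                     (count-upTo (suc N) n (s≤s (ℕₚ.≤-trans (n≤a n) (ℕₚ.m≤n+m (a n) (T₃.expo j))))))

  -- Odd numbers are `±1` modulo 4, so either `k₀ + l` or `-k₀ + l` is divisible by 4.
  sign-choice : ∀ k₀ h l → k₀ ≡ + 1 + h * + 2 →
    (∃[ v ] l ≡ + 1 + v * + 4) ⊎ (∃[ v ] l ≡ + 3 + v * + 4) →
    ∃[ k ] ∃[ p ] ∃[ h′ ] (k * k ≡ k₀ * k₀ × + 4 * p - k ≡ l × k ≡ + 1 + h′ * + 2)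
  sign-choice k₀ h l k₀≡ l≡ = go (odd⇒1or3 k₀ h k₀≡) l≡
    where
    square : ∀ x → - x * - x ≡ x * x
    square = solve-∀
    negated : ∀ h → - (+ 1 + h * + 2) ≡ + 1 + (- h - + 1) * + 2
    negated = solve-∀
    i₁ : ∀ u v → + 4 * (v - u) - - (+ 1 + u * + 4) ≡ + 1 + v * + 4
    i₁ = solve-∀
    i₂ : ∀ u v → + 4 * (+ 1 + v + u) - (+ 1 + u * + 4) ≡ + 3 + v * + 4
    i₂ = solve-∀
    i₃ : ∀ u v → + 4 * (+ 1 + v + u) - (+ 3 + u * + 4) ≡ + 1 + v * + 4
    i₃ = solve-∀
    i₄ : ∀ u v → + 4 * (v - u) - - (+ 3 + u * + 4) ≡ + 3 + v * + 4
    i₄ = solve-∀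
    Goal : Set
    Goal = ∃[ k ] ∃[ p ] ∃[ h′ ] (k * k ≡ k₀ * k₀ × + 4 * p - k ≡ l × k ≡ + 1 + h′ * + 2)
    keep : ∀ p → + 4 * p - k₀ ≡ l → Goal
    keep p eq = k₀ , p , h , refl , eq , k₀≡
    flip : ∀ p → + 4 * p - - k₀ ≡ l → Goal
    flip p eq = - k₀ , p , - h - + 1 , square k₀ , eq , trans (cong -_ k₀≡) (negated h)
    go : (∃[ u ] k₀ ≡ + 1 + u * + 4) ⊎ (∃[ u ] k₀ ≡ + 3 + u * + 4) →
         (∃[ v ] l ≡ + 1 + v * + 4) ⊎ (∃[ v ] l ≡ + 3 + v * + 4) → Goal
    go (inj₁ (u , e)) (inj₁ (v , f)) = flip (v - u) (trans (cong (λ x → + 4 * (v - u) - - x) e) (trans (i₁ u v) (sym f)))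
    go (inj₁ (u , e)) (inj₂ (v , f)) = keep (+ 1 + v + u) (trans (cong (λ x → + 4 * (+ 1 + v + u) - x) e) (trans (i₂ u v) (sym f)))
    go (inj₂ (u , e)) (inj₁ (v , f)) = keep (+ 1 + v + u) (trans (cong (λ x → + 4 * (+ 1 + v + u) - x) e) (trans (i₃ u v) (sym f)))
    go (inj₂ (u , e)) (inj₂ (v , f)) = flip (v - u) (trans (cong (λ x → + 4 * (v - u) - - x) e) (trans (i₄ u v) (sym f)))

  right-to : ∀ N x → right N x ≢ + 0 →
    ∃[ y ] (rightRel x y × weight N φR y ≡ right N x × count _≟ℤ²_ (box (bound N)) y ≡ + 1)
  right-to N (j , n) nz =
    let k , p , h , k² , l≡ , k-odd =
          sign-choice (+ 6 * j - + 1) (+ 3 * j - + 1) (root n) (identity j) (char-≢0 4 1 3 (root n) χ≢0)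
    in (k , p) , (k² , l≡) , sym (right-value N j n k p h (k² , l≡) sumN k-odd)
       , count-level N k p (onLevel⁺ N j n k p (k² , l≡) sumN)
    where
    identity : ∀ j → + 6 * j - + 1 ≡ + 1 + (+ 3 * j - + 1) * + 2
    identity = solve-∀
    nonzero = *-≢0 (parity j * sgn n) (mono (T₃.expo j ℕ.+ a n) N) nz
    sumN : T₃.expo j ℕ.+ a n ≡ N
    sumN = mono-≢0 (T₃.expo j ℕ.+ a n) N (proj₂ nonzero)
    χ≢0 : χ₄ (root n) ≢ + 0
    χ≢0 = proj₁ (*-≢0 (χ₄ (root n)) (ψ₃ (root n)) (proj₁ (*-≢0 (χ₄ (root n) * ψ₃ (root n)) (w (root n))
            (λ z → proj₂ (*-≢0 (parity j) (sgn n) (proj₁ nonzero)) (trans (root-sign n) z)))))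

  right-from : ∀ N y → weight N φR y ≢ + 0 →
    ∃[ x ] (rightRel x y × right N x ≡ weight N φR y × count _≟ℤℕ_ (indices N) x ≡ + 1)
  right-from N (k , p) nz =
    let n , root≡ = root-onto l χ≢0 (proj₂ ψ≢0) w≢0
        j , k² = sixth (mod3 half)
        rel = k² , sym root≡
        sumN = onLevel⁻ N j n k p rel onLevel
    in (j , n) , rel , right-value N j n k p half rel sumN odd , count-right N j n sumN
    where
    open Support (support N φR k p nz)
    l = + 4 * p - k
    ψ≢0 : ψ₃ k ≢ + 0 × ψ₃ l ≢ + 0
    ψ≢0 = *-≢0 (ψ₃ k) (ψ₃ l) (neg-≢0 φ≢0)
    χ≢0 : χ₄ l ≢ + 0
    χ≢0 = proj₂ (*-≢0 (χ₄ k) (χ₄ l) (λ z → -1≢0 (trans (sym (χ₄-complement k p half odd)) z)))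
      where
      -1≢0 : - + 1 ≢ + 0
      -1≢0 ()
    i₁ : ∀ t → + 1 + (+ 0 + t * + 3) * + 2 ≡ - (+ 6 * - t - + 1)
    i₁ = solve-∀
    i₂ : ∀ t → + 1 + (+ 1 + t * + 3) * + 2 ≡ + 0 + (+ 1 + + 2 * t) * + 3
    i₂ = solve-∀
    i₃ : ∀ t → + 1 + (+ 2 + t * + 3) * + 2 ≡ + 6 * (t + + 1) - + 1
    i₃ = solve-∀
    square : ∀ x → - x * - x ≡ x * x
    square = solve-∀
    sixth : (∃[ t ] half ≡ + 0 + t * + 3) ⊎ (∃[ t ] half ≡ + 1 + t * + 3) ⊎ (∃[ t ] half ≡ + 2 + t * + 3) →
            ∃[ j ] k * k ≡ (+ 6 * j - + 1) * (+ 6 * j - + 1)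
    sixth (inj₁ (t , e)) = - t , trans (cong (λ x → x * x) k≡) (square (+ 6 * - t - + 1))
      where
      k≡ : k ≡ - (+ 6 * - t - + 1)
      k≡ = trans odd (trans (cong (λ h → + 1 + h * + 2) e) (i₁ t))
    -- In this class 3 divides `k`, which the nonzero `ψ₃ k` excludes; in the other two `k` is
    -- `±(6j - 1)`.
    sixth (inj₂ (inj₁ (t , e))) = ⊥-elim (proj₁ ψ≢0 (char-value 3 1 2 0 (+ 1 + + 2 * t)
      (trans odd (trans (cong (λ h → + 1 + h * + 2) e) (i₂ t)))))
    sixth (inj₂ (inj₂ (t , e))) = t + + 1 , cong (λ x → x * x) k≡
      where
      k≡ : k ≡ + 6 * (t + + 1) - + 1
      k≡ = trans odd (trans (cong (λ h → + 1 + h * + 2) e) (i₃ t))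

  -- With `k′ = -k` the equality of the two values of `l` would give `k = 2 (p - p′)`, against `k`
  -- odd.
  right-functional : ∀ N x y y′ → weight N φR y ≢ + 0 → weight N φR y′ ≢ + 0 →
                     rightRel x y → rightRel x y′ → y ≡ y′
  right-functional N _ (k , p) (k′ , p′) nz _ (k² , l≡) (k′² , l′≡) =
    go (square-≡ k k′ (trans k² (sym k′²)))
    where
    open Support (support N φR k p nz)
    l≡l′ : + 4 * p - k ≡ + 4 * p′ - k′
    l≡l′ = trans l≡ (sym l′≡)
    i₁ : ∀ p k → + 4 * p ≡ + 4 * p - k + k
    i₁ = solve-∀
    i₂ : ∀ h → + 2 * (+ 1 + h * + 2) ≡ (+ 1 + h * + 2) + (+ 1 + h * + 2)
    i₂ = solve-∀
    i₃ : ∀ p k → k + k ≡ + 4 * p + k - (+ 4 * p - k)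
    i₃ = solve-∀
    i₄ : ∀ p p′ k′ → + 4 * p + - k′ - (+ 4 * p′ - k′) ≡ + 2 * (+ 0 + (p - p′) * + 2)
    i₄ = solve-∀
    go : k ≡ k′ ⊎ k ≡ - k′ → (k , p) ≡ (k′ , p′)
    go (inj₁ refl) = cong (k ,_) (*-cancel (+ 4) (trans (i₁ p k) (trans (cong (_+ k) l≡l′) (sym (i₁ p′ k)))))
    go (inj₂ eq)   = ⊥-elim (residue-clash 2 1 0 half (p - p′) (λ ())
      (*-cancel (+ 2) (trans (i₂ half) (trans (cong₂ _+_ (sym odd) (sym odd))
        (trans (i₃ p k) (trans (cong₂ (λ x y → + 4 * p + x - y) eq l≡l′) (i₄ p p′ k′)))))))

  right-injective : ∀ x x′ y → rightRel x y → rightRel x′ y → x ≡ x′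
  right-injective (j , n) (j′ , n′) _ (k² , l≡) (k′² , l′≡) =
    cong₂ _,_ (go (square-≡ (+ 6 * j - + 1) (+ 6 * j′ - + 1) (trans (sym k²) k′²)))
              (a-injective n n′ (ℤₚ.+-injective (*-cancel (+ 840) (+-cancelʳ (+ 361) (+ 840 * + a n) (+ 840 * + a n′)
                (trans (sym (root² n)) (trans (cong (λ l → l * l) (trans (sym l≡) l′≡)) (root² n′)))))))
    where
    i₁ : ∀ j → + 6 * j ≡ + 6 * j - + 1 + + 1
    i₁ = solve-∀
    i₂ : ∀ j j′ → + 2 * (+ 0 + (j + j′) * + 3) ≡ + 6 * j - + 1 + (+ 6 * j′ + + 1)
    i₂ = solve-∀
    i₃ : ∀ j′ → - (+ 6 * j′ - + 1) + (+ 6 * j′ + + 1) ≡ + 2 * (+ 1 + + 0 * + 3)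
    i₃ = solve-∀
    go : + 6 * j - + 1 ≡ + 6 * j′ - + 1 ⊎ + 6 * j - + 1 ≡ - (+ 6 * j′ - + 1) → j ≡ j′
    go (inj₁ eq) = *-cancel (+ 6) (trans (i₁ j) (trans (cong (_+ + 1) eq) (sym (i₁ j′))))
    go (inj₂ eq) = ⊥-elim (residue-clash 3 0 1 (j + j′) (+ 0) (λ ())
      (*-cancel (+ 2) (trans (i₂ j j′) (trans (cong (_+ (+ 6 * j′ + + 1)) eq) (i₃ j′)))))

  right-sum : ∀ N → ∑ (indices N) (right N) ≡ ∑ (box (bound N)) (weight N φR)
  right-sum N = reindex _≟ℤℕ_ _≟ℤ²_ (indices N) (box (bound N)) (right N) (weight N φR) rightRel
    (right-to N) (right-from N) (right-functional N) (λ x x′ y _ _ → right-injective x x′ y)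

  left≡right : ∀ N → ∑ (box (bound N)) (left N) ≡ ∑ (indices N) (right N)
  left≡right N = trans (left-sum N) (trans (weight-sum N) (sym (right-sum N)))

-- The sequence a

module _ {a : ℕ → ℕ} (a↑ : StrictlyIncreasing a) where

  increasing-injective : ∀ m n → a m ≡ a n → m ≡ n
  increasing-injective m n eq with ℕₚ.<-cmp m n
  ... | tri< m<n _ _ = ⊥-elim (ℕₚ.<⇒≢ (a↑ m n m<n) eq)
  ... | tri≈ _ m≡n _ = m≡n
  ... | tri> _ _ n<m = ⊥-elim (ℕₚ.<⇒≢ (a↑ n m n<m) (sym eq))

  increasing-mono : ∀ {m n} → m ℕ.≤ n → a m ℕ.≤ a n
  increasing-mono {m} {n} m≤n with ℕₚ.m≤n⇒m<n∨m≡n m≤n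
  ... | inj₁ m<n  = ℕₚ.<⇒≤ (a↑ m n m<n)
  ... | inj₂ refl = ℕₚ.≤-refl

  increasing-≥ : ∀ n → n ℕ.≤ a n
  increasing-≥ zero    = z≤n
  increasing-≥ (suc n) = ℕₚ.≤-<-trans (increasing-≥ n) (a↑ n (suc n) (ℕₚ.n<1+n n))

-- The index at which `b` takes the value `a n` cannot be below `n`, since there `b` agrees with
-- `a`, which is injective.
increasing-first : ∀ {a b} → StrictlyIncreasing a → StrictlyIncreasing b →
  (∀ n → ∃[ m ] b m ≡ a n) → ∀ n → (∀ {m} → m ℕ.< n → a m ≡ b m) → b n ℕ.≤ a n
increasing-first {a} {b} a↑ b↑ hit n agree with hit n
... | m , b≡a with m ℕ.<? n
...   | yes m<n = ⊥-elim (ℕₚ.<⇒≢ m<n (increasing-injective a↑ m n (trans (agree m<n) b≡a)))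
...   | no m≮n  = subst (b n ℕ.≤_) b≡a (increasing-mono b↑ (ℕₚ.≮⇒≥ m≮n))

increasing-unique : ∀ {a b} → StrictlyIncreasing a → StrictlyIncreasing b →
  (∀ n → ∃[ m ] b m ≡ a n) → (∀ n → ∃[ m ] a m ≡ b n) → ∀ n → a n ≡ b n
increasing-unique {a} {b} a↑ b↑ a⊆b b⊆a = <-rec (λ n → a n ≡ b n) λ n agree →
  ℕₚ.≤-antisym (increasing-first b↑ a↑ b⊆a n (λ m<n → sym (agree m<n)))
               (increasing-first a↑ b↑ a⊆b n agree)

-- The residues r modulo 420 with r² ≡ 361 (mod 840), in increasing order.
res : ℕ → ℕ
res 0  = 19
res 1  = 61
res 2  = 79
res 3  = 89
res 4  = 121
res 5  = 131
res 6  = 149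
res 7  = 191
res 8  = 229
res 9  = 271
res 10 = 289
res 11 = 299
res 12 = 331
res 13 = 341
res 14 = 359
res _  = 401

index : ℕ → ℕ
index r = length (filter (λ i → res i ℕ.<? r) (upTo 16))

offset : ℕ → ℕ
offset i = (res i ℕ.* res i ℕ.∸ 361) / 840

opaque
  res² : ∀ {i} → i ℕ.< 16 → res i ℕ.* res i ≡ 840 ℕ.* offset i ℕ.+ 361
  res² = from-yes (ℕₚ.allUpTo? (λ i → res i ℕ.* res i ℕ.≟ 840 ℕ.* offset i ℕ.+ 361) 16)

  res<420 : ∀ {i} → i ℕ.< 16 → res i ℕ.< 420
  res<420 = from-yes (ℕₚ.allUpTo? (λ i → res i ℕ.<? 420) 16)

  res-increasing : ∀ {j} → j ℕ.< 16 → ∀ {i} → i ℕ.< j → res i ℕ.< res j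
  res-increasing = from-yes (ℕₚ.allUpTo? (λ j → ℕₚ.allUpTo? (λ i → res i ℕ.<? res j) j) 16)

  index-spec : ∀ {r} → r ℕ.< 420 → (r ℕ.* r) % 840 ≡ 361 → index r ℕ.< 16 × res (index r) ≡ r
  index-spec = from-yes (ℕₚ.allUpTo? (λ r → ((r ℕ.* r) % 840 ℕ.≟ 361) →-dec
                 ((index r ℕ.<? 16) ×-dec (res (index r) ℕ.≟ r))) 420)

  -- If the product is nonzero, then `r` is odd, prime to 3, `±1` modulo 5 and 5 modulo 7; its
  -- square is then 1 modulo 8, 3 and 5 and 4 modulo 7, which is 361 modulo 840.
  square-residue : ∀ {r} → r ℕ.< 420 → (r ℕ.* r) % 840 ≡ 361 ⊎ χ₄ (+ r) * ψ₃ (+ r) * w (+ r) ≡ + 0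
  square-residue = from-yes (ℕₚ.allUpTo? (λ r → ((r ℕ.* r) % 840 ℕ.≟ 361) ⊎-dec
                     (χ₄ (+ r) * ψ₃ (+ r) * w (+ r) ℤ.≟ + 0)) 420)

-- The sign that makes the root congruent to 5 modulo 7.
orient : ℕ → ℤ
orient i = if res i % 7 ℕ.≡ᵇ 5 then + 1 else - + 1

opaque
  orient² : ∀ {i} → i ℕ.< 16 → orient i * orient i ≡ + 1
  orient² = from-yes (ℕₚ.allUpTo? (λ i → orient i * orient i ℤ.≟ + 1) 16)

  -- The point at which the pattern of `t` modulo 16 enters: a comparison of sixteen signs.
  res-sign : ∀ {i} → i ℕ.< 16 → (- + 1) ℤ.^ tRes i
    ≡ χ₄ (orient i * + res i) * ψ₃ (orient i * + res i) * w (orient i * + res i)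
  res-sign = from-yes (ℕₚ.allUpTo? (λ i → (- + 1) ℤ.^ tRes i ℤ.≟
    χ₄ (orient i * + res i) * ψ₃ (orient i * + res i) * w (orient i * + res i)) 16)

-- The positive square roots in increasing order. Their residues repeat modulo 420 and not merely
-- modulo 840, since `(r + 420q)² = r² + 840 (rq + 210q²)`; the same expansion yields the formula
-- for `value`.
rootℕ : ℕ → ℕ
rootℕ n = res (n % 16) ℕ.+ 420 ℕ.* (n / 16)

value : ℕ → ℕ
value n = offset (n % 16) ℕ.+ (res (n % 16) ℕ.* (n / 16) ℕ.+ 210 ℕ.* ((n / 16) ℕ.* (n / 16)))

square-expand : ∀ c m e r q → m ≡ 2 ℕ.* c → e ≡ 4 ℕ.* c →
  (r ℕ.+ m ℕ.* q) ℕ.* (r ℕ.+ m ℕ.* q) ≡ r ℕ.* r ℕ.+ e ℕ.* (r ℕ.* q ℕ.+ c ℕ.* (q ℕ.* q))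
square-expand c _ _ r q refl refl = identity c r q
  where
  identity : ∀ c r q → (r ℕ.+ 2 ℕ.* c ℕ.* q) ℕ.* (r ℕ.+ 2 ℕ.* c ℕ.* q)
                     ≡ r ℕ.* r ℕ.+ 4 ℕ.* c ℕ.* (r ℕ.* q ℕ.+ c ℕ.* (q ℕ.* q))
  identity = ℕ-Solver.solve-∀

rootℕ² : ∀ n → rootℕ n ℕ.* rootℕ n ≡ 840 ℕ.* value n ℕ.+ 361
rootℕ² n = begin
  rootℕ n ℕ.* rootℕ n
    ≡⟨ square-expand 210 420 840 r q refl refl ⟩
  r ℕ.* r ℕ.+ 840 ℕ.* (r ℕ.* q ℕ.+ 210 ℕ.* (q ℕ.* q))
    ≡⟨ cong (ℕ._+ 840 ℕ.* (r ℕ.* q ℕ.+ 210 ℕ.* (q ℕ.* q))) (res² (ℕ.m%n<n n 16)) ⟩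
  840 ℕ.* offset (n % 16) ℕ.+ 361 ℕ.+ 840 ℕ.* (r ℕ.* q ℕ.+ 210 ℕ.* (q ℕ.* q))
    ≡⟨ trans (i₂ 840 361 (offset (n % 16)) (r ℕ.* q ℕ.+ 210 ℕ.* (q ℕ.* q)))
             (cong (λ x → 840 ℕ.* x ℕ.+ 361) unfold) ⟩
  840 ℕ.* value n ℕ.+ 361 ∎
  where
  open ≡-Reasoning
  r = res (n % 16)
  q = n / 16
  i₂ : ∀ c d o s → c ℕ.* o ℕ.+ d ℕ.+ c ℕ.* s ≡ c ℕ.* (o ℕ.+ s) ℕ.+ d
  i₂ = ℕ-Solver.solve-∀
  unfold : offset (n % 16) ℕ.+ (r ℕ.* q ℕ.+ 210 ℕ.* (q ℕ.* q)) ≡ value n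
  unfold = refl

rootℕ-increasing : StrictlyIncreasing rootℕ
rootℕ-increasing m n m<n = go (ℕₚ.m≤n⇒m<n∨m≡n (ℕ./-monoˡ-≤ 16 (ℕₚ.<⇒≤ m<n)))
  where
  go : m / 16 ℕ.< n / 16 ⊎ m / 16 ≡ n / 16 → rootℕ m ℕ.< rootℕ n
  go (inj₁ q<q′) = begin-strict
    res (m % 16) ℕ.+ 420 ℕ.* (m / 16) <⟨ ℕₚ.+-monoˡ-< (420 ℕ.* (m / 16)) (res<420 (ℕ.m%n<n m 16)) ⟩
    420 ℕ.+ 420 ℕ.* (m / 16)          ≡⟨ sym (ℕₚ.*-suc 420 (m / 16)) ⟩
    420 ℕ.* suc (m / 16)              ≤⟨ ℕₚ.*-monoʳ-≤ 420 q<q′ ⟩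
    420 ℕ.* (n / 16)                  ≤⟨ ℕₚ.m≤n+m (420 ℕ.* (n / 16)) (res (n % 16)) ⟩
    rootℕ n                           ∎
    where open ℕₚ.≤-Reasoning
  go (inj₂ q≡q′) = subst (λ q → rootℕ m ℕ.< res (n % 16) ℕ.+ 420 ℕ.* q) q≡q′
    (ℕₚ.+-monoˡ-< (420 ℕ.* (m / 16)) (res-increasing (ℕ.m%n<n n 16) r<r′))
    where
    r<r′ : m % 16 ℕ.< n % 16
    r<r′ = ℕₚ.+-cancelʳ-< (m / 16 ℕ.* 16) (m % 16) (n % 16)
      (subst₂ ℕ._<_ (ℕ.m≡m%n+[m/n]*n m 16)
        (trans (ℕ.m≡m%n+[m/n]*n n 16) (cong (λ q → n % 16 ℕ.+ q ℕ.* 16) (sym q≡q′))) m<n)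

value-increasing : StrictlyIncreasing value
value-increasing m n m<n = ℕₚ.*-cancelˡ-< 840 (value m) (value n) (ℕₚ.+-cancelʳ-< 361 _ _
  (subst₂ ℕ._<_ (rootℕ² m) (rootℕ² n)
    (ℕₚ.*-mono-< (rootℕ-increasing m n m<n) (rootℕ-increasing m n m<n))))

rootℕ-onto : ∀ k → (k ℕ.* k) % 840 ≡ 361 → ∃[ n ] rootℕ n ≡ k
rootℕ-onto k k²≡ = n , (begin
  res (n % 16) ℕ.+ 420 ℕ.* (n / 16)
    ≡⟨ cong₂ (λ i j → res i ℕ.+ 420 ℕ.* j) remainder quotient′ ⟩
  res (index r) ℕ.+ 420 ℕ.* q
    ≡⟨ cong₂ ℕ._+_ (proj₂ spec) (ℕₚ.*-comm 420 q) ⟩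
  r ℕ.+ q ℕ.* 420
    ≡⟨ sym (ℕ.m≡m%n+[m/n]*n k 420) ⟩
  k ∎)
  where
  open ≡-Reasoning
  r = k % 420
  q = k / 420
  i₁ : (r ℕ.+ q ℕ.* 420) ℕ.* (r ℕ.+ q ℕ.* 420) ≡ r ℕ.* r ℕ.+ (r ℕ.* q ℕ.+ 210 ℕ.* (q ℕ.* q)) ℕ.* 840
  i₁ = trans (cong (λ x → (r ℕ.+ x) ℕ.* (r ℕ.+ x)) (ℕₚ.*-comm q 420))
      (trans (square-expand 210 420 840 r q refl refl)
             (cong (r ℕ.* r ℕ.+_) (ℕₚ.*-comm 840 (r ℕ.* q ℕ.+ 210 ℕ.* (q ℕ.* q)))))
  r²≡ : (r ℕ.* r) % 840 ≡ 361
  r²≡ = trans (sym (ℕ.[m+kn]%n≡m%n (r ℕ.* r) (r ℕ.* q ℕ.+ 210 ℕ.* (q ℕ.* q)) 840))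
       (trans (cong (_% 840) (trans (sym i₁) (cong (λ x → x ℕ.* x) (sym (ℕ.m≡m%n+[m/n]*n k 420))))) k²≡)
  spec = index-spec (ℕ.m%n<n k 420) r²≡
  n = index r ℕ.+ q ℕ.* 16
  remainder : n % 16 ≡ index r
  remainder = trans (ℕ.[m+kn]%n≡m%n (index r) q 16) (ℕ.m<n⇒m%n≡m (proj₁ spec))
  quotient′ : n / 16 ≡ q
  quotient′ = trans (ℕ.+-distrib-/-∣ʳ (index r) (divides-refl q))
    (cong₂ ℕ._+_ (ℕ.m<n⇒m/n≡0 (proj₁ spec)) (ℕ.m*n/n≡m q 16))

w-mod7 : ∀ l → w l ≢ + 0 → ∃[ u ] l ≡ + 5 + u * + 7
w-mod7 l w≢0 = go (char-≢0 35 26 19 l w≢0)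
  where
  i₁ : ∀ v → + 26 + v * + 35 ≡ + 5 + (+ 3 + + 5 * v) * + 7
  i₁ = solve-∀
  i₂ : ∀ v → + 19 + v * + 35 ≡ + 5 + (+ 2 + + 5 * v) * + 7
  i₂ = solve-∀
  go : (∃[ v ] l ≡ + 26 + v * + 35) ⊎ (∃[ v ] l ≡ + 19 + v * + 35) → ∃[ u ] l ≡ + 5 + u * + 7
  go (inj₁ (v , e)) = + 3 + + 5 * v , trans e (i₁ v)
  go (inj₂ (v , e)) = + 2 + + 5 * v , trans e (i₂ v)

-- Both numbers are 5 modulo 7, so their sum is 3 modulo 7 and not zero.
w-oriented : ∀ x l → w x ≢ + 0 → w l ≢ + 0 → x ≢ - l
w-oriented x l wx≢0 wl≢0 x≡-l =
  let u , x≡ = w-mod7 x wx≢0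
      v , l≡ = w-mod7 l wl≢0
  in residue-clash 7 3 0 (u + v + + 1) (+ 0) (λ ())
       (trans (i₁ u v) (trans (cong₂ _+_ (sym x≡) (sym l≡)) (trans (cong (_+ l) x≡-l) (ℤₚ.+-inverseˡ l))))
  where
  i₁ : ∀ u v → + 3 + (u + v + + 1) * + 7 ≡ (+ 5 + u * + 7) + (+ 5 + v * + 7)
  i₁ = solve-∀

module Construction {a : ℕ → ℕ} (a↑ : StrictlyIncreasing a)
                    (enumerates : ∀ m → IsSq (840 ℕ.* m ℕ.+ 361) ⇔ (∃[ n ] a n ≡ m)) where

  a≡value : ∀ n → a n ≡ value n
  a≡value = increasing-unique a↑ value-increasing a⊆value value⊆a
    where
    value⊆a : ∀ n → ∃[ m ] a m ≡ value n
    value⊆a n = Equivalence.to (enumerates (value n)) (rootℕ n , rootℕ² n)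
    a⊆value : ∀ n → ∃[ m ] value m ≡ a n
    a⊆value n = proj₁ found , ℕₚ.*-cancelˡ-≡ _ _ 840 (ℕₚ.+-cancelʳ-≡ 361 _ _
      (trans (sym (rootℕ² (proj₁ found)))
             (trans (cong (λ x → x ℕ.* x) (proj₂ found)) (proj₂ isSq))))
      where
      isSq : IsSq (840 ℕ.* a n ℕ.+ 361)
      isSq = Equivalence.from (enumerates (a n)) (n , refl)
      i₁ : ∀ m → 840 ℕ.* m ℕ.+ 361 ≡ 361 ℕ.+ m ℕ.* 840
      i₁ = ℕ-Solver.solve-∀
      found : ∃[ m ] rootℕ m ≡ proj₁ isSq
      found = rootℕ-onto (proj₁ isSq) (trans (cong (_% 840) (trans (proj₂ isSq) (i₁ (a n))))
                                             (ℕ.[m+kn]%n≡m%n 361 (a n) 840))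

  root : ℕ → ℤ
  root n = orient (n % 16) * + rootℕ n

  root²≡rootℕ² : ∀ n → root n * root n ≡ + (rootℕ n ℕ.* rootℕ n)
  root²≡rootℕ² n = begin
    root n * root n
      ≡⟨ i₁ (orient (n % 16)) (+ rootℕ n) ⟩
    orient (n % 16) * orient (n % 16) * (+ rootℕ n * + rootℕ n)
      ≡⟨ cong₂ _*_ (orient² (ℕ.m%n<n n 16)) (sym (ℤₚ.pos-* (rootℕ n) (rootℕ n))) ⟩
    + 1 * + (rootℕ n ℕ.* rootℕ n)
      ≡⟨ ℤₚ.*-identityˡ (+ (rootℕ n ℕ.* rootℕ n)) ⟩
    + (rootℕ n ℕ.* rootℕ n) ∎
    where
    open ≡-Reasoning
    i₁ : ∀ x y → x * y * (x * y) ≡ x * x * (y * y)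
    i₁ = solve-∀

  root² : ∀ n → root n * root n ≡ + 840 * + a n + + 361
  root² n = begin
    root n * root n
      ≡⟨ root²≡rootℕ² n ⟩
    + (rootℕ n ℕ.* rootℕ n)
      ≡⟨ cong +_ (trans (rootℕ² n) (cong (λ x → 840 ℕ.* x ℕ.+ 361) (sym (a≡value n)))) ⟩
    + (840 ℕ.* a n ℕ.+ 361)
      ≡⟨ trans (ℤₚ.pos-+ (840 ℕ.* a n) 361) (cong (_+ + 361) (ℤₚ.pos-* 840 (a n))) ⟩
    + 840 * + a n + + 361 ∎
    where open ≡-Reasoning

  root-sign : ∀ n → sgn n ≡ χ₄ (root n) * ψ₃ (root n) * w (root n)
  root-sign n = trans (res-sign (ℕ.m%n<n n 16))
    (sym (cong₂ _*_ (cong₂ _*_ (periodic 4 105 1 3 (i₁ o r q)) (periodic 3 140 1 2 (i₂ o r q)))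
                    (periodic 35 12 26 19 (i₃ o r q))))
    where
    o = orient (n % 16)
    r = + res (n % 16)
    q = + (n / 16)
    root≡ : root n ≡ o * (r + + 420 * q)
    root≡ = cong (o *_) (trans (ℤₚ.pos-+ (res (n % 16)) (420 ℕ.* (n / 16))) (cong (_+_ r) (ℤₚ.pos-* 420 (n / 16))))
    periodic : ∀ m .{{_ : ℕ.NonZero m}} c x y → o * (r + + 420 * q) ≡ o * r + (+ c * (o * q)) * + m →
               char m x y (root n) ≡ char m x y (o * r)
    periodic m c x y eq = trans (cong (char m x y) (trans root≡ eq)) (char-periodic m x y (o * r) (+ c * (o * q)))
    i₁ : ∀ o r q → o * (r + + 420 * q) ≡ o * r + (+ 105 * (o * q)) * + 4
    i₁ = solve-∀
    i₂ : ∀ o r q → o * (r + + 420 * q) ≡ o * r + (+ 140 * (o * q)) * + 3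
    i₂ = solve-∀
    i₃ : ∀ o r q → o * (r + + 420 * q) ≡ o * r + (+ 12 * (o * q)) * + 35
    i₃ = solve-∀

  root-w≢0 : ∀ n → w (root n) ≢ + 0
  root-w≢0 n w≡0 = sgn≢0 (t n) (trans (root-sign n)
    (trans (cong (χ₄ (root n) * ψ₃ (root n) *_) w≡0) (ℤₚ.*-zeroʳ (χ₄ (root n) * ψ₃ (root n)))))
    where
    sgn≢0 : ∀ m → (- + 1) ℤ.^ m ≢ + 0
    sgn≢0 zero    ()
    sgn≢0 (suc m) eq = sgn≢0 m (ℤₚ.neg-injective (trans (sym (ℤₚ.-1*i≡-i ((- + 1) ℤ.^ m))) eq))

  -- The three conditions force `l² ≡ 361 (mod 840)`, so `∣ l ∣` is one of the `rootℕ n`; the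
  -- normalisation modulo 7 then rules out `root n = -l`.
  root-onto : ∀ l → χ₄ l ≢ + 0 → ψ₃ l ≢ + 0 → w l ≢ + 0 → ∃[ n ] root n ≡ l
  root-onto l χ≢0 ψ≢0 w≢0 = proj₁ found , choose (square-≡ (root (proj₁ found)) l (begin
    root (proj₁ found) * root (proj₁ found)
      ≡⟨ root²≡rootℕ² (proj₁ found) ⟩
    + (rootℕ (proj₁ found) ℕ.* rootℕ (proj₁ found))
      ≡⟨ cong (λ x → + (x ℕ.* x)) (proj₂ found) ⟩
    + (∣ l ∣ ℕ.* ∣ l ∣)
      ≡⟨ sym (square-abs l) ⟩
    l * l ∎))
    where
    open ≡-Reasoning
    r = l %ℕ 420
    q = l /ℕ 420
    l≡ : l ≡ + r + q * + 420
    l≡ = a≡a%ℕn+[a/ℕn]*n l 420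
    periodic : ∀ m .{{_ : ℕ.NonZero m}} c x y → + r + q * + 420 ≡ + r + (q * + c) * + m →
               char m x y l ≡ char m x y (+ r)
    periodic m c x y eq = trans (cong (char m x y) (trans l≡ eq)) (char-periodic m x y (+ r) (q * + c))
    i₁ : ∀ r q → r + q * + 420 ≡ r + (q * + 105) * + 4
    i₁ = solve-∀
    i₂ : ∀ r q → r + q * + 420 ≡ r + (q * + 140) * + 3
    i₂ = solve-∀
    i₃ : ∀ r q → r + q * + 420 ≡ r + (q * + 12) * + 35
    i₃ = solve-∀
    product-≢0 : ∀ x y → x ≢ + 0 → y ≢ + 0 → x * y ≢ + 0
    product-≢0 x y x≢0 y≢0 eq with ℤₚ.i*j≡0⇒i≡0∨j≡0 x eq
    ... | inj₁ x≡0 = x≢0 x≡0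
    ... | inj₂ y≡0 = y≢0 y≡0
    r²≡ : (r ℕ.* r) % 840 ≡ 361
    r²≡ with square-residue (n%ℕd<d l 420)
    ... | inj₁ eq = eq
    ... | inj₂ eq = ⊥-elim (product-≢0 (χ₄ l * ψ₃ l) (w l) (product-≢0 (χ₄ l) (ψ₃ l) χ≢0 ψ≢0) w≢0
      (trans (cong₂ _*_ (cong₂ _*_ (periodic 4 105 1 3 (i₁ (+ r) q)) (periodic 3 140 1 2 (i₂ (+ r) q)))
                        (periodic 35 12 26 19 (i₃ (+ r) q))) eq))
    i₄ : ∀ r q s t → r * r ≡ s + t * + 840 →
         (r + q * + 420) * (r + q * + 420) ≡ s + (t + r * q + + 210 * (q * q)) * + 840
    i₄ r q s t eq = trans (expand r q) (trans (cong (_+ (r * q + + 210 * (q * q)) * + 840) eq) (collect r q s t))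
      where
      expand : ∀ r q → (r + q * + 420) * (r + q * + 420) ≡ r * r + (r * q + + 210 * (q * q)) * + 840
      expand = solve-∀
      collect : ∀ r q s t → s + t * + 840 + (r * q + + 210 * (q * q)) * + 840
                          ≡ s + (t + r * q + + 210 * (q * q)) * + 840
      collect = solve-∀
    r²-quotient : ∃[ u ] + r * + r ≡ + 361 + u * + 840
    r²-quotient = quotient 840 361 (+ r * + r) (trans (cong (_%ℕ 840) (sym (ℤₚ.pos-* r r))) r²≡)
    l²≡ : (∣ l ∣ ℕ.* ∣ l ∣) % 840 ≡ 361
    l²≡ = trans (cong (_%ℕ 840) (sym (square-abs l)))
      (residue 840 361 (proj₁ r²-quotient + + r * q + + 210 * (q * q))
        (trans (cong (λ x → x * x) l≡) (i₄ (+ r) q (+ 361) (proj₁ r²-quotient) (proj₂ r²-quotient))))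
    found : ∃[ n ] rootℕ n ≡ ∣ l ∣
    found = rootℕ-onto ∣ l ∣ l²≡
    choose : root (proj₁ found) ≡ l ⊎ root (proj₁ found) ≡ - l → root (proj₁ found) ≡ l
    choose (inj₁ eq) = eq
    choose (inj₂ eq) = ⊥-elim (w-oriented (root (proj₁ found)) l (root-w≢0 (proj₁ found)) w≢0 eq)

  roots : Roots a
  roots = record
    { root = root ; root² = root² ; root-sign = root-sign ; root-onto = root-onto
    ; a-injective = increasing-injective a↑ ; n≤a = increasing-≥ a↑ }

-- Conclusion

⊛-cancel : ∀ A P Q D → P 0 ≡ + 1 → Q 0 ≡ + 1 → (A ⊛ P) ≗ ((Q ⊛ P) ⊛ D) → D ≗ (A ⊛ inv Q)
⊛-cancel A P Q D P₀ Q₀ eq n = sym (begin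
  (A ⊛ v) n
    ≡⟨ sym (⊛-identityʳ (A ⊛ v) n) ⟩
  ((A ⊛ v) ⊛ one) n
    ≡⟨ ⊛-congʳ (A ⊛ v) (λ m → sym (inverseʳ P P₀ m)) n ⟩
  ((A ⊛ v) ⊛ (P ⊛ u)) n
    ≡⟨ ⊛-interchange A v P u n ⟩
  ((A ⊛ P) ⊛ (v ⊛ u)) n
    ≡⟨ ⊛-congˡ (v ⊛ u) eq n ⟩
  (((Q ⊛ P) ⊛ D) ⊛ (v ⊛ u)) n
    ≡⟨ ⊛-congˡ (v ⊛ u) (⊛-comm (Q ⊛ P) D) n ⟩
  ((D ⊛ (Q ⊛ P)) ⊛ (v ⊛ u)) n
    ≡⟨ ⊛-assoc D (Q ⊛ P) (v ⊛ u) n ⟩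
  (D ⊛ ((Q ⊛ P) ⊛ (v ⊛ u))) n
    ≡⟨ ⊛-congʳ D unit n ⟩
  (D ⊛ one) n
    ≡⟨ ⊛-identityʳ D n ⟩
  D n ∎)
  where
  open ≡-Reasoning
  u = inv P
  v = inv Q
  unit : ((Q ⊛ P) ⊛ (v ⊛ u)) ≗ one
  unit m = trans (⊛-interchange Q P v u m)
          (trans (⊛-cong {Q ⊛ v} {one} {P ⊛ u} {one} (inverseʳ Q Q₀) (inverseʳ P P₀) m) (⊛-identityˡ one m))

prodBelow-cong-≈ : ∀ {N} {f g : ℕ → Series} → (∀ i → f i ≈[ N ] g i) → ∀ M → prodBelow f M ≈[ N ] prodBelow g M
prodBelow-cong-≈ p zero n n≤N = refl
prodBelow-cong-≈ {N} {f} {g} p (suc M) n n≤N =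
  trans (prodBelow-head f M n)
 (trans (⊛-cong-≈ {f 0} {g 0} {prodBelow (f ∘ suc) M} {prodBelow (g ∘ suc) M}
           (p 0) (prodBelow-cong-≈ (p ∘ suc) M) n n≤N)
        (sym (prodBelow-head g M n)))

-- Each exponent `m ≥ 1` is `suc r + L i` for exactly one `r < L`, so this is `(q;q)_∞` with its
-- factors sorted by residue. Taken with `L = 3` and `L = 5`, it links the theta series `η₃` to
-- `Q₅ ⊛ P₅`.
dissection : ∀ L .{{_ : ℕ.NonZero L}} → prodBelow (λ r → qPoch (suc r) L) L ≗ qPoch 1 1
dissection L N = begin
  prodBelow (λ r → qPoch (suc r) L) L N
    ≡⟨ prodBelow-cong-≈ (λ r → qPoch-finite (suc r) L N M (ℕₚ.n<1+n N)) L N ℕₚ.≤-refl ⟩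
  prodBelow (λ r → prodBelow (factors (suc r) L) M) L N
    ≡⟨ sym (prodBelow-swap (λ i r → h (r ℕ.+ L ℕ.* i)) L M N) ⟩
  prodBelow (λ i → prodBelow (λ r → h (r ℕ.+ L ℕ.* i)) L) M N
    ≡⟨ sym (prodBelow-blocks L h M N) ⟩
  prodBelow h (M ℕ.* L) N
    ≡⟨ prodBelow-cong (λ i m → cong (λ x → oneMinus (suc x) m) (sym (ℕₚ.*-identityˡ i))) (M ℕ.* L) N ⟩
  prodBelow (factors 1 1) (M ℕ.* L) N
    ≡⟨ sym (qPoch-finite 1 1 N (M ℕ.* L) (ℕₚ.≤-trans (ℕₚ.n<1+n N) (ℕₚ.m≤m*n M L)) N ℕₚ.≤-refl) ⟩
  qPoch 1 1 N ∎
  where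
  open ≡-Reasoning
  M = suc N
  h : ℕ → Series
  h i = oneMinus (suc i)

η₃ Q₅ P₅ P₇ : Series
η₃ = qPoch 1 3 ⊛ qPoch 2 3 ⊛ qPoch 3 3
Q₅ = qPoch 1 5 ⊛ qPoch 4 5
P₅ = qPoch 2 5 ⊛ qPoch 3 5 ⊛ qPoch 5 5
P₇ = qPoch 1 7 ⊛ qPoch 6 7 ⊛ qPoch 7 7

η₃≗Q₅⊛P₅ : η₃ ≗ (Q₅ ⊛ P₅)
η₃≗Q₅⊛P₅ n = begin
  ((x₁ ⊛ x₂) ⊛ x₃) n
    ≡⟨ ⊛-assoc x₁ x₂ x₃ n ⟩
  (x₁ ⊛ (x₂ ⊛ x₃)) n
    ≡⟨ ⊛-congʳ x₁ (⊛-congʳ x₂ (λ m → sym (⊛-identityʳ x₃ m))) n ⟩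
  (x₁ ⊛ (x₂ ⊛ (x₃ ⊛ one))) n
    ≡⟨ trans (dissection 3 n) (sym (dissection 5 n)) ⟩
  (y₁ ⊛ (y₂ ⊛ (y₃ ⊛ (y₄ ⊛ (y₅ ⊛ one))))) n
    ≡⟨ ⊛-congʳ y₁ inner n ⟩
  (y₁ ⊛ (y₄ ⊛ ((y₂ ⊛ y₃) ⊛ y₅))) n
    ≡⟨ sym (⊛-assoc y₁ y₄ ((y₂ ⊛ y₃) ⊛ y₅) n) ⟩
  (Q₅ ⊛ P₅) n ∎
  where
  open ≡-Reasoning
  x₁ x₂ x₃ y₁ y₂ y₃ y₄ y₅ : Series
  x₁ = qPoch 1 3
  x₂ = qPoch 2 3
  x₃ = qPoch 3 3
  y₁ = qPoch 1 5
  y₂ = qPoch 2 5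
  y₃ = qPoch 3 5
  y₄ = qPoch 4 5
  y₅ = qPoch 5 5
  inner : (y₂ ⊛ (y₃ ⊛ (y₄ ⊛ (y₅ ⊛ one)))) ≗ (y₄ ⊛ ((y₂ ⊛ y₃) ⊛ y₅))
  inner m = begin
    (y₂ ⊛ (y₃ ⊛ (y₄ ⊛ (y₅ ⊛ one)))) m
      ≡⟨ ⊛-congʳ y₂ (⊛-congʳ y₃ (⊛-congʳ y₄ (⊛-identityʳ y₅))) m ⟩
    (y₂ ⊛ (y₃ ⊛ (y₄ ⊛ y₅))) m
      ≡⟨ sym (⊛-assoc y₂ y₃ (y₄ ⊛ y₅) m) ⟩
    ((y₂ ⊛ y₃) ⊛ (y₄ ⊛ y₅)) m
      ≡⟨ ⊛-swap (y₂ ⊛ y₃) y₄ y₅ m ⟩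
    (y₄ ⊛ ((y₂ ⊛ y₃) ⊛ y₅)) m ∎

∑-extend : ∀ (f : ℕ → ℤ) M d → (∀ n → M ℕ.≤ n → f n ≡ + 0) → ∑ (upTo (d ℕ.+ M)) f ≡ ∑ (upTo M) f
∑-extend f M zero    z = refl
∑-extend f M (suc d) z =
  trans (∑-last f (d ℕ.+ M))
 (trans (cong₂ _+_ (∑-extend f M d z) (z (d ℕ.+ M) (ℕₚ.m≤n+m M d))) (ℤₚ.+-identityʳ _))

-- The list of indices in `lhsSeries` varies with the coefficient. As `a n ≥ n`, the indices between
-- `i` and `N` contribute nothing at `q^i`, and one list serves all coefficients up to `N`.
lhs-sparse : ∀ {a} → StrictlyIncreasing a → ∀ N → lhsSeries a ≈[ N ] sparse sgn a (upTo (suc N))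
lhs-sparse {a} a↑ N i i≤N = begin
  lhsSeries a i
    ≡⟨ ∑-cong term (upTo (suc i)) ⟩
  ∑ (upTo (suc i)) f
    ≡⟨ sym (∑-extend f (suc i) (N ℕ.∸ i) vanish) ⟩
  ∑ (upTo (N ℕ.∸ i ℕ.+ suc i)) f
    ≡⟨ cong (λ m → ∑ (upTo m) f) (trans (ℕₚ.+-suc (N ℕ.∸ i) i) (cong suc (ℕₚ.m∸n+n≡m i≤N))) ⟩
  ∑ (upTo (suc N)) f ∎
  where
  open ≡-Reasoning
  f : ℕ → ℤ
  f n = sgn n * mono (a n) i
  ≡ᵇ-sym : ∀ m n → (m ≡ᵇ n) ≡ (n ≡ᵇ m)
  ≡ᵇ-sym zero    zero    = refl
  ≡ᵇ-sym zero    (suc n) = refl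
  ≡ᵇ-sym (suc m) zero    = refl
  ≡ᵇ-sym (suc m) (suc n) = ≡ᵇ-sym m n
  select : ∀ b s → (if b then s else + 0) ≡ s * (if b then + 1 else + 0)
  select true  s = sym (ℤₚ.*-identityʳ s)
  select false s = sym (ℤₚ.*-zeroʳ s)
  term : ∀ n → (if a n ≡ᵇ i then sgn n else + 0) ≡ f n
  term n = trans (cong (λ b → if b then sgn n else + 0) (≡ᵇ-sym (a n) i)) (select (i ≡ᵇ a n) (sgn n))
  vanish : ∀ n → suc i ℕ.≤ n → f n ≡ + 0
  vanish n i<n = trans (cong (sgn n *_) (mono-low (ℕₚ.≤-trans i<n (increasing-≥ a↑ n)))) (ℤₚ.*-zeroʳ (sgn n))
    where
    mono-low : ∀ {e} → i ℕ.< e → mono e i ≡ + 0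
    mono-low {e} i<e = trans (sym (⊛-identityʳ (mono e) i)) (mono-⊛-low e one i<e)

opaque
  unfolding box

  box-sum : ∀ B f → ∑ (cartesianProduct (range B) (range B)) f ≡ ∑ (box B) f
  box-sum B f = refl

P₇⊛P₅ : ∀ {a} → StrictlyIncreasing a → (∀ m → IsSq (840 ℕ.* m ℕ.+ 361) ⇔ (∃[ n ] a n ≡ m)) →
        (P₇ ⊛ P₅) ≗ ((Q₅ ⊛ P₅) ⊛ lhsSeries a)
P₇⊛P₅ {a} a↑ enumerates N = begin
  (P₇ ⊛ P₅) N
    ≡⟨ ⊛-cong-at {P₇} {T₇.theta M} {P₅} {T₅.theta M} N
         (T₇.tripleProduct (N<bound N)) (T₅.tripleProduct (N<bound N)) ⟩
  (T₇.theta M ⊛ T₅.theta M) N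
    ≡⟨ sparse-⊛ parity T₇.expo parity T₅.expo (range M) (range M) N ⟩
  ∑ (cartesianProduct (range M) (range M)) (left N)
    ≡⟨ box-sum M (left N) ⟩
  ∑ (box M) (left N)
    ≡⟨ left≡right N ⟩
  ∑ (indices N) (right N)
    ≡⟨ sym (sparse-⊛ parity T₃.expo sgn a (range M) (upTo (suc N)) N) ⟩
  (T₃.theta M ⊛ sparse sgn a (upTo (suc N))) N
    ≡⟨ ⊛-cong-at {T₃.theta M} {η₃} {sparse sgn a (upTo (suc N))} {lhsSeries a} N
         (≈-sym {η₃} {T₃.theta M} (T₃.tripleProduct (N<bound N)))
         (≈-sym {lhsSeries a} {sparse sgn a (upTo (suc N))} (lhs-sparse a↑ N)) ⟩
  (η₃ ⊛ lhsSeries a) N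
    ≡⟨ ⊛-congˡ (lhsSeries a) η₃≗Q₅⊛P₅ N ⟩
  ((Q₅ ⊛ P₅) ⊛ lhsSeries a) N ∎
  where
  open ≡-Reasoning
  open RightSum a (Construction.roots a↑ enumerates)
  M = bound N

theorem1 : (a : ℕ → ℕ) → StrictlyIncreasing a →
           (∀ m → IsSq (840 ℕ.* m ℕ.+ 361) ⇔ (∃[ n ] a n ≡ m)) →
           ∀ N → lhsSeries a N ≡ rhsSeries N
theorem1 a a↑ enumerates = ⊛-cancel P₇ P₅ Q₅ (lhsSeries a) refl refl (P₇⊛P₅ a↑ enumerates)
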